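{- Let $\alpha\in\mathbb{R}$ be transcendental over $\mathbb{Q}$. Identify each element of $\mathbb{Q}(\alpha)$ with the unique rational function $r\in\mathbb{Q}(x)$ such that the element equals $r(\alpha)$, let $\mathbb{Q}(\alpha)^+$ be the set of those $r$ with $r(\alpha)>0$, and define $H_+=\{r\in \mathbb{Q}(\alpha)^+ : r'(\alpha)>0\}$, $H_0=\{r\in \mathbb{Q}(\alpha)^+ : r'(\alpha)=0\}$, $H_-=\{r\in \mathbb{Q}(\alpha)^+ : r'(\alpha)<0\}$. Then the only ways to write $\mathbb{Q}(\alpha)^+=A\sqcup B$ (unordered) with $A,B$ disjoint nonempty subsets each closed under addition and multiplication are $\mathbb{Q}(\alpha)^+=(H_+\cup H_0)\sqcup H_-$ and $\mathbb{Q}(\alpha)^+=H_+\sqcup(H_0\cup H_-)$. -}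

module Defs where

open import Data.List.Base using (List; []; _∷_; map)
open import Data.Nat.Base as ℕ using (ℕ; zero; suc)
import Data.Nat.Properties as ℕₚ
open import Data.Product.Base using (_×_; _,_; ∃-syntax; proj₁; proj₂)
open import Data.Rational
  using (ℚ; 0ℚ; 1ℚ; ½; _<_; _≤_; _+_; _*_; _-_; -_; ∣_∣; 1/_; NonZero;
         positive; nonNegative; ≢-nonZero; >-nonZero)
open import Data.Rational.Properties
open import Data.Rational.Solver using (module +-*-Solver)
open import Data.Sum.Base using (_⊎_; inj₁; inj₂; [_,_]′)
open import Function.Base using (_∘_)
open import Level using (0ℓ)
import Level
open import Relation.Binary.Core using (Rel)
open import Relation.Binary.Definitions using (_Respects_)
open import Relation.Binary.PropositionalEquality
  using (_≡_; refl; sym; trans; cong; cong₂; subst)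
open import Relation.Nullary using (¬_; yes; no; contradiction)
open import Relation.Unary using (Pred; _∪_; _⊥_; _≐_; Satisfiable)

open +-*-Solver using (solve; _:=_; _:+_; _:*_; _:-_; :-_; con)

------------------------------------------------------------------------
-- Real numbers: Cauchy sequences of rationals, up to the equality _≈ᵣ_.

IsCauchy : (ℕ → ℚ) → Set
IsCauchy x = ∀ ε → 0ℚ < ε →
  ∃[ N ] (∀ m n → N ℕ.≤ m → N ℕ.≤ n → ∣ x m - x n ∣ < ε)

record ℝ : Set where
  constructor mkℝ
  field
    seq      : ℕ → ℚ
    isCauchy : IsCauchy seq

open ℝ public

infix 4 _≈ᵣ_ _<ᵣ_ _#_

_≈ᵣ_ : Rel ℝ 0ℓ
x ≈ᵣ y = ∀ ε → 0ℚ < ε → ∃[ N ] (∀ n → N ℕ.≤ n → ∣ seq x n - seq y n ∣ < ε)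

_<ᵣ_ : Rel ℝ 0ℓ
x <ᵣ y = ∃[ ε ] (0ℚ < ε × ∃[ N ] (∀ n → N ℕ.≤ n → ε < seq y n - seq x n))

-- Inequality of reals in its positive form; classically the negation of _≈ᵣ_.
_#_ : Rel ℝ 0ℓ
x # y = x <ᵣ y ⊎ y <ᵣ x

m≤ : ∀ {a b n} → a ℕ.⊔ b ℕ.≤ n → a ℕ.≤ n
m≤ {a} {b} h = ℕₚ.≤-trans (ℕₚ.m≤m⊔n a b) h

n≤ : ∀ {a b n} → a ℕ.⊔ b ℕ.≤ n → b ℕ.≤ n
n≤ {a} {b} h = ℕₚ.≤-trans (ℕₚ.m≤n⊔m a b) h

*-pos : ∀ {p q} → 0ℚ < p → 0ℚ < q → 0ℚ < p * q
*-pos {p} {q} 0<p 0<q =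
  subst (_< p * q) (*-zeroʳ p) (*-monoʳ-<-pos p {{positive 0<p}} 0<q)

1/-pos : ∀ {p} (0<p : 0ℚ < p) → 0ℚ < (1/ p) {{>-nonZero 0<p}}
1/-pos {p} 0<p =
  positive⁻¹ ((1/ p) {{>-nonZero 0<p}}) {{1/pos⇒pos p {{positive 0<p}}}}

0<1 : 0ℚ < 1ℚ
0<1 = positive⁻¹ 1ℚ

const-cauchy : ∀ q → IsCauchy (λ _ → q)
const-cauchy q ε 0<ε =
  0 , λ _ _ _ _ → subst (_< ε) (sym (cong ∣_∣ (+-inverseʳ q))) 0<ε

+-cauchy : ∀ {x y} → IsCauchy x → IsCauchy y → IsCauchy (λ n → x n + y n)
+-cauchy {x} {y} cx cy ε 0<ε with cx (½ * ε) 0<ε/2 | cy (½ * ε) 0<ε/2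
  where
  0<ε/2 : 0ℚ < ½ * ε
  0<ε/2 = *-pos (positive⁻¹ ½) 0<ε
... | M , hM | N , hN = M ℕ.⊔ N , λ m n m≥ n≥ → begin-strict
  ∣ (x m + y m) - (x n + y n) ∣      ≡⟨ cong ∣_∣ (regroup (x m) (y m) (x n) (y n)) ⟩
  ∣ (x m - x n) + (y m - y n) ∣      ≤⟨ ∣p+q∣≤∣p∣+∣q∣ (x m - x n) (y m - y n) ⟩
  ∣ x m - x n ∣ + ∣ y m - y n ∣      <⟨ +-mono-< (hM m n (m≤ m≥) (m≤ n≥))
                                                 (hN m n (n≤ m≥) (n≤ n≥)) ⟩
  ½ * ε + ½ * ε                      ≡⟨ sym (*-distribʳ-+ ε ½ ½) ⟩
  1ℚ * ε                             ≡⟨ *-identityˡ ε ⟩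
  ε                                  ∎
  where
  open ≤-Reasoning
  regroup : ∀ a b c d → (a + b) - (c + d) ≡ (a - c) + (b - d)
  regroup = solve 4 (λ a b c d → (a :+ b) :- (c :+ d) := (a :- c) :+ (b :- d)) refl

eventually-bounded : ∀ {x} → IsCauchy x →
  ∃[ B ] (0ℚ < B × ∃[ N ] (∀ n → N ℕ.≤ n → ∣ x n ∣ ≤ B))
eventually-bounded {x} cx with cx 1ℚ 0<1
... | N , h = 1ℚ + ∣ x N ∣ , 0<B , N , λ n n≥ → begin
  ∣ x n ∣                      ≡⟨ cong ∣_∣ (regroup (x n) (x N)) ⟩
  ∣ (x n - x N) + x N ∣        ≤⟨ ∣p+q∣≤∣p∣+∣q∣ (x n - x N) (x N) ⟩
  ∣ x n - x N ∣ + ∣ x N ∣      ≤⟨ +-monoˡ-≤ ∣ x N ∣ (<⇒≤ (h n N n≥ ℕₚ.≤-refl)) ⟩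
  1ℚ + ∣ x N ∣                 ∎
  where
  open ≤-Reasoning
  0<B : 0ℚ < 1ℚ + ∣ x N ∣
  0<B = +-mono-<-≤ 0<1 (0≤∣p∣ (x N))
  regroup : ∀ a b → a ≡ (a - b) + b
  regroup = solve 2 (λ a b → a := (a :- b) :+ b) refl

*-mono-≤-< : ∀ {a b c d} → 0ℚ ≤ c → 0ℚ < b → a ≤ b → c < d → a * c < b * d
*-mono-≤-< {a} {b} {c} {d} 0≤c 0<b a≤b c<d =
  ≤-<-trans (*-monoʳ-≤-nonNeg c {{nonNegative 0≤c}} a≤b)
            (*-monoʳ-<-pos b {{positive 0<b}} c<d)

*-close : ∀ {B C δ} a b c d → 0ℚ < B → 0ℚ < C → ∣ a ∣ ≤ B → ∣ d ∣ ≤ C →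
  ∣ a - c ∣ < δ → ∣ b - d ∣ < δ → ∣ a * b - c * d ∣ < (B + C) * δ
*-close {B} {C} {δ} a b c d 0<B 0<C a≤B d≤C ac<δ bd<δ = begin-strict
  ∣ a * b - c * d ∣                          ≡⟨ cong ∣_∣ (regroup a b c d) ⟩
  ∣ a * (b - d) + d * (a - c) ∣              ≤⟨ ∣p+q∣≤∣p∣+∣q∣ (a * (b - d)) (d * (a - c)) ⟩
  ∣ a * (b - d) ∣ + ∣ d * (a - c) ∣          ≡⟨ cong₂ _+_ (∣p*q∣≡∣p∣*∣q∣ a (b - d))
                                                         (∣p*q∣≡∣p∣*∣q∣ d (a - c)) ⟩
  ∣ a ∣ * ∣ b - d ∣ + ∣ d ∣ * ∣ a - c ∣      <⟨ +-mono-< (*-mono-≤-< (0≤∣p∣ (b - d)) 0<B a≤B bd<δ)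
                                                         (*-mono-≤-< (0≤∣p∣ (a - c)) 0<C d≤C ac<δ) ⟩
  B * δ + C * δ                              ≡⟨ sym (*-distribʳ-+ δ B C) ⟩
  (B + C) * δ                                ∎
  where
  open ≤-Reasoning
  regroup : ∀ a b c d → a * b - c * d ≡ a * (b - d) + d * (a - c)
  regroup = solve 4 (λ a b c d →
    a :* b :- c :* d := a :* (b :- d) :+ d :* (a :- c)) refl

*-1/-cancel : ∀ S ε (0<S : 0ℚ < S) → S * ((1/ S) {{>-nonZero 0<S}} * ε) ≡ ε
*-1/-cancel S ε 0<S = trans (sym (*-assoc S ((1/ S) {{>-nonZero 0<S}}) ε))
  (trans (cong (_* ε) (*-inverseʳ S {{>-nonZero 0<S}})) (*-identityˡ ε))

*-cauchy : ∀ {x y} → IsCauchy x → IsCauchy y → IsCauchy (λ n → x n * y n)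
*-cauchy {x} {y} cx cy ε 0<ε =
  let B , 0<B , K , hB = eventually-bounded {x} cx
      C , 0<C , L , hC = eventually-bounded {y} cy
      0<S = +-mono-< 0<B 0<C
      δ   = (1/ (B + C)) {{>-nonZero 0<S}} * ε
      0<δ = *-pos (1/-pos 0<S) 0<ε
      M , hM = cx δ 0<δ
      N , hN = cy δ 0<δ
  in (K ℕ.⊔ L) ℕ.⊔ (M ℕ.⊔ N) , λ m n m≥ n≥ →
     subst (∣ x m * y m - x n * y n ∣ <_) (*-1/-cancel (B + C) ε 0<S)
       (*-close (x m) (y m) (x n) (y n) 0<B 0<C
         (hB m (m≤ {K} {L} (m≤ {K ℕ.⊔ L} {M ℕ.⊔ N} m≥)))
         (hC n (n≤ {K} {L} (m≤ {K ℕ.⊔ L} {M ℕ.⊔ N} n≥)))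
         (hM m n (m≤ {M} {N} (n≤ {K ℕ.⊔ L} {M ℕ.⊔ N} m≥))
                 (m≤ {M} {N} (n≤ {K ℕ.⊔ L} {M ℕ.⊔ N} n≥)))
         (hN m n (n≤ {M} {N} (n≤ {K ℕ.⊔ L} {M ℕ.⊔ N} m≥))
                 (n≤ {M} {N} (n≤ {K ℕ.⊔ L} {M ℕ.⊔ N} n≥))))

0ᵣ : ℝ
0ᵣ = mkℝ (λ _ → 0ℚ) (const-cauchy 0ℚ)

constᵣ : ℚ → ℝ
constᵣ q = mkℝ (λ _ → q) (const-cauchy q)

infixl 6 _+ᵣ_
infixl 7 _*ᵣ_

_+ᵣ_ : ℝ → ℝ → ℝ
mkℝ x cx +ᵣ mkℝ y cy = mkℝ (λ n → x n + y n) (+-cauchy {x} {y} cx cy)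

_*ᵣ_ : ℝ → ℝ → ℝ
mkℝ x cx *ᵣ mkℝ y cy = mkℝ (λ n → x n * y n) (*-cauchy {x} {y} cx cy)

-- Totalised by 1/0 = 0, so that a sequence can be inverted termwise: a real apart
-- from 0 has only finitely many zero terms, which do not affect its inverse.
invℚ : ℚ → ℚ
invℚ q with q ≟ 0ℚ
... | yes _   = 0ℚ
... | no q≢0  = (1/ q) {{≢-nonZero q≢0}}

*-invℚ : ∀ q → 0ℚ < ∣ q ∣ → q * invℚ q ≡ 1ℚ
*-invℚ q 0<∣q∣ with q ≟ 0ℚ
... | yes refl = contradiction 0<∣q∣ (<-irrefl refl)
... | no q≢0   = *-inverseʳ q {{≢-nonZero q≢0}}

p≤∣p∣ : ∀ p → p ≤ ∣ p ∣
p≤∣p∣ p with ≤-total 0ℚ p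
... | inj₁ 0≤p = ≤-reflexive (sym (0≤p⇒∣p∣≡p 0≤p))
... | inj₂ p≤0 = ≤-trans p≤0 (0≤∣p∣ p)

bounded-away : ∀ x → x # 0ᵣ →
  ∃[ δ ] (0ℚ < δ × ∃[ N ] (∀ n → N ℕ.≤ n → δ < ∣ seq x n ∣))
bounded-away x (inj₁ (δ , 0<δ , N , h)) = δ , 0<δ , N , λ n n≥ →
  <-≤-trans (h n n≥) (≤-trans (p≤∣p∣ (0ℚ - seq x n))
    (≤-reflexive (trans (cong ∣_∣ (+-identityˡ (- seq x n))) (∣-p∣≡∣p∣ (seq x n)))))
bounded-away x (inj₂ (δ , 0<δ , N , h)) = δ , 0<δ , N , λ n n≥ →
  <-≤-trans (h n n≥) (≤-trans (p≤∣p∣ (seq x n - 0ℚ))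
    (≤-reflexive (cong ∣_∣ (+-identityʳ (seq x n)))))

inv-cauchy : ∀ x → x # 0ᵣ → IsCauchy (invℚ ∘ seq x)
inv-cauchy (mkℝ x cx) x#0 ε 0<ε with bounded-away (mkℝ x cx) x#0
... | δ , 0<δ , K , hδ = K ℕ.⊔ N , λ m n m≥ n≥ →
  let u = invℚ (x m) ; v = invℚ (x n)
      0<∣xm∣ = <-trans 0<δ (hδ m (m≤ m≥)) ; 0<∣xn∣ = <-trans 0<δ (hδ n (m≤ n≥))
  in begin-strict
  ∣ u - v ∣
    ≡⟨ cong ∣_∣ (sym (cong₂ _-_ (*-identityʳ u) (*-identityʳ v))) ⟩
  ∣ u * 1ℚ - v * 1ℚ ∣
    ≡⟨ cong ∣_∣ (cong₂ (λ s t → u * s - v * t) (sym (*-invℚ (x n) 0<∣xn∣))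
                                                (sym (*-invℚ (x m) 0<∣xm∣))) ⟩
  ∣ u * (x n * v) - v * (x m * u) ∣
    ≡⟨ cong ∣_∣ (regroup u v (x m) (x n)) ⟩
  ∣ (u * v) * (x n - x m) ∣
    ≡⟨ trans (∣p*q∣≡∣p∣*∣q∣ (u * v) (x n - x m))
             (cong (_* ∣ x n - x m ∣) (∣p*q∣≡∣p∣*∣q∣ u v)) ⟩
  (∣ u ∣ * ∣ v ∣) * ∣ x n - x m ∣
    <⟨ *-mono-≤-< (0≤∣p∣ (x n - x m)) (*-pos 0<D 0<D)
         (≤-trans (*-monoʳ-≤-nonNeg ∣ v ∣ {{∣-∣-nonNeg v}} (∣inv∣≤D (x m) (hδ m (m≤ m≥))))
                  (*-monoˡ-≤-nonNeg D {{nonNegative (<⇒≤ 0<D)}}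
                     (∣inv∣≤D (x n) (hδ n (m≤ n≥)))))
         (hN n m (n≤ n≥) (n≤ m≥)) ⟩
  (D * D) * ((δ * δ) * ε)   ≡⟨ regroup′ D δ ε ⟩
  ((δ * D) * (δ * D)) * ε   ≡⟨ cong (λ t → (t * t) * ε) δ*D≡1 ⟩
  (1ℚ * 1ℚ) * ε             ≡⟨ *-identityˡ ε ⟩
  ε                         ∎
  where
  open ≤-Reasoning
  D : ℚ
  D = (1/ δ) {{>-nonZero 0<δ}}
  0<D : 0ℚ < D
  0<D = 1/-pos 0<δ
  δ*D≡1 : δ * D ≡ 1ℚ
  δ*D≡1 = *-inverseʳ δ {{>-nonZero 0<δ}}
  0<η : 0ℚ < (δ * δ) * ε
  0<η = *-pos (*-pos 0<δ 0<δ) 0<ε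
  N = proj₁ (cx ((δ * δ) * ε) 0<η)
  hN = proj₂ (cx ((δ * δ) * ε) 0<η)
  regroup : ∀ u v a b → u * (b * v) - v * (a * u) ≡ (u * v) * (b - a)
  regroup = solve 4 (λ u v a b →
    u :* (b :* v) :- v :* (a :* u) := (u :* v) :* (b :- a)) refl
  regroup′ : ∀ d e c → (d * d) * ((e * e) * c) ≡ ((e * d) * (e * d)) * c
  regroup′ = solve 3 (λ d e c →
    (d :* d) :* ((e :* e) :* c) := ((e :* d) :* (e :* d)) :* c) refl
  ∣inv∣≤D : ∀ q → δ < ∣ q ∣ → ∣ invℚ q ∣ ≤ D
  ∣inv∣≤D q δ<q = begin
    ∣ w ∣                   ≡⟨ sym (*-identityˡ ∣ w ∣) ⟩
    1ℚ * ∣ w ∣              ≡⟨ cong (_* ∣ w ∣) (sym (trans (*-comm D δ) δ*D≡1)) ⟩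
    (D * δ) * ∣ w ∣         ≡⟨ *-assoc D δ ∣ w ∣ ⟩
    D * (δ * ∣ w ∣)         ≤⟨ *-monoˡ-≤-nonNeg D {{nonNegative (<⇒≤ 0<D)}}
                                 (*-monoʳ-≤-nonNeg ∣ w ∣ {{∣-∣-nonNeg w}} (<⇒≤ δ<q)) ⟩
    D * (∣ q ∣ * ∣ w ∣)     ≡⟨ cong (D *_) (trans (sym (∣p*q∣≡∣p∣*∣q∣ q w))
                                 (cong ∣_∣ (*-invℚ q (<-trans 0<δ δ<q)))) ⟩
    D * 1ℚ                  ≡⟨ *-identityʳ D ⟩
    D                       ∎
    where w = invℚ q

invᵣ : (x : ℝ) → x # 0ᵣ → ℝ
invᵣ x x#0 = mkℝ (invℚ ∘ seq x) (inv-cauchy x x#0)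

------------------------------------------------------------------------
-- Polynomials over ℚ: coefficient lists, constant term first.  Trailing zeros
-- are allowed, so polynomials are compared by _≈ₚ_.

Poly : Set
Poly = List ℚ

coeff : Poly → ℕ → ℚ
coeff []      _       = 0ℚ
coeff (a ∷ p) zero    = a
coeff (a ∷ p) (suc i) = coeff p i

infix 4 _≈ₚ_

_≈ₚ_ : Rel Poly 0ℓ
p ≈ₚ q = ∀ i → coeff p i ≡ coeff q i

0ₚ : Poly
0ₚ = []

infixl 6 _+ₚ_ _-ₚ_
infixl 7 _*ₚ_ _·ₚ_

_+ₚ_ : Poly → Poly → Poly
[]      +ₚ q       = q
(a ∷ p) +ₚ []      = a ∷ p
(a ∷ p) +ₚ (b ∷ q) = a + b ∷ p +ₚ q

_·ₚ_ : ℚ → Poly → Poly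
a ·ₚ p = map (a *_) p

_-ₚ_ : Poly → Poly → Poly
p -ₚ q = p +ₚ (- 1ℚ) ·ₚ q

-- (a + x·p)·q = a·q + x·(p·q)
_*ₚ_ : Poly → Poly → Poly
[]      *ₚ q = 0ₚ
(a ∷ p) *ₚ q = a ·ₚ q +ₚ (0ℚ ∷ p *ₚ q)

-- (a + x·p)′ = p + x·p′
derivₚ : Poly → Poly
derivₚ []      = 0ₚ
derivₚ (a ∷ p) = p +ₚ (0ℚ ∷ derivₚ p)

evalₚ : Poly → ℝ → ℝ
evalₚ []      α = 0ᵣ
evalₚ (a ∷ p) α = constᵣ a +ᵣ α *ᵣ evalₚ p α

coeff-+ : ∀ p q i → coeff (p +ₚ q) i ≡ coeff p i + coeff q i
coeff-+ []      q       i       = sym (+-identityˡ (coeff q i))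
coeff-+ (a ∷ p) []      i       = sym (+-identityʳ (coeff (a ∷ p) i))
coeff-+ (a ∷ p) (b ∷ q) zero    = refl
coeff-+ (a ∷ p) (b ∷ q) (suc i) = coeff-+ p q i

coeff-· : ∀ a p i → coeff (a ·ₚ p) i ≡ a * coeff p i
coeff-· a []      i       = sym (*-zeroʳ a)
coeff-· a (b ∷ p) zero    = refl
coeff-· a (b ∷ p) (suc i) = coeff-· a p i

coeff-*₀ : ∀ a p b q → coeff ((a ∷ p) *ₚ (b ∷ q)) 0 ≡ a * b
coeff-*₀ a p b q = +-identityʳ (a * b)

0∷-* : ∀ {a} p q → a ≡ 0ℚ → (a ∷ p) *ₚ q ≈ₚ 0ℚ ∷ p *ₚ q
0∷-* p q refl i = trans (coeff-+ (0ℚ ·ₚ q) (0ℚ ∷ p *ₚ q) i)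
  (trans (cong (_+ c) (trans (coeff-· 0ℚ q i) (*-zeroˡ (coeff q i)))) (+-identityˡ c))
  where c = coeff (0ℚ ∷ p *ₚ q) i

*-0∷ : ∀ {b} p q → b ≡ 0ℚ → p *ₚ (b ∷ q) ≈ₚ 0ℚ ∷ p *ₚ q
*-0∷ []      q _    zero    = refl
*-0∷ []      q _    (suc i) = refl
*-0∷ (a ∷ p) q refl zero    = trans (+-identityʳ (a * 0ℚ)) (*-zeroʳ a)
*-0∷ (a ∷ p) q refl (suc i) =
  trans (coeff-+ (a ·ₚ q) (p *ₚ (0ℚ ∷ q)) i)
    (trans (cong (coeff (a ·ₚ q) i +_) (*-0∷ p q refl i))
           (sym (coeff-+ (a ·ₚ q) (0ℚ ∷ p *ₚ q) i)))

p*q≡0 : ∀ p q → p * q ≡ 0ℚ → p ≡ 0ℚ ⊎ q ≡ 0ℚ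
p*q≡0 p q pq≡0 with p ≟ 0ℚ
... | yes p≡0 = inj₁ p≡0
... | no p≢0  = inj₂ (trans (sym (*-identityˡ q))
  (trans (cong (_* q) (sym (*-inverseˡ p)))
  (trans (*-assoc (1/ p) p q) (trans (cong ((1/ p) *_) pq≡0) (*-zeroʳ (1/ p))))))
  where
  instance
    p-nonZero : NonZero p
    p-nonZero = ≢-nonZero p≢0

0∷≈0 : ∀ {a p} → a ≡ 0ℚ → p ≈ₚ 0ₚ → a ∷ p ≈ₚ 0ₚ
0∷≈0 a≡0 p≈0 zero    = a≡0
0∷≈0 a≡0 p≈0 (suc i) = p≈0 i

*ₚ≈0 : ∀ p q → p *ₚ q ≈ₚ 0ₚ → p ≈ₚ 0ₚ ⊎ q ≈ₚ 0ₚ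
*ₚ≈0 []      q       _    = inj₁ λ _ → refl
*ₚ≈0 (a ∷ p) []      _    = inj₂ λ _ → refl
*ₚ≈0 (a ∷ p) (b ∷ q) pq≈0 =
  [ (λ a≡0 → [ inj₁ ∘ 0∷≈0 a≡0 , inj₂ ]′ (*ₚ≈0 p (b ∷ q) λ i →
      trans (sym (0∷-* p (b ∷ q) a≡0 (suc i))) (pq≈0 (suc i))))
  , (λ b≡0 → [ inj₁ , inj₂ ∘ 0∷≈0 b≡0 ]′ (*ₚ≈0 (a ∷ p) q λ i →
      trans (sym (*-0∷ (a ∷ p) q b≡0 (suc i))) (pq≈0 (suc i))))
  ]′ (p*q≡0 a b (trans (sym (coeff-*₀ a p b q)) (pq≈0 0)))

*ₚ-≉0 : ∀ {p q} → ¬ p ≈ₚ 0ₚ → ¬ q ≈ₚ 0ₚ → ¬ p *ₚ q ≈ₚ 0ₚ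
*ₚ-≉0 {p} {q} p≉0 q≉0 = [ p≉0 , q≉0 ]′ ∘ *ₚ≈0 p q

------------------------------------------------------------------------
-- The field ℚ(x): fractions of polynomials, not necessarily reduced, up to the
-- equality _≈_.

record RatFun : Set where
  constructor mkRatFun
  field
    num   : Poly
    den   : Poly
    den≉0 : ¬ den ≈ₚ 0ₚ

open RatFun public

infix  4 _≈_
infixl 6 _⊕_
infixl 7 _⊗_

_≈_ : Rel RatFun 0ℓ
r ≈ s = num r *ₚ den s ≈ₚ num s *ₚ den r

_⊕_ : RatFun → RatFun → RatFun
mkRatFun n d d≉0 ⊕ mkRatFun m e e≉0 =
  mkRatFun (n *ₚ e +ₚ m *ₚ d) (d *ₚ e) (*ₚ-≉0 {d} {e} d≉0 e≉0)

_⊗_ : RatFun → RatFun → RatFun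
mkRatFun n d d≉0 ⊗ mkRatFun m e e≉0 =
  mkRatFun (n *ₚ m) (d *ₚ e) (*ₚ-≉0 {d} {e} d≉0 e≉0)

deriv : RatFun → RatFun
deriv (mkRatFun n d d≉0) =
  mkRatFun (derivₚ n *ₚ d -ₚ n *ₚ derivₚ d) (d *ₚ d) (*ₚ-≉0 {d} {d} d≉0 d≉0)

-- "p(α) ≠ 0" is read with the inequality of reals, as the division by den r at α
-- in eval requires.
Transcendental : ℝ → Set
Transcendental α = ∀ p → ¬ p ≈ₚ 0ₚ → evalₚ p α # 0ᵣ

module _ (α : ℝ) (tr : Transcendental α) where

  eval : RatFun → ℝ
  eval r = evalₚ (num r) α *ᵣ invᵣ (evalₚ (den r) α) (tr (den r) (den≉0 r))

  -- ℚ(α)⁺, each element of ℚ(α) being identified with its rational function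
  ℚ⟨α⟩⁺ : Pred RatFun 0ℓ
  ℚ⟨α⟩⁺ r = 0ᵣ <ᵣ eval r

  H₊ H₀ H₋ : Pred RatFun 0ℓ
  H₊ r = ℚ⟨α⟩⁺ r × 0ᵣ <ᵣ eval (deriv r)
  H₀ r = ℚ⟨α⟩⁺ r × eval (deriv r) ≈ᵣ 0ᵣ
  H₋ r = ℚ⟨α⟩⁺ r × eval (deriv r) <ᵣ 0ᵣ

ClosedUnder : ∀ {ℓ} → (RatFun → RatFun → RatFun) → Pred RatFun ℓ → Set ℓ
ClosedUnder _∙_ A = ∀ {r s} → A r → A s → A (r ∙ s)

-- A predicate is a subset of ℚ(x) only if it respects _≈_.
record IsDecomposition {ℓ₁ ℓ₂} (P : Pred RatFun 0ℓ)
                       (A : Pred RatFun ℓ₁) (B : Pred RatFun ℓ₂) :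
                       Set (ℓ₁ Level.⊔ ℓ₂) where
  field
    A-resp-≈   : A Respects _≈_
    B-resp-≈   : B Respects _≈_
    union      : A ∪ B ≐ P
    disjoint   : A ⊥ B
    A-nonempty : Satisfiable A
    B-nonempty : Satisfiable B
    A-closed-⊕ : ClosedUnder _⊕_ A
    A-closed-⊗ : ClosedUnder _⊗_ A
    B-closed-⊕ : ClosedUnder _⊕_ B
    B-closed-⊗ : ClosedUnder _⊗_ B

SameUnorderedPair : ∀ {ℓ₁ ℓ₂ ℓ₃ ℓ₄} →
  Pred RatFun ℓ₁ → Pred RatFun ℓ₂ → Pred RatFun ℓ₃ → Pred RatFun ℓ₄ →
  Set (ℓ₁ Level.⊔ ℓ₂ Level.⊔ ℓ₃ Level.⊔ ℓ₄)
SameUnorderedPair A B C D = (A ≐ C × B ≐ D) ⊎ (A ≐ D × B ≐ C)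

{-# OPTIONS --safe #-}
module Submission where

open import Defs

open import Algebra.Bundles using (CommutativeRing; RawRing)
import Algebra.Morphism.RingMonomorphism as RingMonomorphism
open import Algebra.Morphism.Structures using (IsRingMonomorphism)
import Algebra.Solver.Ring
open import Algebra.Solver.Ring.AlmostCommutativeRing
  using (fromCommutativeRing; _-Raw-AlmostCommutative⟶_)
open import Algebra.Structures using (IsCommutativeRing)
open import Data.Empty using (⊥)
import Data.Integer.Base as ℤ
open import Data.Integer.Solver using () renaming (module +-*-Solver to ℤSolver)
open import Data.List.Base using ([]; _∷_)
open import Data.Maybe.Base using (Maybe; just; nothing)
open import Data.Nat.Base as ℕ using (ℕ; zero; suc)
import Data.Nat.Properties as ℕₚ
open import Data.Product.Base using (_×_; _,_; ∃-syntax; proj₁; proj₂; map₂; swap)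
open import Data.Rational.Base as ℚ using (ℚ; mkℚ; 0ℚ; 1ℚ; ½)
import Data.Rational.Properties as ℚₚ
open import Data.Rational.Solver using () renaming (module +-*-Solver to ℚSolver)
import Data.Rational.Unnormalised.Base as ℚᵘ
import Data.Rational.Unnormalised.Properties as ℚᵘₚ
open import Data.Sum.Base as Sum using (_⊎_; inj₁; inj₂; [_,_]′)
open import Function.Base using (_∘_; id)
open import Level using (Level; 0ℓ; _⊔_)
open import Relation.Binary.Definitions using (tri<; tri≈; tri>; _Respects_)
open import Relation.Binary.PropositionalEquality as ≡ using (_≡_)
open import Relation.Nullary using (¬_; Dec; yes; no; contradiction)
open import Relation.Unary using (Pred; Satisfiable; _∪_; _≐_)
open import Relation.Unary.Properties using (≐-trans)

-- Let 1 ∈ A.  Then A contains ℚ⁺, and the class of x is invariant under adding rationals (as long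
-- as the result is positive), so that A and B partition the whole field modulo ℚ.  If neither α
-- nor - α lies in B modulo ℚ, then the x for which both x and - x are in A modulo ℚ form a
-- subfield containing α, and B is empty.  Otherwise let β = ± α be in B modulo ℚ and δ = ± d/dα,
-- so that δβ = 1.  Call x tame if x + tβ is in B modulo ℚ for rational t > - δx and in A modulo ℚ
-- for t < - δx.  Tame elements form a subring containing ℚ and β, hence all polynomials; the crux
-- is that they are closed under squares.  Passing to quotients, the sign of δ decides the class of
-- every r with δr ≠ 0, while the r with δr = 0 are constant and lie in A.

-- Modulo ℚ both classes are closed under sums and positive rational multiples on the whole field,
-- with no sign to check. The price is multiplication: only positive representatives may be
-- multiplied, and replacing `x`, `y` by `x + p`, `y + q` adds cross terms to the product. This is
-- why squares of tame elements are hard.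
--
-- Tameness passes to products but is not shown to pass to inverses. A quotient `R` with positive
-- tame denominator `w` is instead tested against a factor `W = w * e`, where `δ W` has the sign
-- opposite to `δ R`. For a rational `c` just below `R` the element `(R - c) * W` is tame and its
-- derivative has the sign of `δ R`, whereas the wrong class for `R` would also be that of `R - c`
-- and of `W`, hence of the product.
--
-- The argument needs no excluded middle: `cover` decides the class of every positive element, so
-- membership in one class may be proved by refuting the other.

ℚ-rawRing : RawRing 0ℓ 0ℓ
ℚ-rawRing = CommutativeRing.rawRing ℚₚ.+-*-commutativeRing

-- Rational numbers: clearing denominators and the Archimedean property.

ℕ→ℚ : ℕ → ℚ
ℕ→ℚ zero    = 0ℚ
ℕ→ℚ (suc n) = 1ℚ ℚ.+ ℕ→ℚ n

0≤ℕ→ℚ : ∀ n → 0ℚ ℚ.≤ ℕ→ℚ n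
0≤ℕ→ℚ zero    = ℚₚ.≤-refl
0≤ℕ→ℚ (suc n) = ℚₚ.+-mono-≤ (ℚₚ.<⇒≤ 0<1) (0≤ℕ→ℚ n)

ℕ→ℚ-toℚᵘ : ∀ n → ℚ.toℚᵘ (ℕ→ℚ n) ℚᵘ.≃ ℚᵘ.mkℚᵘ (ℤ.+ n) 0
ℕ→ℚ-toℚᵘ zero    = ℚᵘ.*≡* ≡.refl
ℕ→ℚ-toℚᵘ (suc n) = ℚᵘₚ.≃-trans (ℚₚ.toℚᵘ-homo-+ 1ℚ (ℕ→ℚ n))
  (ℚᵘₚ.≃-trans (ℚᵘₚ.+-congʳ ℚᵘ.1ℚᵘ (ℕ→ℚ-toℚᵘ n))
    (ℚᵘ.*≡* (ℤSolver.solve 1 (λ n → let 1′ = ℤSolver.con ℤ.1ℤ in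
      (1′ :* 1′ :+ n :* 1′) :* 1′ := (1′ :+ n) :* (1′ :* 1′)) ≡.refl (ℤ.+ n))))
  where open ℤSolver

-- The successors on both sides matter: the repeated sums formed from this identity must have at
-- least one term, since an empty sum would be 0, which is in neither class.
clear-denominator : ∀ {q} → 0ℚ ℚ.< q →
  ∃[ k ] ∃[ m ] ℕ→ℚ (suc k) ℚ.* q ≡ ℕ→ℚ (suc m)
clear-denominator {mkℚ (ℤ.+ 0)     k c} (ℚ.*<* (ℤ.+<+ ()))
clear-denominator {mkℚ (ℤ.+ suc m) k c} 0<q = k , m , ℚₚ.toℚᵘ-injective (
  ℚᵘₚ.≃-trans (ℚₚ.toℚᵘ-homo-* (ℕ→ℚ (suc k)) (mkℚ (ℤ.+ suc m) k c))
  (ℚᵘₚ.≃-trans (ℚᵘₚ.*-congʳ (ℕ→ℚ-toℚᵘ (suc k)))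
  (ℚᵘₚ.≃-trans (ℚᵘ.*≡* (ℤSolver.solve 2 (λ k m → let 1′ = ℤSolver.con ℤ.1ℤ in
      (k :* m) :* 1′ := m :* (1′ :* k)) ≡.refl (ℤ.+ suc k) (ℤ.+ suc m)))
    (ℚᵘₚ.≃-sym (ℕ→ℚ-toℚᵘ (suc m))))))
  where open ℤSolver

p<q⇒0<q-p : ∀ {p q} → p ℚ.< q → 0ℚ ℚ.< q ℚ.- p
p<q⇒0<q-p {p} {q} p<q = ≡.subst (ℚ._< q ℚ.- p) (ℚₚ.+-inverseʳ p) (ℚₚ.+-monoˡ-< (ℚ.- p) p<q)

archimedean : ∀ {c q} → 0ℚ ℚ.< c → 0ℚ ℚ.< q → ∃[ n ] q ℚ.< ℕ→ℚ n ℚ.* c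
archimedean {c} {q} 0<c 0<q with clear-denominator (*-pos (1/-pos 0<c) 0<q)
-- The quotient `r = q / c` satisfies `r ≤ (k + 1) * r = m + 1`, so `m + 1` copies of `c` reach `q`,
-- and one more makes the inequality strict.
... | k , m , eq = suc (suc m) , (begin-strict
  q                         ≡⟨ *-1/-cancel c q 0<c ⟨
  c ℚ.* r                   ≡⟨ ℚₚ.*-comm c r ⟩
  r ℚ.* c                   ≡⟨ ≡.cong (ℚ._* c) (ℚₚ.*-identityˡ r) ⟨
  1ℚ ℚ.* r ℚ.* c            ≤⟨ ℚₚ.*-monoʳ-≤-nonNeg c {{ℚ.nonNegative (ℚₚ.<⇒≤ 0<c)}}
                                 (ℚₚ.*-monoʳ-≤-nonNeg r {{ℚ.nonNegative (ℚₚ.<⇒≤ 0<r)}}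
                                   (ℚₚ.+-monoʳ-≤ 1ℚ (0≤ℕ→ℚ k))) ⟩
  ℕ→ℚ (suc k) ℚ.* r ℚ.* c   ≡⟨ ≡.cong (ℚ._* c) eq ⟩
  ℕ→ℚ (suc m) ℚ.* c         ≡⟨ ℚₚ.+-identityˡ _ ⟨
  0ℚ ℚ.+ ℕ→ℚ (suc m) ℚ.* c  <⟨ ℚₚ.+-monoˡ-< (ℕ→ℚ (suc m) ℚ.* c) 0<c ⟩
  c ℚ.+ ℕ→ℚ (suc m) ℚ.* c   ≡⟨ ≡.cong (ℚ._+ ℕ→ℚ (suc m) ℚ.* c) (ℚₚ.*-identityˡ c) ⟨
  1ℚ ℚ.* c ℚ.+ ℕ→ℚ (suc m) ℚ.* c ≡⟨ ℚₚ.*-distribʳ-+ c 1ℚ (ℕ→ℚ (suc m)) ⟨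
  ℕ→ℚ (suc (suc m)) ℚ.* c   ∎)
  where
  open ℚₚ.≤-Reasoning
  r = (ℚ.1/ c) {{ℚ.>-nonZero 0<c}} ℚ.* q
  0<r = *-pos (1/-pos 0<c) 0<q

-- Ordered structures in which the rationals are dense.

-- An abstract ℚ(α): the embedding into ℝ enters through the cone `Pos`, its trichotomy and the
-- density of ℚ. Inverses of positive elements enter separately, as the hypothesis `inverse` of
-- `Classification`.
record DenseOrderedField : Set₁ where
  field
    commutativeRing : CommutativeRing 0ℓ 0ℓ

  open CommutativeRing commutativeRing public
    renaming (_≈_ to _≃_; refl to ≃-refl; sym to ≃-sym; trans to ≃-trans)
    hiding (zero)

  field
    ι           : ℚ → Carrier
    ι-+         : ∀ p q → ι (p ℚ.+ q) ≃ ι p + ι q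
    ι-*         : ∀ p q → ι (p ℚ.* q) ≃ ι p * ι q
    ι-neg       : ∀ q → ι (ℚ.- q) ≃ - ι q
    ι-0         : ι 0ℚ ≃ 0#
    ι-1         : ι 1ℚ ≃ 1#
    Pos         : Pred Carrier 0ℓ
    Pos-resp    : Pos Respects _≃_
    Pos-+       : ∀ {x y} → Pos x → Pos y → Pos (x + y)
    Pos-*       : ∀ {x y} → Pos x → Pos y → Pos (x * y)
    Pos-ι       : ∀ {q} → 0ℚ ℚ.< q → Pos (ι q)
    ¬Pos-0      : ¬ Pos 0#
    trichotomy  : ∀ x → Pos x ⊎ x ≃ 0# ⊎ Pos (- x)
    dense       : ∀ x y → Pos (y - x) → ∃[ q ] (Pos (ι q - x) × Pos (y - ι q))

module Bipartitions (K : DenseOrderedField) where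
  open DenseOrderedField K

  private
    ι-morphism : ℚ-rawRing -Raw-AlmostCommutative⟶ fromCommutativeRing commutativeRing
    ι-morphism = record
      { ⟦_⟧    = ι
      ; +-homo = ι-+
      ; *-homo = ι-*
      ; -‿homo = ι-neg
      ; 0-homo = ι-0
      ; 1-homo = ι-1
      }

    ι-coeff≟ : ∀ p q → Maybe (ι p ≃ ι q)
    ι-coeff≟ p q with p ℚₚ.≟ q
    ... | yes p≡q = just (reflexive (≡.cong ι p≡q))
    ... | no _    = nothing

  module Solver = Algebra.Solver.Ring ℚ-rawRing (fromCommutativeRing commutativeRing)
    ι-morphism ι-coeff≟
  open Solver using (solve; _:=_; _:+_; _:*_; _:-_; :-_; con)

  -- Signs and rational approximation.

  ¬Pos-both : ∀ {x} → Pos x → ¬ Pos (- x)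
  ¬Pos-both {x} px pnx = ¬Pos-0 (Pos-resp (-‿inverseʳ x) (Pos-+ px pnx))

  Pos-½ : Pos (ι ½)
  Pos-½ = Pos-ι (ℚₚ.positive⁻¹ ½)

  Pos-1 : Pos 1#
  Pos-1 = Pos-resp ι-1 (Pos-ι 0<1)

  ι-reflects-Pos : ∀ {q} → Pos (ι q) → 0ℚ ℚ.< q
  ι-reflects-Pos {q} pq with ℚₚ.<-cmp 0ℚ q
  ... | tri< 0<q _ _    = 0<q
  ... | tri≈ _ ≡.refl _ = contradiction (Pos-resp ι-0 pq) ¬Pos-0
  ... | tri> _ _ q<0    = contradiction
    (Pos-resp (ι-neg q) (Pos-ι (ℚₚ.neg-antimono-< q<0))) (¬Pos-both pq)

  infixl 5 _⟨≃⟩_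
  _⟨≃⟩_ : ∀ {x y z} → x ≃ y → y ≃ z → x ≃ z
  _⟨≃⟩_ = ≃-trans

  neg-neg : ∀ {x} → - - x ≃ x
  neg-neg {x} = solve 1 (λ x → :- :- x := x) ≃-refl x

  neg-zero : ∀ {x} → x ≃ 0# → - x ≃ 0#
  neg-zero e = -‿cong (e ⟨≃⟩ ≃-sym ι-0) ⟨≃⟩ solve 0 (:- con 0ℚ := con 0ℚ) ≃-refl ⟨≃⟩ ι-0

  neg-zero⁻¹ : ∀ {x} → - x ≃ 0# → x ≃ 0#
  neg-zero⁻¹ e = ≃-sym neg-neg ⟨≃⟩ neg-zero e

  between-0-and : ∀ {x} → Pos x → ∃[ q ] (0ℚ ℚ.< q × Pos (x - ι q))
  between-0-and {x} px =
    let q , p₁ , p₂ = dense (ι 0ℚ) x (Pos-resp (solve 1 (λ x → x := x :- con 0ℚ) ≃-refl x) px)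
    in q , ι-reflects-Pos (Pos-resp (solve 1 (λ x → x :- con 0ℚ := x) ≃-refl (ι q)) p₁) , p₂

  absolute-bound : ∀ x → ∃[ q ] (0ℚ ℚ.< q × Pos (ι q - x) × Pos (ι q + x))
  absolute-bound x with trichotomy x
  ... | inj₁ px =
    let q , p , _ = dense x (x + 1#) (Pos-resp (solve 2 (λ x u → u := x :+ u :- x) ≃-refl x 1#) Pos-1)
        pq = Pos-resp (solve 2 (λ q x → q :- x :+ x := q) ≃-refl (ι q) x) (Pos-+ p px)
    in q , ι-reflects-Pos pq , p , Pos-+ pq px
  ... | inj₂ (inj₁ x≃0) = 1ℚ , 0<1
    , Pos-resp (solve 0 (con 1ℚ := con 1ℚ :- con 0ℚ) ≃-refl ⟨≃⟩ +-congˡ (-‿cong 0≃x)) (Pos-ι 0<1)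
    , Pos-resp (solve 0 (con 1ℚ := con 1ℚ :+ con 0ℚ) ≃-refl ⟨≃⟩ +-congˡ 0≃x) (Pos-ι 0<1)
    where 0≃x = ι-0 ⟨≃⟩ ≃-sym x≃0
  ... | inj₂ (inj₂ pnx) =
    let q , p , _ = dense (- x) (- x + 1#)
                      (Pos-resp (solve 2 (λ x u → u := x :+ u :- x) ≃-refl (- x) 1#) Pos-1)
        pq = Pos-resp (solve 2 (λ q x → q :- x :+ x := q) ≃-refl (ι q) (- x)) (Pos-+ p pnx)
    in q , ι-reflects-Pos pq , Pos-+ pq pnx
       , Pos-resp (solve 2 (λ q x → q :- :- x := q :+ x) ≃-refl (ι q) x) p

  ι-inverse : ∀ {q} → 0ℚ ℚ.< q → ∃[ p ] (0ℚ ℚ.< p × ι p * ι q ≃ 1#)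
  ι-inverse {q} 0<q = (ℚ.1/ q) {{≢0}} , 1/-pos 0<q
    , ≃-sym (ι-* _ q) ⟨≃⟩ reflexive (≡.cong ι (ℚₚ.*-inverseˡ q {{≢0}})) ⟨≃⟩ ι-1
    where ≢0 = ℚ.>-nonZero 0<q

  small-multiple : ∀ {s x} → 0ℚ ℚ.< s → Pos x → ∃[ q ] (0ℚ ℚ.< q × Pos (x - ι s * ι q))
  small-multiple {s} {x} 0<s px =
    let p , 0<p , ps≃1 = ι-inverse 0<s
        q , 0<q , pq   = between-0-and (Pos-* (Pos-ι 0<p) px)
    in q , 0<q , Pos-resp
         (solve 4 (λ s p x q → s :* (p :* x :- q) := p :* s :* x :- s :* q) ≃-refl (ι s) (ι p) x (ι q)
           ⟨≃⟩ +-congʳ (*-congʳ ps≃1 ⟨≃⟩ *-identityˡ x))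
         (Pos-* (Pos-ι 0<s) pq)

  approx-below : ∀ x {η} → 0ℚ ℚ.< η → ∃[ c ] (Pos (x - ι c) × Pos (ι η - (x - ι c)))
  approx-below x {η} 0<η =
    let c , p₁ , p₂ = dense (x - ι η) x
          (Pos-resp (solve 2 (λ x h → h := x :- (x :- h)) ≃-refl x (ι η)) (Pos-ι 0<η))
    in c , p₂ , Pos-resp (solve 3 (λ x h c → c :- (x :- h) := h :- (x :- c)) ≃-refl x (ι η) (ι c)) p₁

  -- Take a rational `s` above both `d` and `- d`, and `η` with `s * η < G`; any `c` within `η`
  -- below `x` works. In the applications `(x - c) * d` is the unwanted term of a product rule.
  perturb : ∀ x d {G} → Pos G →
    ∃[ c ] (Pos (x - ι c) × Pos (G + (x - ι c) * d) × Pos (G - (x - ι c) * d))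
  perturb x d {G} pG =
    let s , 0<s , s-d , s+d = absolute-bound d
        η , 0<η , G-sη      = small-multiple 0<s pG
        c , 0<y , y<η       = approx-below x 0<η
        G-sy                = less-product G-sη (Pos-ι 0<s) y<η
    in c , 0<y , add-product G-sy 0<y s+d , subtract-product G-sy 0<y s-d
    where
    less-product : ∀ {G s η y} → Pos (G - s * η) → Pos s → Pos (η - y) → Pos (G - s * y)
    less-product {G} {s} {η} {y} p q r = Pos-resp
      (solve 4 (λ G s h y → G :- s :* h :+ s :* (h :- y) := G :- s :* y) ≃-refl G s η y)
      (Pos-+ p (Pos-* q r))
    add-product : ∀ {G s y d} → Pos (G - s * y) → Pos y → Pos (s + d) → Pos (G + y * d)
    add-product {G} {s} {y} {d} p q r = Pos-resp
      (solve 4 (λ G s y d → G :- s :* y :+ y :* (s :+ d) := G :+ y :* d) ≃-refl G s y d)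
      (Pos-+ p (Pos-* q r))
    subtract-product : ∀ {G s y d} → Pos (G - s * y) → Pos y → Pos (s - d) → Pos (G - y * d)
    subtract-product {G} {s} {y} {d} p q r = Pos-resp
      (solve 4 (λ G s y d → G :- s :* y :+ y :* (s :- d) := G :- y :* d) ≃-refl G s y d)
      (Pos-+ p (Pos-* q r))

  -- Classes modulo the rationals.

  ι-shift : ∀ x p q {r} → p ℚ.+ q ≡ r → x + ι p + ι q ≃ x + ι r
  ι-shift x p q ≡.refl = +-assoc x (ι p) (ι q) ⟨≃⟩ +-congˡ (≃-sym (ι-+ p q))

  ι-unshift : ∀ x q → x + ι q + ι (ℚ.- q) ≃ x
  ι-unshift x q = ι-shift x q (ℚ.- q) (ℚₚ.+-inverseʳ q) ⟨≃⟩ +-congˡ ι-0 ⟨≃⟩ +-identityʳ x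

  infix 21 _+ℚ
  _+ℚ : ∀ {ℓ} → Pred Carrier ℓ → Pred Carrier ℓ
  (C +ℚ) x = ∃[ q ] C (x + ι q)

  above : ∀ x → ∃[ q ] Pos (x + ι q)
  above x = let q , _ , _ , p = absolute-bound x in q , Pos-resp (+-comm (ι q) x) p

  -- Both parts of a bipartition turn out to satisfy these laws, so the calculus modulo ℚ is
  -- developed once. By `shift` the choice of translate is immaterial: `+ℚ-elim` recovers `C x` for
  -- positive `x` from any translate.
  record IsShiftable {ℓ} (C : Pred Carrier ℓ) : Set ℓ where
    field
      resp       : C Respects _≃_
      pos        : ∀ {x} → C x → Pos x
      +-closed   : ∀ {x y} → C x → C y → C (x + y)
      *-closed   : ∀ {x y} → C x → C y → C (x * y)
      scale      : ∀ {q x} → 0ℚ ℚ.< q → C x → C (ι q * x)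
      shift      : ∀ {x q} → C x → Pos (x + ι q) → C (x + ι q)

    +ℚ-resp : C +ℚ Respects _≃_
    +ℚ-resp x≃y (q , c) = q , resp (+-congʳ x≃y) c

    +ℚ-intro : ∀ {x} → C x → (C +ℚ) x
    +ℚ-intro {x} c = 0ℚ , resp (≃-sym (+-congˡ ι-0 ⟨≃⟩ +-identityʳ x)) c

    +ℚ-elim : ∀ {x} → (C +ℚ) x → Pos x → C x
    +ℚ-elim {x} (q , c) px =
      resp (ι-unshift x q) (shift c (Pos-resp (≃-sym (ι-unshift x q)) px))

    +ℚ-shift : ∀ {x} q → (C +ℚ) x → (C +ℚ) (x + ι q)
    +ℚ-shift {x} q (p , c) = ℚ.- q ℚ.+ p
      , resp (≃-sym (≃-sym (ι-shift (x + ι q) (ℚ.- q) p ≡.refl) ⟨≃⟩ +-congʳ (ι-unshift x q))) c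

    +ℚ-+ : ∀ {x y} → (C +ℚ) x → (C +ℚ) y → (C +ℚ) (x + y)
    +ℚ-+ {x} {y} (p , c) (q , d) = p ℚ.+ q , resp
      (solve 4 (λ x y p q → (x :+ p) :+ (y :+ q) := (x :+ y) :+ (p :+ q)) ≃-refl x y (ι p) (ι q)
        ⟨≃⟩ +-congˡ (≃-sym (ι-+ p q))) (+-closed c d)

    +ℚ-scale : ∀ {q x} → 0ℚ ℚ.< q → (C +ℚ) x → (C +ℚ) (ι q * x)
    +ℚ-scale {q} {x} 0<q (p , c) = q ℚ.* p , resp
      (distribˡ (ι q) x (ι p) ⟨≃⟩ +-congˡ (≃-sym (ι-* q p))) (scale 0<q c)

  -- Bipartitions of the positive elements and their invariance under rational shifts.

  record IsBipartition {ℓ₁ ℓ₂} (A : Pred Carrier ℓ₁) (B : Pred Carrier ℓ₂) :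
                       Set (ℓ₁ ⊔ ℓ₂) where
    field
      A-resp     : A Respects _≃_
      B-resp     : B Respects _≃_
      cover      : ∀ {x} → Pos x → A x ⊎ B x
      A-pos      : ∀ {x} → A x → Pos x
      B-pos      : ∀ {x} → B x → Pos x
      disjoint   : ∀ {x} → A x → B x → ⊥
      A-+        : ∀ {x y} → A x → A y → A (x + y)
      A-*        : ∀ {x y} → A x → A y → A (x * y)
      B-+        : ∀ {x y} → B x → B y → B (x + y)
      B-*        : ∀ {x y} → B x → B y → B (x * y)

  module Bipartition {ℓ₁ ℓ₂} {A : Pred Carrier ℓ₁} {B : Pred Carrier ℓ₂}
                     (bipartition : IsBipartition A B) (A-1 : A 1#) where
    open IsBipartition bipartition

    B-if-not-A : ∀ {x} → Pos x → ¬ A x → B x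
    B-if-not-A px ¬a = [ (λ a → contradiction a ¬a) , id ]′ (cover px)

    A-if-not-B : ∀ {x} → Pos x → ¬ B x → A x
    A-if-not-B px ¬b = [ id , (λ b → contradiction b ¬b) ]′ (cover px)

    multiple : ∀ {ℓ} {C : Pred Carrier ℓ} → C Respects _≃_ →
      (∀ {x y} → C x → C y → C (x + y)) → ∀ {x} n → C x → C (ι (ℕ→ℚ (suc n)) * x)
    multiple C-resp C-+ {x} zero    c = C-resp (solve 1 (λ x → x := con (ℕ→ℚ 1) :* x) ≃-refl x) c
    multiple C-resp C-+ {x} (suc n) c = C-resp
      (solve 2 (λ m x → x :+ m :* x := (con 1ℚ :+ m) :* x) ≃-refl (ι (ℕ→ℚ (suc n))) x
        ⟨≃⟩ *-congʳ (≃-sym (ι-+ 1ℚ (ℕ→ℚ (suc n)))))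
      (C-+ c (multiple C-resp C-+ n c))

    -- Were `q` in B, the integer `(k + 1) * q = m + 1` would lie in B as a sum of copies of `q` and
    -- in A as a sum of copies of 1.
    A-ι : ∀ {q} → 0ℚ ℚ.< q → A (ι q)
    A-ι {q} 0<q = let k , m , eq = clear-denominator 0<q in
      A-if-not-B (Pos-ι 0<q) λ b → disjoint
        (A-resp (*-identityʳ _) (multiple A-resp A-+ m A-1))
        (B-resp (≃-sym (ι-* _ q) ⟨≃⟩ reflexive (≡.cong ι eq)) (multiple B-resp B-+ k b))

    A-scale : ∀ {q x} → 0ℚ ℚ.< q → A x → A (ι q * x)
    A-scale 0<q = A-* (A-ι 0<q)

    -- If `q * x` were in A, multiplying by `1 / q`, which is in A, would put `x` in A.
    B-scale : ∀ {q x} → 0ℚ ℚ.< q → B x → B (ι q * x)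
    B-scale {q} {x} 0<q b = let p , 0<p , pq≃1 = ι-inverse 0<q in
      B-if-not-A (Pos-* (Pos-ι 0<q) (B-pos b)) λ a → disjoint
        (A-resp (≃-sym (*-assoc _ _ _) ⟨≃⟩ *-congʳ pq≃1 ⟨≃⟩ *-identityˡ x) (A-scale 0<p a)) b

    B-lower : ∀ {x q} → B x → 0ℚ ℚ.< q → Pos (x - ι q) → B (x - ι q)
    B-lower {x} {q} b 0<q p = B-if-not-A p λ a → disjoint
      (A-resp (solve 2 (λ x q → x :- q :+ q := x) ≃-refl x (ι q)) (A-+ a (A-ι 0<q))) b

    -- (x + q)² = (x - q)² + 4qx, where the right-hand side is in B.
    B-raise-less : ∀ {x q} → B x → 0ℚ ℚ.< q → Pos (x - ι q) → B (x + ι q)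
    B-raise-less {x} {q} b 0<q p =
      let b₁ = B-lower b 0<q p
          b₂ = B-scale (ℚₚ.positive⁻¹ (ℕ→ℚ 4)) (B-scale 0<q b)
      in B-if-not-A (Pos-+ (B-pos b) (Pos-ι 0<q)) λ a → disjoint (A-* a a)
        (B-resp (solve 2 (λ x q → (x :- q) :* (x :- q) :+ con (ℕ→ℚ 4) :* (q :* x)
                             := (x :+ q) :* (x :+ q)) ≃-refl x (ι q))
          (B-+ (B-* b₁ b₁) b₂))

    -- Raising by `q` preserves the hypothesis of `B-raise-less` that `q` lies below the element, so
    -- the step can be repeated.
    B-raise-multiple : ∀ {x q} → B x → 0ℚ ℚ.< q → Pos (x - ι q) → ∀ n → B (x + ι (ℕ→ℚ n ℚ.* q))
    B-raise-multiple {x} {q} b 0<q p zero = B-resp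
      (≃-sym (+-congˡ (reflexive (≡.cong ι (ℚₚ.*-zeroˡ q)) ⟨≃⟩ ι-0) ⟨≃⟩ +-identityʳ x)) b
    B-raise-multiple {x} {q} b 0<q p (suc n) = B-resp
      (ι-shift x q (ℕ→ℚ n ℚ.* q) (≡.sym
        (≡.trans (ℚₚ.*-distribʳ-+ q 1ℚ (ℕ→ℚ n)) (≡.cong (ℚ._+ ℕ→ℚ n ℚ.* q) (ℚₚ.*-identityˡ q)))))
      (B-raise-multiple (B-raise-less b 0<q p) 0<q
        (Pos-resp (solve 2 (λ x q → x := x :+ q :- q) ≃-refl x (ι q)) (B-pos b)) n)

    B-shift : ∀ {x q} → B x → Pos (x + ι q) → B (x + ι q)
    B-shift {x} {q} b p with ℚₚ.<-cmp 0ℚ q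
    ... | tri≈ _ ≡.refl _ = B-resp (≃-sym (+-congˡ ι-0 ⟨≃⟩ +-identityʳ x)) b
    ... | tri> _ _ q<0 = B-resp -q≃ (B-lower b (ℚₚ.neg-antimono-< q<0) (Pos-resp (≃-sym -q≃) p))
      where
      -q≃ : x - ι (ℚ.- q) ≃ x + ι q
      -q≃ = +-congˡ (-‿cong (ι-neg q)) ⟨≃⟩ solve 2 (λ x q → x :- :- q := x :+ q) ≃-refl x (ι q)
    ... | tri< 0<q _ _ =
      -- A step upwards must be smaller than the element, a step downwards need only keep it
      -- positive. So steps of `c < x` overshoot to `n * c > q`, and `B-lower` removes the excess
      -- `r`.
      let c , 0<c , p′ = between-0-and (B-pos b)
          n , q<nc     = archimedean 0<c 0<q
          r            = ℕ→ℚ n ℚ.* c ℚ.- q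
          rearrange    : x + ι (ℕ→ℚ n ℚ.* c) - ι r ≃ x + ι q
          rearrange    = +-congˡ (-‿cong (ι-+ _ _ ⟨≃⟩ +-congˡ (ι-neg q)))
            ⟨≃⟩ solve 3 (λ x m q → x :+ m :- (m :- q) := x :+ q) ≃-refl x (ι (ℕ→ℚ n ℚ.* c)) (ι q)
      in B-resp rearrange (B-lower (B-raise-multiple b 0<c p′ n) (p<q⇒0<q-p q<nc)
           (Pos-resp (≃-sym rearrange) p))

    A-shift : ∀ {x q} → A x → Pos (x + ι q) → A (x + ι q)
    A-shift {x} {q} a p = A-if-not-B p λ b → disjoint a (B-resp (ι-unshift x q)
      (B-shift b (Pos-resp (≃-sym (ι-unshift x q)) (A-pos a))))

    A-shiftable : IsShiftable A
    A-shiftable = record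
      { resp = A-resp ; pos = A-pos ; +-closed = A-+ ; *-closed = A-*
      ; scale = A-scale ; shift = A-shift }

    B-shiftable : IsShiftable B
    B-shiftable = record
      { resp = B-resp ; pos = B-pos ; +-closed = B-+ ; *-closed = B-*
      ; scale = B-scale ; shift = B-shift }

    module A = IsShiftable A-shiftable
    module B = IsShiftable B-shiftable

    cover-ℚ : ∀ x → (A +ℚ) x ⊎ (B +ℚ) x
    cover-ℚ x with above x
    ... | q , p = [ (λ a → inj₁ (q , a)) , (λ b → inj₂ (q , b)) ]′ (cover p)

    disjoint-ℚ : ∀ {x} → (A +ℚ) x → (B +ℚ) x → ⊥
    disjoint-ℚ {x} a b =
      let q , p = above x in disjoint (A.+ℚ-elim (A.+ℚ-shift q a) p) (B.+ℚ-elim (B.+ℚ-shift q b) p)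

    A-if-not-B-ℚ : ∀ {x} → ¬ (B +ℚ) x → (A +ℚ) x
    A-if-not-B-ℚ {x} ¬b = [ id , (λ b → contradiction b ¬b) ]′ (cover-ℚ x)

    B-if-not-A-ℚ : ∀ {x} → ¬ (A +ℚ) x → (B +ℚ) x
    B-if-not-A-ℚ {x} ¬a = [ (λ a → contradiction a ¬a) , id ]′ (cover-ℚ x)

    A-ℚ : ∀ q → (A +ℚ) (ι q)
    A-ℚ q = A.+ℚ-resp (+-identityˡ (ι q)) (A.+ℚ-shift q (1ℚ , A-resp
      (≃-sym (+-identityˡ _ ⟨≃⟩ ι-1)) A-1))

    -- Two opposite elements of B modulo ℚ would have their sum 0 in B modulo ℚ. There is no
    -- counterpart with A and B exchanged: a rational and its negative are both in A modulo ℚ.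
    B-neg : ∀ {x} → (B +ℚ) x → (A +ℚ) (- x)
    B-neg {x} b = A-if-not-B-ℚ λ b′ → disjoint-ℚ (A-ℚ 0ℚ)
      (B.+ℚ-resp (-‿inverseʳ x ⟨≃⟩ ≃-sym ι-0) (B.+ℚ-+ b b′))

  -- Derivations that kill the rationals.

  record IsDerivation (δ : Carrier → Carrier) : Set where
    field
      δ-cong : ∀ {x y} → x ≃ y → δ x ≃ δ y
      δ-+    : ∀ x y → δ (x + y) ≃ δ x + δ y
      δ-*    : ∀ x y → δ (x * y) ≃ δ x * y + x * δ y
      δ-ι    : ∀ q → δ (ι q) ≃ 0#

    δ-scale : ∀ q x → δ (ι q * x) ≃ ι q * δ x
    δ-scale q x = δ-* (ι q) x ⟨≃⟩ +-congʳ (*-congʳ (δ-ι q) ⟨≃⟩ zeroˡ x) ⟨≃⟩ +-identityˡ _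

    δ-neg : ∀ x → δ (- x) ≃ - δ x
    δ-neg x = δ-cong (solve 1 (λ x → :- x := con (ℚ.- 1ℚ) :* x) ≃-refl x) ⟨≃⟩ δ-scale (ℚ.- 1ℚ) x
      ⟨≃⟩ solve 1 (λ y → con (ℚ.- 1ℚ) :* y := :- y) ≃-refl (δ x)

    δ-+ι : ∀ x q → δ (x + ι q) ≃ δ x
    δ-+ι x q = δ-+ x (ι q) ⟨≃⟩ +-congˡ (δ-ι q) ⟨≃⟩ +-identityʳ (δ x)

    neg-isDerivation : IsDerivation (-_ ∘ δ)
    neg-isDerivation = record
      { δ-cong = λ x≃y → -‿cong (δ-cong x≃y)
      ; δ-+    = λ x y → -‿cong (δ-+ x y)
          ⟨≃⟩ solve 2 (λ u v → :- (u :+ v) := :- u :+ :- v) ≃-refl (δ x) (δ y)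
      ; δ-*    = λ x y → -‿cong (δ-* x y)
          ⟨≃⟩ solve 4 (λ x y u v → :- (u :* y :+ x :* v) := :- u :* y :+ x :* :- v)
                ≃-refl x y (δ x) (δ y)
      ; δ-ι    = λ q → -‿cong (δ-ι q ⟨≃⟩ ≃-sym ι-0)
          ⟨≃⟩ solve 0 (:- con 0ℚ := con 0ℚ) ≃-refl ⟨≃⟩ ι-0
      }

  open IsBipartition public

  -- Tame elements and their closure under the ring operations.

  module Halves {ℓ₁ ℓ₂} {A : Pred Carrier ℓ₁} {B : Pred Carrier ℓ₂}
                (bipartition : IsBipartition A B) (A-1 : A 1#)
                {δ : Carrier → Carrier} (isDerivation : IsDerivation δ)
                {β : Carrier} (δβ≃1 : δ β ≃ 1#) (B-β : (B +ℚ) β) where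
    open Bipartition bipartition A-1
    open IsDerivation isDerivation

    -- Since `δ β` is 1, `δ x + t` is the derivative of `x + t * β`: on the line through `x` in
    -- direction `β` the class has to follow the sign of the derivative. Nothing is required where
    -- the derivative vanishes, so strict inequalities and density suffice.
    record Tame (x : Carrier) : Set (ℓ₁ ⊔ ℓ₂) where
      field
        rising  : ∀ t → Pos (δ x + ι t) → (B +ℚ) (x + ι t * β)
        falling : ∀ t → Pos (- (δ x + ι t)) → (A +ℚ) (x + ι t * β)

    open Tame

    tame-resp : Tame Respects _≃_
    tame-resp x≃y tx = record
      { rising  = λ t p → B.+ℚ-resp (+-congʳ x≃y)
          (rising tx t (Pos-resp (+-congʳ (≃-sym (δ-cong x≃y))) p))
      ; falling = λ t p → A.+ℚ-resp (+-congʳ x≃y)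
          (falling tx t (Pos-resp (-‿cong (+-congʳ (≃-sym (δ-cong x≃y)))) p))
      }

    tame-rising : ∀ {x} → Tame x → Pos (δ x) → (B +ℚ) x
    tame-rising {x} tx p = B.+ℚ-resp (solve 2 (λ x b → x :+ con 0ℚ :* b := x) ≃-refl x β)
      (rising tx 0ℚ (Pos-resp (solve 1 (λ d → d := d :+ con 0ℚ) ≃-refl (δ x)) p))

    tame-falling : ∀ {x} → Tame x → Pos (- δ x) → (A +ℚ) x
    tame-falling {x} tx p = A.+ℚ-resp (solve 2 (λ x b → x :+ con 0ℚ :* b := x) ≃-refl x β)
      (falling tx 0ℚ (Pos-resp (solve 1 (λ d → :- d := :- (d :+ con 0ℚ)) ≃-refl (δ x)) p))

    -- Density gives `s` with `- δ x < s < δ y + t`, and `t` splits as `s + (t - s)` so that both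
    -- summands rise. The falling case is the mirror image.
    tame-+ : ∀ {x y} → Tame x → Tame y → Tame (x + y)
    tame-+ {x} {y} tx ty = record { rising = up ; falling = down }
      where
      regroup : ∀ t s → x + ι s * β + (y + ι (t ℚ.- s) * β) ≃ x + y + ι t * β
      regroup t s = +-congˡ (+-congˡ (*-congʳ (ι-+ t (ℚ.- s) ⟨≃⟩ +-congˡ (ι-neg s))))
        ⟨≃⟩ solve 5 (λ x y s t b → x :+ s :* b :+ (y :+ (t :- s) :* b) := x :+ y :+ t :* b)
              ≃-refl x y (ι s) (ι t) β
      up : ∀ t → Pos (δ (x + y) + ι t) → (B +ℚ) (x + y + ι t * β)
      up t p = let s , p₁ , p₂ = dense (- δ x) (δ y + ι t) (Pos-resp
                      (+-congʳ (δ-+ x y) ⟨≃⟩ solve 3 (λ u v t → u :+ v :+ t := v :+ t :- :- u)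
                        ≃-refl (δ x) (δ y) (ι t)) p)
               in B.+ℚ-resp (regroup t s) (B.+ℚ-+
                    (rising tx s (Pos-resp (solve 2 (λ u s → s :- :- u := u :+ s) ≃-refl (δ x) (ι s)) p₁))
                    (rising ty (t ℚ.- s) (Pos-resp (+-assoc _ _ _ ⟨≃⟩
                      +-congˡ (+-congˡ (≃-sym (ι-neg s)) ⟨≃⟩ ≃-sym (ι-+ t (ℚ.- s)))) p₂)))
      down : ∀ t → Pos (- (δ (x + y) + ι t)) → (A +ℚ) (x + y + ι t * β)
      down t p = let s , p₁ , p₂ = dense (δ y + ι t) (- δ x) (Pos-resp
                        (-‿cong (+-congʳ (δ-+ x y)) ⟨≃⟩ solve 3 (λ u v t → :- (u :+ v :+ t) := :- u :- (v :+ t))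
                          ≃-refl (δ x) (δ y) (ι t)) p)
                 in A.+ℚ-resp (regroup t s) (A.+ℚ-+
                      (falling tx s (Pos-resp (solve 2 (λ u s → :- u :- s := :- (u :+ s)) ≃-refl (δ x) (ι s)) p₂))
                      (falling ty (t ℚ.- s) (Pos-resp
                        (solve 3 (λ v t s → s :- (v :+ t) := :- (v :+ (t :- s))) ≃-refl (δ y) (ι t) (ι s)
                        ⟨≃⟩ -‿cong (+-congˡ (+-congˡ (≃-sym (ι-neg s)) ⟨≃⟩ ≃-sym (ι-+ t (ℚ.- s))))) p₁)))

    tame-scale⁺ : ∀ {q x} → 0ℚ ℚ.< q → Tame x → Tame (ι q * x)
    tame-scale⁺ {q} {x} 0<q tx = let p , 0<p , pq≃1 = ι-inverse 0<q in record
      { rising  = λ t pos → B.+ℚ-resp (regroup pq≃1 t) (B.+ℚ-scale 0<q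
          (rising tx (p ℚ.* t) (Pos-resp (rescale pq≃1 t) (Pos-* (Pos-ι 0<p) pos))))
      ; falling = λ t pos → A.+ℚ-resp (regroup pq≃1 t) (A.+ℚ-scale 0<q
          (falling tx (p ℚ.* t) (Pos-resp
            (solve 2 (λ p u → p :* :- u := :- (p :* u)) ≃-refl (ι p) _ ⟨≃⟩ -‿cong (rescale pq≃1 t))
            (Pos-* (Pos-ι 0<p) pos))))
      }
      where
      module _ {p} (pq≃1 : ι p * ι q ≃ 1#) where
        regroup : ∀ t → ι q * (x + ι (p ℚ.* t) * β) ≃ ι q * x + ι t * β
        regroup t = *-congˡ (+-congˡ (*-congʳ (ι-* p t)))
          ⟨≃⟩ solve 5 (λ q x p t b → q :* (x :+ p :* t :* b) := q :* x :+ p :* q :* (t :* b))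
                ≃-refl (ι q) x (ι p) (ι t) β
          ⟨≃⟩ +-congˡ (*-congʳ pq≃1 ⟨≃⟩ *-identityˡ _)
        rescale : ∀ t → ι p * (δ (ι q * x) + ι t) ≃ δ x + ι (p ℚ.* t)
        rescale t = *-congˡ (+-congʳ (δ-scale q x))
          ⟨≃⟩ solve 4 (λ p q d t → p :* (q :* d :+ t) := p :* q :* d :+ p :* t)
                ≃-refl (ι p) (ι q) (δ x) (ι t)
          ⟨≃⟩ +-cong (*-congʳ pq≃1 ⟨≃⟩ *-identityˡ _) (≃-sym (ι-* p t))

    B-ιβ : ∀ {t} → 0ℚ ℚ.< t → (B +ℚ) (ι t * β)
    B-ιβ 0<t = B.+ℚ-scale 0<t B-β

    A-ιβ : ∀ {t} → Pos (- ι t) → (A +ℚ) (ι t * β)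
    A-ιβ {t} p = A.+ℚ-resp (*-congʳ (ι-neg t)
        ⟨≃⟩ solve 2 (λ t b → :- t :* :- b := t :* b) ≃-refl (ι t) β)
      (A.+ℚ-scale (ι-reflects-Pos (Pos-resp (≃-sym (ι-neg t)) p)) (B-neg B-β))

    tame-ι : ∀ q → Tame (ι q)
    tame-ι q = record
      { rising  = λ t p → B.+ℚ-resp (+-comm _ _)
          (B.+ℚ-shift q (B-ιβ (ι-reflects-Pos (Pos-resp (drop t) p))))
      ; falling = λ t p → A.+ℚ-resp (+-comm _ _)
          (A.+ℚ-shift q (A-ιβ (Pos-resp (-‿cong (drop t)) p)))
      }
      where
      drop : ∀ t → δ (ι q) + ι t ≃ ι t
      drop t = +-congʳ (δ-ι q) ⟨≃⟩ +-identityˡ (ι t)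

    tame-β : Tame β
    tame-β = record
      { rising  = λ t p → B.+ℚ-resp (regroup t)
          (B-ιβ (ι-reflects-Pos (Pos-resp (δβ+t t) p)))
      ; falling = λ t p → A.+ℚ-resp (regroup t) (A-ιβ (Pos-resp (-‿cong (δβ+t t)) p))
      }
      where
      δβ+t : ∀ t → δ β + ι t ≃ ι (1ℚ ℚ.+ t)
      δβ+t t = +-congʳ (δβ≃1 ⟨≃⟩ ≃-sym ι-1) ⟨≃⟩ ≃-sym (ι-+ 1ℚ t)
      regroup : ∀ t → ι (1ℚ ℚ.+ t) * β ≃ β + ι t * β
      regroup t = *-congʳ (ι-+ 1ℚ t)
        ⟨≃⟩ solve 2 (λ t b → (con 1ℚ :+ t) :* b := b :+ t :* b) ≃-refl (ι t) β

    -- For `falling`, `B-neg` suffices. For `rising`, take a rational `0 < s < t - δ x`. Then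
    -- `x + (s - t) * β` is in A modulo ℚ, and if `- x + t * β` were too, so would be their sum
    -- `s * β`, contradicting `B-ιβ`.
    tame-neg : ∀ {x} → Tame x → Tame (- x)
    tame-neg {x} tx = record
      { rising  = λ t p →
          let s , 0<s , p′ = between-0-and (Pos-resp (+-congʳ (δ-neg x)) p)
          in B-if-not-A-ℚ λ a → disjoint-ℚ
               (A.+ℚ-resp (cancel t s) (A.+ℚ-+ (falling tx (s ℚ.- t) (Pos-resp
                 (solve 3 (λ d t s → :- d :+ t :- s := :- (d :+ (s :- t))) ≃-refl (δ x) (ι t) (ι s)
                   ⟨≃⟩ -‿cong (+-congˡ (≃-sym (ι-s-t t s)))) p′)) a))
               (B-ιβ 0<s)
      ; falling = λ t p → A.+ℚ-resp
          (solve 3 (λ x t b → :- (x :+ :- t :* b) := :- x :+ t :* b) ≃-refl x (ι t) β)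
          (B-neg (B.+ℚ-resp (+-congˡ (*-congʳ (ι-neg t))) (rising tx (ℚ.- t) (Pos-resp
            (-‿cong (+-congʳ (δ-neg x)) ⟨≃⟩ solve 2 (λ d t → :- (:- d :+ t) := d :+ :- t) ≃-refl (δ x) (ι t)
              ⟨≃⟩ +-congˡ (≃-sym (ι-neg t))) p))))
      }
      where
      ι-s-t : ∀ t s → ι (s ℚ.- t) ≃ ι s - ι t
      ι-s-t t s = ι-+ s (ℚ.- t) ⟨≃⟩ +-congˡ (ι-neg t)
      cancel : ∀ t s → x + ι (s ℚ.- t) * β + (- x + ι t * β) ≃ ι s * β
      cancel t s = +-congʳ (+-congˡ (*-congʳ (ι-s-t t s)))
        ⟨≃⟩ solve 4 (λ x t s b → x :+ (s :- t) :* b :+ (:- x :+ t :* b) := s :* b) ≃-refl x (ι t) (ι s) β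

    tame-scale : ∀ q {x} → Tame x → Tame (ι q * x)
    tame-scale q {x} tx with ℚₚ.<-cmp 0ℚ q
    ... | tri< 0<q _ _    = tame-scale⁺ 0<q tx
    ... | tri≈ _ ≡.refl _ = tame-resp (solve 1 (λ x → con 0ℚ := con 0ℚ :* x) ≃-refl x) (tame-ι 0ℚ)
    ... | tri> _ _ q<0    = tame-resp
      (-‿cong (*-congʳ (ι-neg q)) ⟨≃⟩ solve 2 (λ q x → :- (:- q :* x) := q :* x) ≃-refl (ι q) x)
      (tame-neg (tame-scale⁺ (ℚₚ.neg-antimono-< q<0) tx))

    -- Up to a rational, `β² + t * β` is the square of `β + t/2`, which is half the derivative
    -- `2 * β + t`. If it is positive, it is a representative of `β` in B; if it is negative, its
    -- negative is a representative of `- β` in A. Either way a positive element gets squared.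
    tame-β² : Tame (β * β)
    tame-β² = record
      { rising  = λ t p → B.+ℚ-resp (complete-square t) (B.+ℚ-shift _
          let b = B.+ℚ-elim (B.+ℚ-shift _ B-β) (Pos-resp (half t) (Pos-* Pos-½ p))
          in B.+ℚ-intro (B.*-closed b b))
      ; falling = λ t p → A.+ℚ-resp (complete-square t) (A.+ℚ-shift _
          let a = A.+ℚ-elim (A.+ℚ-resp (negate t) (A.+ℚ-shift _ (B-neg B-β))) (Pos-resp
                    (solve 2 (λ h u → h :* :- u := :- (h :* u)) ≃-refl (ι ½) _ ⟨≃⟩ -‿cong (half t))
                    (Pos-* Pos-½ p))
          in A.+ℚ-intro (A.resp (solve 1 (λ u → :- u :* :- u := u :* u) ≃-refl _) (A.*-closed a a)))
      }
      where
      half : ∀ t → ι ½ * (δ (β * β) + ι t) ≃ β + ι (½ ℚ.* t)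
      half t = *-congˡ (+-congʳ (δ-* β β ⟨≃⟩ +-cong (*-congʳ δβ≃1) (*-congˡ δβ≃1)
          ⟨≃⟩ +-cong (*-identityˡ β) (*-identityʳ β)))
        ⟨≃⟩ solve 2 (λ b t → con ½ :* (b :+ b :+ t) := b :+ con ½ :* t) ≃-refl β (ι t)
        ⟨≃⟩ +-congˡ (≃-sym (ι-* ½ t))
      negate : ∀ t → - β + ι (ℚ.- (½ ℚ.* t)) ≃ - (β + ι (½ ℚ.* t))
      negate t = +-congˡ (ι-neg _) ⟨≃⟩ solve 2 (λ b h → :- b :+ :- h := :- (b :+ h)) ≃-refl β _
      complete-square : ∀ t →
        (β + ι (½ ℚ.* t)) * (β + ι (½ ℚ.* t)) + ι (ℚ.- (½ ℚ.* t ℚ.* (½ ℚ.* t))) ≃ β * β + ι t * β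
      complete-square t = +-cong (*-cong (+-congˡ (ι-* ½ t)) (+-congˡ (ι-* ½ t)))
          (ι-neg _ ⟨≃⟩ -‿cong (ι-* _ _ ⟨≃⟩ *-cong (ι-* ½ t) (ι-* ½ t)))
        ⟨≃⟩ solve 2 (λ b t → (b :+ con ½ :* t) :* (b :+ con ½ :* t)
                :+ :- ((con ½ :* t) :* (con ½ :* t)) := b :* b :+ t :* b) ≃-refl β (ι t)

    tame-e² : ∀ s q → Tame ((ι s * β + ι q) * (ι s * β + ι q))
    tame-e² s q = tame-resp expand (tame-+ (tame-+ (tame-scale (s ℚ.* s) tame-β²)
      (tame-scale (ℕ→ℚ 2 ℚ.* (s ℚ.* q)) tame-β)) (tame-ι (q ℚ.* q)))
      where
      expand : ι (s ℚ.* s) * (β * β) + ι (ℕ→ℚ 2 ℚ.* (s ℚ.* q)) * β + ι (q ℚ.* q)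
             ≃ (ι s * β + ι q) * (ι s * β + ι q)
      expand = +-cong (+-cong (*-congʳ (ι-* s s))
            (*-congʳ (ι-* _ _ ⟨≃⟩ *-congˡ (ι-* s q)))) (ι-* q q)
        ⟨≃⟩ solve 3 (λ s q b → s :* s :* (b :* b) :+ con (ℕ→ℚ 2) :* (s :* q) :* b :+ q :* q
              := (s :* b :+ q) :* (s :* b :+ q)) ≃-refl (ι s) (ι q) β

    δ-e² : ∀ s q → let e = ι s * β + ι q in δ (e * e) ≃ ι (ℕ→ℚ 2) * ι s * e
    δ-e² s q = δ-* e e ⟨≃⟩ +-cong (*-congʳ δe) (*-congˡ δe)
        ⟨≃⟩ solve 2 (λ s e → s :* e :+ e :* s := con (ℕ→ℚ 2) :* s :* e) ≃-refl (ι s) e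
      where
      e = ι s * β + ι q
      δe : δ e ≃ ι s
      δe = δ-+ι _ q ⟨≃⟩ δ-scale s β ⟨≃⟩ *-congˡ δβ≃1 ⟨≃⟩ *-identityʳ (ι s)

    -- For rational c near x and e = sβ + q with e > ∣x - c∣ and s > ∣δ x∣, both e ± (x - c) lie
    -- in B, hence so do e² ± (x - c)².  They differ from ± x² by tame elements, whose δ is
    -- controlled because e is small.
    module Square {x} (tx : Tame x) {s c q}
      (e-z : Pos (ι s * β + ι q - (x - ι c))) (e+z : Pos (ι s * β + ι q + (x - ι c)))
      (s-v : Pos (ι s - δ x)) (s+v : Pos (ι s + δ x)) where

      e z : Carrier
      e = ι s * β + ι q
      z = x - ι c

      B-e+z : B (e + z)
      B-e+z = B.+ℚ-elim (B.+ℚ-resp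
        (+-congˡ (ι-+ q (ℚ.- c) ⟨≃⟩ +-congˡ (ι-neg c))
          ⟨≃⟩ solve 4 (λ x y q c → x :+ y :+ (q :- c) := y :+ q :+ (x :- c)) ≃-refl x (ι s * β) (ι q) (ι c))
        (B.+ℚ-shift (q ℚ.- c) (rising tx s (Pos-resp (+-comm _ _) s+v)))) e+z

      B-e-z : B (e - z)
      B-e-z = B.+ℚ-elim (B.+ℚ-resp
        (+-congˡ (ι-+ q c)
          ⟨≃⟩ solve 4 (λ x y q c → :- x :+ y :+ (q :+ c) := y :+ q :- (x :- c)) ≃-refl x (ι s * β) (ι q) (ι c))
        (B.+ℚ-shift (q ℚ.+ c) (rising (tame-neg tx) s
          (Pos-resp (+-comm _ _ ⟨≃⟩ +-congʳ (≃-sym (δ-neg x))) s-v)))) e-z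

      -- Half the sum of `(e + z)²` and `(e - z)²` is `e² + z²`. Adding `2 * c * x - e² + t * β`,
      -- which is in B modulo ℚ by the hypothesis on its derivative, leaves `x² + t * β` up to the
      -- rational `c²`.
      rising-x² : ∀ t → Pos (ι (ℕ→ℚ 2) * ι c * δ x - ι (ℕ→ℚ 2) * ι s * e + ι t) →
        (B +ℚ) (x * x + ι t * β)
      rising-x² t p = B.+ℚ-resp
        (+-cong (+-congˡ (+-congʳ (+-congʳ (*-congʳ (ι-* _ c))))) (ι-neg _ ⟨≃⟩ -‿cong (ι-* c c))
          ⟨≃⟩ solve 4 (λ x e c u → con ½ :* ((e :+ (x :- c)) :* (e :+ (x :- c)) :+ (e :- (x :- c)) :* (e :- (x :- c)))
                :+ (con (ℕ→ℚ 2) :* c :* x :+ :- (e :* e) :+ u) :+ :- (c :* c) := x :* x :+ u)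
                ≃-refl x e (ι c) (ι t * β))
        (B.+ℚ-shift (ℚ.- (c ℚ.* c)) (B.+ℚ-+
          (B.+ℚ-intro (B.scale (ℚₚ.positive⁻¹ ½) (B.+-closed (B.*-closed B-e+z B-e+z) (B.*-closed B-e-z B-e-z))))
          (rising (tame-+ (tame-scale (ℕ→ℚ 2 ℚ.* c) tx) (tame-neg (tame-e² s q))) t (Pos-resp (≃-sym
            (+-congʳ (δ-+ _ _ ⟨≃⟩ +-cong (δ-scale _ x ⟨≃⟩ *-congʳ (ι-* _ c)) (δ-neg _ ⟨≃⟩ -‿cong (δ-e² s q))))) p))))

      -- Here the product `(e + z) * (e - z) = e² - z²` serves: if `x² + t * β` were in B modulo ℚ,
      -- the sum of the two would be the falling element `2 * c * x + e² + t * β` up to a rational.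
      falling-x² : ∀ t → Pos (- (ι (ℕ→ℚ 2) * ι c * δ x + ι (ℕ→ℚ 2) * ι s * e + ι t)) →
        (A +ℚ) (x * x + ι t * β)
      falling-x² t p = A-if-not-B-ℚ λ b → disjoint-ℚ
        (falling (tame-+ (tame-scale (ℕ→ℚ 2 ℚ.* c) tx) (tame-e² s q)) t (Pos-resp (≃-sym
            (-‿cong (+-congʳ (δ-+ _ _ ⟨≃⟩ +-cong (δ-scale _ x ⟨≃⟩ *-congʳ (ι-* _ c)) (δ-e² s q))))) p))
        (B.+ℚ-resp
          (+-congˡ (ι-* c c) ⟨≃⟩ solve 4 (λ x e c u → x :* x :+ u :+ (e :+ (x :- c)) :* (e :- (x :- c)) :+ c :* c
               := con (ℕ→ℚ 2) :* c :* x :+ e :* e :+ u) ≃-refl x e (ι c) (ι t * β)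
            ⟨≃⟩ +-congʳ (+-congʳ (*-congʳ (≃-sym (ι-* _ c)))))
          (B.+ℚ-shift (c ℚ.* c) (B.+ℚ-+ b (B.+ℚ-intro (B.*-closed B-e+z B-e-z)))))

    module _ {x} (tx : Tame x) where
      private
        v = δ x

        δx²≃ : δ (x * x) ≃ ι (ℕ→ℚ 2) * (x * v)
        δx²≃ = δ-* x x ⟨≃⟩ solve 2 (λ x v → v :* x :+ x :* v := con (ℕ→ℚ 2) :* (x :* v)) ≃-refl x v

      -- `G` stands for `δ (x * x) + t` or its negative, so that both signs share one choice of `s`,
      -- `η`, `c` and `q`.
      module _ {G} (pG : Pos G) where
        private
          s-bound = absolute-bound v
          s = proj₁ s-bound
          0<s = proj₁ (proj₂ s-bound)
          s-v = proj₁ (proj₂ (proj₂ s-bound))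
          s+v = proj₂ (proj₂ (proj₂ s-bound))
          -- Up to sign, the derivative of the comparison element differs from `G` by the terms
          -- `2 * (x - c) * v` and `2 * s * e`. As `x - c < η`, `v` lies between `- s` and `s`, and
          -- `e < 2 * η`, these stay below `2 * s * η` and `4 * s * η` in absolute value: hence the
          -- 6.
          η-small = small-multiple (*-pos (ℚₚ.positive⁻¹ (ℕ→ℚ 6)) 0<s) pG
          η = proj₁ η-small
          0<η = proj₁ (proj₂ η-small)
          G-6sη : Pos (G - ι (ℕ→ℚ 6) * ι s * ι η)
          G-6sη = Pos-resp (+-congˡ (-‿cong (*-congʳ (ι-* _ s)))) (proj₂ (proj₂ η-small))
          c-near = approx-below x 0<η
          c = proj₁ c-near
          0<z = proj₁ (proj₂ c-near)
          z<η = proj₂ (proj₂ c-near)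
          -- This places `e` between `η` and `2 * η`: large enough to exceed `x - c`, small enough
          -- for the error bound.
          q-near = dense (ι η - ι s * β) (ι η + ι η - ι s * β) (Pos-resp
            (solve 2 (λ h b → h := h :+ h :- b :- (h :- b)) ≃-refl (ι η) (ι s * β)) (Pos-ι 0<η))
          q = proj₁ q-near
          η<e : Pos (ι s * β + ι q - ι η)
          η<e = Pos-resp (solve 3 (λ h b q → q :- (h :- b) := b :+ q :- h) ≃-refl (ι η) (ι s * β) (ι q))
            (proj₁ (proj₂ q-near))
          e<2η : Pos (ι η + ι η - (ι s * β + ι q))
          e<2η = Pos-resp (solve 3 (λ h b q → h :+ h :- b :- q := h :+ h :- (b :+ q)) ≃-refl (ι η) (ι s * β) (ι q))
            (proj₂ (proj₂ q-near))
          e-z : Pos (ι s * β + ι q - (x - ι c))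
          e-z = Pos-resp (solve 3 (λ e h z → e :- h :+ (h :- z) := e :- z) ≃-refl _ (ι η) _) (Pos-+ η<e z<η)
          e+z : Pos (ι s * β + ι q + (x - ι c))
          e+z = Pos-resp (solve 3 (λ e h z → e :- h :+ (h :+ z) := e :+ z) ≃-refl _ (ι η) _)
            (Pos-+ η<e (Pos-+ (Pos-ι 0<η) 0<z))
          open Square tx {s} {c} {q} e-z e+z s-v s+v
          slack : Pos (ι s * (ι η + ι η - e))
          slack = Pos-* (Pos-ι 0<s) e<2η

        square-rising : ∀ t → G ≃ δ (x * x) + ι t → (B +ℚ) (x * x + ι t * β)
        square-rising t G≃ = rising-x² t (Pos-resp
          (+-cong (+-congʳ (G≃ ⟨≃⟩ +-congʳ δx²≃)) ≃-refl
            ⟨≃⟩ solve 7 (λ x v s h c e t →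
              (con (ℕ→ℚ 2) :* (x :* v) :+ t :- con (ℕ→ℚ 6) :* s :* h)
              :+ (con (ℕ→ℚ 2) :* (s :* (h :- (x :- c)) :+ (x :- c) :* (s :- v)) :+ con (ℕ→ℚ 2) :* (s :* (h :+ h :- e)))
              := con (ℕ→ℚ 2) :* c :* v :- con (ℕ→ℚ 2) :* s :* e :+ t) ≃-refl x v (ι s) (ι η) (ι c) e (ι t))
          (Pos-+ G-6sη (Pos-+
            (Pos-* (Pos-ι (ℚₚ.positive⁻¹ (ℕ→ℚ 2))) (Pos-+ (Pos-* (Pos-ι 0<s) z<η) (Pos-* 0<z s-v)))
            (Pos-* (Pos-ι (ℚₚ.positive⁻¹ (ℕ→ℚ 2))) slack))))

        square-falling : ∀ t → G ≃ - (δ (x * x) + ι t) → (A +ℚ) (x * x + ι t * β)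
        square-falling t G≃ = falling-x² t (Pos-resp
          (+-cong (+-congʳ (G≃ ⟨≃⟩ -‿cong (+-congʳ δx²≃))) ≃-refl
            ⟨≃⟩ solve 7 (λ x v s h c e t →
              (:- (con (ℕ→ℚ 2) :* (x :* v) :+ t) :- con (ℕ→ℚ 6) :* s :* h)
              :+ (con (ℕ→ℚ 2) :* (s :* (h :- (x :- c)) :+ (x :- c) :* (s :+ v)) :+ con (ℕ→ℚ 2) :* (s :* (h :+ h :- e)))
              := :- (con (ℕ→ℚ 2) :* c :* v :+ con (ℕ→ℚ 2) :* s :* e :+ t)) ≃-refl x v (ι s) (ι η) (ι c) e (ι t))
          (Pos-+ G-6sη (Pos-+
            (Pos-* (Pos-ι (ℚₚ.positive⁻¹ (ℕ→ℚ 2))) (Pos-+ (Pos-* (Pos-ι 0<s) z<η) (Pos-* 0<z s+v)))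
            (Pos-* (Pos-ι (ℚₚ.positive⁻¹ (ℕ→ℚ 2))) slack))))

    tame-square : ∀ {x} → Tame x → Tame (x * x)
    tame-square tx = record
      { rising  = λ t p → square-rising tx p t ≃-refl
      ; falling = λ t p → square-falling tx p t ≃-refl
      }

    -- Polarisation reduces products to squares.
    tame-* : ∀ {x y} → Tame x → Tame y → Tame (x * y)
    tame-* {x} {y} tx ty = tame-resp
      (solve 2 (λ x y → con ½ :* ((x :+ y) :* (x :+ y) :+ :- (x :* x :+ y :* y)) := x :* y) ≃-refl x y)
      (tame-scale ½ (tame-+ (tame-square (tame-+ tx ty))
        (tame-neg (tame-+ (tame-square tx) (tame-square ty)))))

    -- Quotients of tame elements.

    module Quotient {R w} (w>0 : Pos w) (tw : Tame w) (tRw : Tame (R * w)) where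

      tame-product : ∀ c {e} → Tame e → Tame ((R - ι c) * (w * e))
      tame-product c {e} te = tame-resp
        (solve 4 (λ R w c e → R :* w :* e :+ :- (c :* (w :* e)) := (R :- c) :* (w :* e)) ≃-refl R w (ι c) e)
        (tame-+ (tame-* tRw te) (tame-neg (tame-scale c (tame-* tw te))))

      δ-product : ∀ c W → δ ((R - ι c) * W) ≃ δ R * W + (R - ι c) * δ W
      δ-product c W = δ-* _ W
        ⟨≃⟩ +-congʳ (*-congʳ (δ-cong (+-congˡ (≃-sym (ι-neg c))) ⟨≃⟩ δ-+ι R (ℚ.- c)))

      A-below : ∀ {c} → (A +ℚ) R → Pos (R - ι c) → A (R - ι c)
      A-below {c} a = A.+ℚ-elim (A.+ℚ-resp (+-congˡ (ι-neg c)) (A.+ℚ-shift (ℚ.- c) a))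

      B-below : ∀ {c} → (B +ℚ) R → Pos (R - ι c) → B (R - ι c)
      B-below {c} b = B.+ℚ-elim (B.+ℚ-resp (+-congˡ (ι-neg c)) (B.+ℚ-shift (ℚ.- c) b))

      -- With `W = w * e`, the derivative of `(R - c) * W` is `δ R * W + (R - c) * δ W`; `perturb`
      -- picks `c` so that the second term cannot outweigh the first.
      rising-contradiction : ∀ {e} → Tame e → Pos (w * e) → Pos (- δ (w * e)) →
        Pos (δ R) → ¬ (A +ℚ) R
      rising-contradiction {e} te pW pδW p a =
        let c , 0<y , p′ , _ = perturb R (δ (w * e)) (Pos-* p pW)
        in disjoint-ℚ
          (A.+ℚ-intro (A.*-closed (A-below a 0<y) (A.+ℚ-elim (tame-falling (tame-* tw te) pδW) pW)))
          (tame-rising (tame-product c te) (Pos-resp (≃-sym (δ-product c (w * e))) p′))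

      falling-contradiction : ∀ {e} → Tame e → Pos (w * e) → Pos (δ (w * e)) →
        Pos (- δ R) → ¬ (B +ℚ) R
      falling-contradiction {e} te pW pδW p b =
        let c , 0<y , _ , p′ = perturb R (δ (w * e)) (Pos-* p pW)
        in disjoint-ℚ
          (tame-falling (tame-product c te) (Pos-resp (negate c) p′))
          (B.+ℚ-intro (B.*-closed (B-below b 0<y) (B.+ℚ-elim (tame-rising (tame-* tw te) pδW) pW)))
        where
        negate : ∀ c → - δ R * (w * e) - (R - ι c) * δ (w * e) ≃ - δ ((R - ι c) * (w * e))
        negate c = solve 3 (λ r W z → :- r :* W :- z := :- (r :* W :+ z))
            ≃-refl (δ R) (w * e) ((R - ι c) * δ (w * e))
          ⟨≃⟩ -‿cong (≃-sym (δ-product c (w * e)))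

      quotient-rising : Pos (δ R) → (B +ℚ) R
      quotient-rising p =
        -- The factor `e = - β - c` has derivative `- 1`, so `δ (w * e) = e * δ w - w`, which is
        -- negative once `e` is small.
        let c , 0<e , _ , p′ = perturb (- β) (δ w) w>0
        in B-if-not-A-ℚ (rising-contradiction
          (tame-resp (+-congˡ (ι-neg c)) (tame-+ (tame-neg tame-β) (tame-ι (ℚ.- c))))
          (Pos-* w>0 0<e) (Pos-resp (descent c) p′) p)
        where
        δe≃ : ∀ c → δ (- β - ι c) ≃ - 1#
        δe≃ c = δ-cong (+-congˡ (≃-sym (ι-neg c))) ⟨≃⟩ δ-+ι (- β) (ℚ.- c) ⟨≃⟩ δ-neg β ⟨≃⟩ -‿cong δβ≃1
        descent : ∀ c → w - (- β - ι c) * δ w ≃ - δ (w * (- β - ι c))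
        descent c = solve 3 (λ w d e → w :- e :* d := :- (d :* e :+ w :* :- con 1ℚ)) ≃-refl w (δ w) (- β - ι c)
          ⟨≃⟩ -‿cong (+-congˡ (*-congˡ (-‿cong ι-1 ⟨≃⟩ ≃-sym (δe≃ c))) ⟨≃⟩ ≃-sym (δ-* w (- β - ι c)))

      quotient-falling : Pos (- δ R) → (A +ℚ) R
      quotient-falling p =
        -- Now `e = β - c` has derivative 1, and `δ (w * e) = e * δ w + w` is positive once `e` is
        -- small.
        let c , 0<e , p′ , _ = perturb β (δ w) w>0
        in A-if-not-B-ℚ (falling-contradiction
          (tame-resp (+-congˡ (ι-neg c)) (tame-+ tame-β (tame-ι (ℚ.- c))))
          (Pos-* w>0 0<e) (Pos-resp (ascent c) p′) p)
        where
        δe≃ : ∀ c → δ (β - ι c) ≃ 1#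
        δe≃ c = δ-cong (+-congˡ (≃-sym (ι-neg c))) ⟨≃⟩ δ-+ι β (ℚ.- c) ⟨≃⟩ δβ≃1
        ascent : ∀ c → w + (β - ι c) * δ w ≃ δ (w * (β - ι c))
        ascent c = solve 3 (λ w d e → w :+ e :* d := d :* e :+ w :* con 1ℚ) ≃-refl w (δ w) (β - ι c)
          ⟨≃⟩ +-congˡ (*-congˡ (ι-1 ⟨≃⟩ ≃-sym (δe≃ c))) ⟨≃⟩ ≃-sym (δ-* w (β - ι c))

  -- Elements that lie in A modulo ℚ together with their negatives.

  module Symmetric {ℓ₁ ℓ₂} {A : Pred Carrier ℓ₁} {B : Pred Carrier ℓ₂}
                   (bipartition : IsBipartition A B) (A-1 : A 1#) where
    open Bipartition bipartition A-1

    Sym : Pred Carrier ℓ₁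
    Sym x = (A +ℚ) x × (A +ℚ) (- x)

    sym-resp : Sym Respects _≃_
    sym-resp x≃y (a , b) = A.+ℚ-resp x≃y a , A.+ℚ-resp (-‿cong x≃y) b

    sym-ι : ∀ q → Sym (ι q)
    sym-ι q = A-ℚ q , A.+ℚ-resp (ι-neg q) (A-ℚ (ℚ.- q))

    sym-neg : ∀ {x} → Sym x → Sym (- x)
    sym-neg {x} (a , b) = b , A.+ℚ-resp (solve 1 (λ x → x := :- :- x) ≃-refl x) a

    sym-+ : ∀ {x y} → Sym x → Sym y → Sym (x + y)
    sym-+ {x} {y} (a , b) (a′ , b′) = A.+ℚ-+ a a′
      , A.+ℚ-resp (solve 2 (λ x y → :- x :+ :- y := :- (x :+ y)) ≃-refl x y) (A.+ℚ-+ b b′)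

    sym-scale⁺ : ∀ {q x} → 0ℚ ℚ.< q → Sym x → Sym (ι q * x)
    sym-scale⁺ {q} {x} 0<q (a , b) = A.+ℚ-scale 0<q a
      , A.+ℚ-resp (solve 2 (λ q x → q :* :- x := :- (q :* x)) ≃-refl (ι q) x) (A.+ℚ-scale 0<q b)

    sym-scale : ∀ q {x} → Sym x → Sym (ι q * x)
    sym-scale q {x} sx with ℚₚ.<-cmp 0ℚ q
    ... | tri< 0<q _ _    = sym-scale⁺ 0<q sx
    ... | tri≈ _ ≡.refl _ = sym-resp (solve 1 (λ x → con 0ℚ := con 0ℚ :* x) ≃-refl x) (sym-ι 0ℚ)
    ... | tri> _ _ q<0    = sym-resp
      (-‿cong (*-congʳ (ι-neg q)) ⟨≃⟩ solve 2 (λ q x → :- (:- q :* x) := q :* x) ≃-refl (ι q) x)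
      (sym-neg (sym-scale⁺ (ℚₚ.neg-antimono-< q<0) sx))

    -- Multiplying positive representatives `x + q` and `y + p` creates the cross terms `p * x` and
    -- `q * y`; symmetry supplies their negatives in A modulo ℚ, which cancel them.
    A-product : ∀ {x y} → Sym x → Sym y → (A +ℚ) (x * y)
    A-product {x} {y} sx@((q , a) , _) sy@((p , b) , _) = A.+ℚ-resp
      (+-congˡ (ι-neg _ ⟨≃⟩ -‿cong (ι-* q p))
        ⟨≃⟩ solve 4 (λ x y q p → (x :+ q) :* (y :+ p) :+ (:- (p :* x) :+ :- (q :* y)) :+ :- (q :* p) := x :* y)
              ≃-refl x y (ι q) (ι p))
      (A.+ℚ-shift (ℚ.- (q ℚ.* p)) (A.+ℚ-+ (A.+ℚ-intro (A.*-closed a b))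
        (A.+ℚ-+ (proj₂ (sym-scale p sx)) (proj₂ (sym-scale q sy)))))

    sym-* : ∀ {x y} → Sym x → Sym y → Sym (x * y)
    sym-* {x} {y} sx sy = A-product sx sy
      , A.+ℚ-resp (solve 2 (λ x y → :- x :* y := :- (x :* y)) ≃-refl x y) (A-product (sym-neg sx) sy)

    A-unscale : ∀ {q x} → 0ℚ ℚ.< q → (A +ℚ) (ι q * x) → (A +ℚ) x
    A-unscale {q} {x} 0<q a =
      let p , 0<p , pq≃1 = ι-inverse 0<q
      in A.+ℚ-resp (≃-sym (*-assoc _ _ x) ⟨≃⟩ *-congʳ pq≃1 ⟨≃⟩ *-identityˡ x) (A.+ℚ-scale 0<p a)

    module _ {w y} (w>0 : Pos w) (sw : Sym w) (yw≃1 : y * w ≃ 1#) where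
      private
        k = proj₁ (between-0-and w>0)
        0<k = proj₁ (proj₂ (between-0-and w>0))
        A-w-k : A (w - ι k)
        A-w-k = A.+ℚ-elim (A.+ℚ-resp (+-congˡ (ι-neg k)) (A.+ℚ-shift (ℚ.- k) (proj₁ sw)))
          (proj₂ (proj₂ (between-0-and w>0)))
        p = proj₁ (absolute-bound y)

      -- (p - y)(w - k) + (1 + kp) - pw = ky
      A-inverse : (A +ℚ) y
      A-inverse = A-if-not-B-ℚ λ b → disjoint-ℚ (A-unscale 0<k (A.+ℚ-resp regroup
          (A.+ℚ-shift (1ℚ ℚ.+ k ℚ.* p) (A.+ℚ-+ (A.+ℚ-intro (A.*-closed (A-p-y b) A-w-k))
            (proj₂ (sym-scale p sw)))))) b
        where
        A-p-y : (B +ℚ) y → A (- y + ι p)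
        A-p-y b = A.+ℚ-elim (A.+ℚ-shift p (B-neg b))
          (Pos-resp (+-comm (ι p) (- y)) (proj₁ (proj₂ (proj₂ (absolute-bound y)))))
        regroup : (- y + ι p) * (w - ι k) + - (ι p * w) + ι (1ℚ ℚ.+ k ℚ.* p) ≃ ι k * y
        regroup = +-congˡ (ι-+ 1ℚ _ ⟨≃⟩ +-cong (ι-1 ⟨≃⟩ ≃-sym yw≃1) (ι-* k p))
          ⟨≃⟩ solve 4 (λ y w k p → (:- y :+ p) :* (w :- k) :+ :- (p :* w) :+ (y :* w :+ k :* p) := k :* y)
                ≃-refl y w (ι k) (ι p)

      -- The identity is that of `A-inverse` with `y` and 1 negated. Lowering `w` by `k` is what
      -- leaves a multiple of `y` over.
      A-neg-inverse : (A +ℚ) (- y)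
      A-neg-inverse = A-if-not-B-ℚ λ b → disjoint-ℚ (A-unscale 0<k (A.+ℚ-resp regroup
          (A.+ℚ-shift (ℚ.- 1ℚ ℚ.+ k ℚ.* p) (A.+ℚ-+ (A.+ℚ-intro (A.*-closed (A-y+p b) A-w-k))
            (proj₂ (sym-scale p sw)))))) b
        where
        A-y+p : (B +ℚ) (- y) → A (y + ι p)
        A-y+p b = A.+ℚ-elim (A.+ℚ-shift p (A.+ℚ-resp (solve 1 (λ y → :- :- y := y) ≃-refl y) (B-neg b)))
          (Pos-resp (+-comm (ι p) y) (proj₂ (proj₂ (proj₂ (absolute-bound y)))))
        regroup : (y + ι p) * (w - ι k) + - (ι p * w) + ι (ℚ.- 1ℚ ℚ.+ k ℚ.* p) ≃ ι k * - y
        regroup = +-congˡ (ι-+ (ℚ.- 1ℚ) _ ⟨≃⟩ +-cong (ι-neg 1ℚ ⟨≃⟩ -‿cong (ι-1 ⟨≃⟩ ≃-sym yw≃1)) (ι-* k p))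
          ⟨≃⟩ solve 4 (λ y w k p → (y :+ p) :* (w :- k) :+ :- (p :* w) :+ (:- (y :* w) :+ k :* p) := k :* :- y)
                ≃-refl y w (ι k) (ι p)

      sym-inverse : Sym y
      sym-inverse = A-inverse , A-neg-inverse

  -- The classification in the abstract setting.

  record IsSubring {ℓ} (S : Pred Carrier ℓ) : Set ℓ where
    field
      S-resp : S Respects _≃_
      S-ι    : ∀ q → S (ι q)
      S-+    : ∀ {x y} → S x → S y → S (x + y)
      S-*    : ∀ {x y} → S x → S y → S (x * y)

  Decides : ∀ {ℓ₁ ℓ₂} → (Carrier → Carrier) → Pred Carrier ℓ₁ → Pred Carrier ℓ₂ → Set (ℓ₁ ⊔ ℓ₂)
  Decides δ A B = ∀ x → Pos x →
    (Pos (δ x) → B x) × (Pos (- δ x) → A x) × (δ x ≃ 0# → A x)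

  -- `fraction` expresses, without polynomials, that every element is a quotient of elements
  -- generated by `α` and ℚ, with positive denominator. Quantifying over all subrings lets it be
  -- applied both to the tame and to the symmetric elements.
  module Classification
    {D : Carrier → Carrier} (isDerivation : IsDerivation D) {α} (Dα≃1 : D α ≃ 1#)
    (inverse : ∀ {x} → Pos x → ∃[ y ] y * x ≃ 1#)
    (fraction : ∀ {ℓ} {S : Pred Carrier ℓ} → IsSubring S → S α →
                ∀ x → ∃[ w ] (Pos w × S w × S (x * w)))
    (constant : ∀ x → D x ≃ 0# → ∃[ q ] x ≃ ι q)
    {ℓ₁ ℓ₂} {A : Pred Carrier ℓ₁} {B : Pred Carrier ℓ₂}
    (bipartition : IsBipartition A B) (A-1 : A 1#) where
    open Bipartition bipartition A-1

    -- Stated for a pair `δ`, `β` so as to cover both `D`, `α` and `- D`, `- α`; `β⇒α` and `kernel`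
    -- give access to `fraction` and `constant`.
    decides : ∀ {δ : Carrier → Carrier} {β} → IsDerivation δ → δ β ≃ 1# → (B +ℚ) β →
      (∀ {ℓ} {S : Pred Carrier ℓ} → IsSubring S → S β → S α) →
      (∀ x → δ x ≃ 0# → D x ≃ 0#) → Decides δ A B
    decides {δ} isDerivation′ δβ≃1 B-β β⇒α kernel x px =
      let w , w>0 , tw , txw = fraction tame-isSubring (β⇒α tame-isSubring tame-β) x
          open Quotient w>0 tw txw
      in (λ p → B.+ℚ-elim (quotient-rising p) px)
       , (λ p → A.+ℚ-elim (quotient-falling p) px)
       , λ δx≃0 → let q , x≃q = constant x (kernel x δx≃0)
                  in A.+ℚ-elim (A.+ℚ-resp (≃-sym x≃q) (A-ℚ q)) px
      where
      open Halves bipartition A-1 isDerivation′ δβ≃1 B-β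
      tame-isSubring : IsSubring Tame
      tame-isSubring = record { S-resp = tame-resp ; S-ι = tame-ι ; S-+ = tame-+ ; S-* = tame-* }

    -- Once `w` and `x * w` are symmetric, so is the inverse of `w`, and `x` is the product of
    -- `x * w` with that inverse.
    A-everything : (A +ℚ) α → (A +ℚ) (- α) → ∀ x → (A +ℚ) x
    A-everything A-α A-nα x =
      let w , w>0 , sw , sxw = fraction sym-isSubring (A-α , A-nα) x
          y , yw≃1 = inverse w>0
      in A.+ℚ-resp (cancel w y yw≃1) (A-product sxw (sym-inverse w>0 sw yw≃1))
      where
      open Symmetric bipartition A-1
      sym-isSubring : IsSubring Sym
      sym-isSubring = record { S-resp = sym-resp ; S-ι = sym-ι ; S-+ = sym-+ ; S-* = sym-* }
      cancel : ∀ w y → y * w ≃ 1# → x * w * y ≃ x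
      cancel w y yw≃1 = *-assoc x w y ⟨≃⟩ *-congˡ (*-comm w y ⟨≃⟩ yw≃1) ⟨≃⟩ *-identityʳ x

    private
      β⇒α : ∀ {ℓ} {S : Pred Carrier ℓ} → IsSubring S → S (- α) → S α
      β⇒α sub s = S-resp (solve 1 (λ a → con (ℚ.- 1ℚ) :* :- a := a) ≃-refl α) (S-* (S-ι _) s)
        where open IsSubring sub

    classification : ∀ {b} → B b → Decides D A B ⊎ Decides (-_ ∘ D) A B
    classification {b} B-b =
      [ (λ A-α → [ (λ A-nα → contradiction (B.+ℚ-intro B-b) (disjoint-ℚ (A-everything A-α A-nα b)))
                 , (λ B-nα → inj₂ (decides neg-isDerivation
                     (-‿cong (δ-neg α) ⟨≃⟩ neg-neg ⟨≃⟩ Dα≃1) B-nα β⇒α (λ x → neg-zero⁻¹)))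
                 ]′ (cover-ℚ (- α)))
      , (λ B-α → inj₁ (decides isDerivation Dα≃1 B-α (λ _ s → s) (λ _ e → e)))
      ]′ (cover-ℚ α)
      where open IsDerivation isDerivation

  -- The halves cut out by a derivation form a bipartition.

  -- The two decompositions of the theorem arise from a derivation and from its negative: the
  -- elements of derivative 0 fall into `NonRising` for both signs.
  Rising NonRising : (Carrier → Carrier) → Pred Carrier 0ℓ
  Rising    δ x = Pos x × Pos (δ x)
  NonRising δ x = Pos x × (δ x ≃ 0# ⊎ Pos (- δ x))

  module _ {δ : Carrier → Carrier} where

    decides⇒≐ : ∀ {ℓ₁ ℓ₂} {A : Pred Carrier ℓ₁} {B : Pred Carrier ℓ₂} →
      IsBipartition A B → Decides δ A B → A ≐ NonRising δ × B ≐ Rising δ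
    decides⇒≐ {A = A} {B} bipartition decides = (A⇒ , A⇐) , (B⇒ , B⇐)
      where
      A⇒ : ∀ {x} → A x → NonRising δ x
      A⇒ {x} a = px , [ (λ p → contradiction (proj₁ (decides x px) p) (disjoint bipartition a)) , id ]′
          (trichotomy (δ x))
        where px = A-pos bipartition a
      A⇐ : ∀ {x} → NonRising δ x → A x
      A⇐ {x} (px , inj₁ e) = proj₂ (proj₂ (decides x px)) e
      A⇐ {x} (px , inj₂ p) = proj₁ (proj₂ (decides x px)) p
      B⇒ : ∀ {x} → B x → Rising δ x
      B⇒ {x} b = px , [ id , [ (λ e → contradiction b (disjoint bipartition (proj₂ (proj₂ (decides x px)) e)))
                             , (λ p → contradiction b (disjoint bipartition (proj₁ (proj₂ (decides x px)) p)))
                             ]′ ]′ (trichotomy (δ x))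
        where px = B-pos bipartition b
      B⇐ : ∀ {x} → Rising δ x → B x
      B⇐ {x} (px , p) = proj₁ (decides x px) p

    module _ (isDerivation : IsDerivation δ) where
      open IsDerivation isDerivation

      private
        NonPos : Pred Carrier 0ℓ
        NonPos x = x ≃ 0# ⊎ Pos (- x)

        nonPos-resp : NonPos Respects _≃_
        nonPos-resp x≃y = [ (λ e → inj₁ (≃-sym x≃y ⟨≃⟩ e)) , (λ p → inj₂ (Pos-resp (-‿cong x≃y) p)) ]′

        nonPos-+ : ∀ {x y} → NonPos x → NonPos y → NonPos (x + y)
        nonPos-+ {x} {y} (inj₁ e) n = nonPos-resp (≃-sym (+-congʳ e ⟨≃⟩ +-identityˡ y)) n
        nonPos-+ {x} {y} (inj₂ p) (inj₁ e) =
          inj₂ (Pos-resp (-‿cong (≃-sym (+-congˡ e ⟨≃⟩ +-identityʳ x))) p)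
        nonPos-+ {x} {y} (inj₂ p) (inj₂ q) =
          inj₂ (Pos-resp (solve 2 (λ x y → :- x :+ :- y := :- (x :+ y)) ≃-refl x y) (Pos-+ p q))

        nonPos-* : ∀ {x y} → Pos x → NonPos y → NonPos (x * y)
        nonPos-* {x} {y} px (inj₁ e) = inj₁ (*-congˡ e ⟨≃⟩ zeroʳ x)
        nonPos-* {x} {y} px (inj₂ p) =
          inj₂ (Pos-resp (solve 2 (λ x y → x :* :- y := :- (x :* y)) ≃-refl x y) (Pos-* px p))

        leibniz : ∀ x y → y * δ x + x * δ y ≃ δ (x * y)
        leibniz x y = +-congʳ (*-comm y (δ x)) ⟨≃⟩ ≃-sym (δ-* x y)

      -- For positive `x` and `y` the Leibniz rule makes `δ (x * y)` a combination of `δ x` and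
      -- `δ y` with positive coefficients, so a common sign survives.
      rising-isBipartition : IsBipartition (NonRising δ) (Rising δ)
      rising-isBipartition = record
        { A-resp   = λ x≃y (p , n) → Pos-resp x≃y p , nonPos-resp (δ-cong x≃y) n
        ; B-resp   = λ x≃y (p , q) → Pos-resp x≃y p , Pos-resp (δ-cong x≃y) q
        ; cover    = λ {x} p → [ (λ q → inj₂ (p , q)) , (λ n → inj₁ (p , n)) ]′ (trichotomy (δ x))
        ; A-pos    = proj₁
        ; B-pos    = proj₁
        ; disjoint = λ { (_ , inj₁ e) (_ , q) → ¬Pos-0 (Pos-resp e q)
                       ; (_ , inj₂ p) (_ , q) → ¬Pos-both q p }
        ; A-+      = λ {x} {y} (p , m) (q , n) → Pos-+ p q , nonPos-resp (≃-sym (δ-+ x y)) (nonPos-+ m n)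
        ; A-*      = λ {x} {y} (p , m) (q , n) → Pos-* p q
                   , nonPos-resp (leibniz x y) (nonPos-+ (nonPos-* q m) (nonPos-* p n))
        ; B-+      = λ {x} {y} (p , m) (q , n) → Pos-+ p q , Pos-resp (≃-sym (δ-+ x y)) (Pos-+ m n)
        ; B-*      = λ {x} {y} (p , m) (q , n) → Pos-* p q
                   , Pos-resp (leibniz x y) (Pos-+ (Pos-* q m) (Pos-* p n))
        }

      nonRising-1 : NonRising δ 1#
      nonRising-1 = Pos-1 , inj₁ (δ-cong (≃-sym ι-1) ⟨≃⟩ δ-ι 1ℚ)

      -- `β` itself may be negative; a rational translate is positive and has the same derivative.
      rising-satisfiable : ∀ {β} → δ β ≃ 1# → Satisfiable (Rising δ)
      rising-satisfiable {β} δβ≃1 =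
        let q , p = above β in β + ι q , p , Pos-resp (≃-sym (δ-+ι β q ⟨≃⟩ δβ≃1)) Pos-1

  swap-bipartition : ∀ {ℓ₁ ℓ₂} {A : Pred Carrier ℓ₁} {B : Pred Carrier ℓ₂} →
    IsBipartition A B → IsBipartition B A
  swap-bipartition p = record
    { A-resp = B-resp p ; B-resp = A-resp p
    ; cover = Sum.swap ∘ cover p ; A-pos = B-pos p ; B-pos = A-pos p
    ; disjoint = λ b a → disjoint p a b
    ; A-+ = B-+ p ; A-* = B-* p ; B-+ = A-+ p ; B-* = A-* p }

open import Data.Rational.Base using (_+_; _*_; _-_; -_; _<_; _≤_; ∣_∣)
open ≡ using (refl; sym; trans; cong; cong₂; subst; subst₂)
open ≡.≡-Reasoning

-- Values and derivatives of polynomials at rational points.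

-- Polynomial identities are verified on values, where ordinary rational algebra applies, and
-- carried back to coefficients by `≈ₚ-from-values`.
peval : Poly → ℚ → ℚ
peval []      t = 0ℚ
peval (a ∷ p) t = a + t * peval p t

dval : Poly → ℚ → ℚ
dval p = peval (derivₚ p)

module _ where
  open ℚSolver

  peval-+ : ∀ p q t → peval (p +ₚ q) t ≡ peval p t + peval q t
  peval-+ []      q       t = sym (ℚₚ.+-identityˡ _)
  peval-+ (a ∷ p) []      t = sym (ℚₚ.+-identityʳ _)
  peval-+ (a ∷ p) (b ∷ q) t = trans (cong (λ u → a + b + t * u) (peval-+ p q t))
    (solve 5 (λ a b t u v → a :+ b :+ t :* (u :+ v) := a :+ t :* u :+ (b :+ t :* v)) refl
      a b t (peval p t) (peval q t))

  peval-· : ∀ c p t → peval (c ·ₚ p) t ≡ c * peval p t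
  peval-· c []      t = sym (ℚₚ.*-zeroʳ c)
  peval-· c (a ∷ p) t = trans (cong (λ u → c * a + t * u) (peval-· c p t))
    (solve 4 (λ c a t u → c :* a :+ t :* (c :* u) := c :* (a :+ t :* u)) refl c a t (peval p t))

  peval-0∷ : ∀ p t → peval (0ℚ ∷ p) t ≡ t * peval p t
  peval-0∷ p t = ℚₚ.+-identityˡ _

  peval-* : ∀ p q t → peval (p *ₚ q) t ≡ peval p t * peval q t
  peval-* []      q t = sym (ℚₚ.*-zeroˡ (peval q t))
  peval-* (a ∷ p) q t = trans (peval-+ (a ·ₚ q) (0ℚ ∷ p *ₚ q) t)
    (trans (cong₂ _+_ (peval-· a q t) (trans (peval-0∷ (p *ₚ q) t) (cong (t *_) (peval-* p q t))))
      (solve 4 (λ a t u v → a :* v :+ t :* (u :* v) := (a :+ t :* u) :* v) refl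
        a t (peval p t) (peval q t)))

  peval-neg : ∀ p t → peval ((- 1ℚ) ·ₚ p) t ≡ - peval p t
  peval-neg p t = trans (peval-· (- 1ℚ) p t) (solve 1 (λ u → con (- 1ℚ) :* u := :- u) refl (peval p t))

  peval-sub : ∀ p q t → peval (p -ₚ q) t ≡ peval p t - peval q t
  peval-sub p q t = trans (peval-+ p _ t) (cong (peval p t +_) (peval-neg q t))

  peval-const : ∀ a t → peval (a ∷ []) t ≡ a
  peval-const a t = trans (cong (a +_) (ℚₚ.*-zeroʳ t)) (ℚₚ.+-identityʳ a)

  peval-at-0 : ∀ a p → peval (a ∷ p) 0ℚ ≡ a
  peval-at-0 a p = trans (cong (a +_) (ℚₚ.*-zeroˡ (peval p 0ℚ))) (ℚₚ.+-identityʳ a)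

  peval-cong : ∀ p q → p ≈ₚ q → ∀ t → peval p t ≡ peval q t
  peval-cong []      []      p≈q t = refl
  peval-cong []      (b ∷ q) p≈q t = sym (trans (cong₂ (λ a u → a + t * u) (sym (p≈q 0))
    (sym (peval-cong [] q (p≈q ∘ suc) t))) (peval-const 0ℚ t))
  peval-cong (a ∷ p) []      p≈q t = trans (cong₂ (λ a u → a + t * u) (p≈q 0)
    (peval-cong p [] (p≈q ∘ suc) t)) (peval-const 0ℚ t)
  peval-cong (a ∷ p) (b ∷ q) p≈q t =
    cong₂ (λ a u → a + t * u) (p≈q 0) (peval-cong p q (p≈q ∘ suc) t)

  dval-∷ : ∀ a p t → dval (a ∷ p) t ≡ peval p t + t * dval p t
  dval-∷ a p t = trans (peval-+ p _ t) (cong (peval p t +_) (peval-0∷ (derivₚ p) t))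

  dval-const : ∀ a t → dval (a ∷ []) t ≡ 0ℚ
  dval-const a t = peval-const 0ℚ t

  dval-+ : ∀ p q t → dval (p +ₚ q) t ≡ dval p t + dval q t
  dval-+ []      q       t = sym (ℚₚ.+-identityˡ _)
  dval-+ (a ∷ p) []      t = sym (ℚₚ.+-identityʳ _)
  dval-+ (a ∷ p) (b ∷ q) t = begin
    dval (a + b ∷ p +ₚ q) t                       ≡⟨ dval-∷ (a + b) (p +ₚ q) t ⟩
    peval (p +ₚ q) t + t * dval (p +ₚ q) t        ≡⟨ cong₂ (λ u v → u + t * v) (peval-+ p q t) (dval-+ p q t) ⟩
    peval p t + peval q t + t * (dval p t + dval q t)
      ≡⟨ solve 5 (λ t u v u′ v′ → u :+ v :+ t :* (u′ :+ v′) := u :+ t :* u′ :+ (v :+ t :* v′)) refl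
           t (peval p t) (peval q t) (dval p t) (dval q t) ⟩
    peval p t + t * dval p t + (peval q t + t * dval q t)
      ≡⟨ cong₂ _+_ (dval-∷ a p t) (dval-∷ b q t) ⟨
    dval (a ∷ p) t + dval (b ∷ q) t               ∎

  dval-· : ∀ c p t → dval (c ·ₚ p) t ≡ c * dval p t
  dval-· c []      t = sym (ℚₚ.*-zeroʳ c)
  dval-· c (a ∷ p) t = begin
    dval (c * a ∷ c ·ₚ p) t                   ≡⟨ dval-∷ (c * a) (c ·ₚ p) t ⟩
    peval (c ·ₚ p) t + t * dval (c ·ₚ p) t    ≡⟨ cong₂ (λ u v → u + t * v) (peval-· c p t) (dval-· c p t) ⟩
    c * peval p t + t * (c * dval p t)
      ≡⟨ solve 4 (λ c t u v → c :* u :+ t :* (c :* v) := c :* (u :+ t :* v)) refl c t (peval p t) (dval p t) ⟩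
    c * (peval p t + t * dval p t)            ≡⟨ cong (c *_) (dval-∷ a p t) ⟨
    c * dval (a ∷ p) t                        ∎

  dval-* : ∀ p q t → dval (p *ₚ q) t ≡ dval p t * peval q t + peval p t * dval q t
  dval-* []      q t = solve 2 (λ u v → con 0ℚ := con 0ℚ :* u :+ con 0ℚ :* v) refl (peval q t) (dval q t)
  dval-* (a ∷ p) q t = begin
    dval (a ·ₚ q +ₚ (0ℚ ∷ p *ₚ q)) t
      ≡⟨ trans (dval-+ (a ·ₚ q) _ t) (cong₂ _+_ (dval-· a q t) (dval-∷ 0ℚ (p *ₚ q) t)) ⟩
    a * dval q t + (peval (p *ₚ q) t + t * dval (p *ₚ q) t)
      ≡⟨ cong₂ (λ u v → a * dval q t + (u + t * v)) (peval-* p q t) (dval-* p q t) ⟩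
    a * dval q t + (peval p t * peval q t + t * (dval p t * peval q t + peval p t * dval q t))
      ≡⟨ solve 6 (λ a t p q p′ q′ → a :* q′ :+ (p :* q :+ t :* (p′ :* q :+ p :* q′))
           := (p :+ t :* p′) :* q :+ (a :+ t :* p) :* q′) refl
           a t (peval p t) (peval q t) (dval p t) (dval q t) ⟩
    (peval p t + t * dval p t) * peval q t + (a + t * peval p t) * dval q t
      ≡⟨ cong (λ u → u * peval q t + (a + t * peval p t) * dval q t) (dval-∷ a p t) ⟨
    dval (a ∷ p) t * peval q t + peval (a ∷ p) t * dval q t ∎

  dval-cong : ∀ p q → p ≈ₚ q → ∀ t → dval p t ≡ dval q t
  dval-cong []      []      p≈q t = refl
  dval-cong []      (b ∷ q) p≈q t = sym (trans (dval-∷ b q t) (trans (cong₂ (λ u v → u + t * v)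
    (sym (peval-cong [] q (p≈q ∘ suc) t)) (sym (dval-cong [] q (p≈q ∘ suc) t))) (peval-const 0ℚ t)))
  dval-cong (a ∷ p) []      p≈q t = trans (dval-∷ a p t) (trans (cong₂ (λ u v → u + t * v)
    (peval-cong p [] (p≈q ∘ suc) t) (dval-cong p [] (p≈q ∘ suc) t)) (peval-const 0ℚ t))
  dval-cong (a ∷ p) (b ∷ q) p≈q t = trans (dval-∷ a p t) (trans (cong₂ (λ u v → u + t * v)
    (peval-cong p q (p≈q ∘ suc) t) (dval-cong p q (p≈q ∘ suc) t)) (sym (dval-∷ b q t)))

  zero? : ∀ p → Dec (p ≈ₚ 0ₚ)
  zero? []      = yes λ _ → refl
  zero? (a ∷ p) with a ℚₚ.≟ 0ℚ | zero? p
  ... | yes a≡0 | yes p≈0 = yes (0∷≈0 a≡0 p≈0)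
  ... | no a≢0  | _       = no λ ap≈0 → a≢0 (ap≈0 0)
  ... | _       | no p≉0  = no λ ap≈0 → p≉0 (ap≈0 ∘ suc)

-- Germs of rational sequences.

Eventually : Pred ℕ 0ℓ → Set
Eventually P = ∃[ N ] (∀ n → N ℕ.≤ n → P n)

always : ∀ {P : Pred ℕ 0ℓ} → (∀ n → P n) → Eventually P
always p = 0 , λ n _ → p n

eventually₁ : ∀ {P Q : Pred ℕ 0ℓ} → (∀ n → P n → Q n) → Eventually P → Eventually Q
eventually₁ f (N , p) = N , λ n n≥ → f n (p n n≥)

eventually₂ : ∀ {P Q R : Pred ℕ 0ℓ} → (∀ n → P n → Q n → R n) →
  Eventually P → Eventually Q → Eventually R
eventually₂ f (M , p) (N , q) = M ℕ.⊔ N , λ n n≥ → f n (p n (m≤ n≥)) (q n (n≤ {M} n≥))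

eventually₃ : ∀ {P Q R S : Pred ℕ 0ℓ} → (∀ n → P n → Q n → R n → S n) →
  Eventually P → Eventually Q → Eventually R → Eventually S
eventually₃ f p q r = eventually₂ (λ n g s → g s) (eventually₂ f p q) r

eventually-inhabited : ∀ {P : Pred ℕ 0ℓ} → Eventually P → ∃[ n ] P n
eventually-inhabited (N , p) = N , p N ℕₚ.≤-refl

infix 4 _~_
_~_ : (f g : ℕ → ℚ) → Set
f ~ g = Eventually λ n → f n ≡ g n

-- Equality from some index on is the right notion because `invℚ` is known to invert a denominator
-- along the sequence of `α` only for late terms.
germs : RawRing 0ℓ 0ℓ
germs = record
  { Carrier = ℕ → ℚ
  ; _≈_     = _~_
  ; _+_     = λ f g n → f n + g n
  ; _*_     = λ f g n → f n * g n
  ; -_      = λ f n → - f n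
  ; 0#      = λ _ → 0ℚ
  ; 1#      = λ _ → 1ℚ
  }

germs-isCommutativeRing : let open RawRing germs renaming (_≈_ to _≈ᵍ_; _+_ to _+ᵍ_; _*_ to _*ᵍ_; -_ to -ᵍ_) in
  IsCommutativeRing _≈ᵍ_ _+ᵍ_ _*ᵍ_ -ᵍ_ 0# 1#
germs-isCommutativeRing = record
  { isRing = record
    { +-isAbelianGroup = record
      { isGroup = record
        { isMonoid = record
          { isSemigroup = record
            { isMagma = record
              { isEquivalence = record
                { refl  = always λ _ → refl
                ; sym   = eventually₁ λ _ → sym
                ; trans = eventually₂ λ _ → trans
                }
              ; ∙-cong = eventually₂ λ _ → cong₂ _+_
              }
            ; assoc = λ f g h → always λ n → ℚₚ.+-assoc (f n) (g n) (h n)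
            }
          ; identity = (λ f → always λ n → ℚₚ.+-identityˡ (f n))
                     , (λ f → always λ n → ℚₚ.+-identityʳ (f n))
          }
        ; inverse = (λ f → always λ n → ℚₚ.+-inverseˡ (f n))
                  , (λ f → always λ n → ℚₚ.+-inverseʳ (f n))
        ; ⁻¹-cong = eventually₁ λ _ → cong (-_)
        }
      ; comm = λ f g → always λ n → ℚₚ.+-comm (f n) (g n)
      }
    ; *-cong     = eventually₂ λ _ → cong₂ _*_
    ; *-assoc    = λ f g h → always λ n → ℚₚ.*-assoc (f n) (g n) (h n)
    ; *-identity = (λ f → always λ n → ℚₚ.*-identityˡ (f n))
                 , (λ f → always λ n → ℚₚ.*-identityʳ (f n))
    ; distrib    = (λ f g h → always λ n → ℚₚ.*-distribˡ-+ (f n) (g n) (h n))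
                 , (λ f g h → always λ n → ℚₚ.*-distribʳ-+ (f n) (g n) (h n))
    }
  ; *-comm = λ f g → always λ n → ℚₚ.*-comm (f n) (g n)
  }

-- Rational functions as germs along the sequence of α.

module TranscendentalReal (α : ℝ) (tr : Transcendental α) where

  infix 9 _at_
  _at_ : Poly → ℕ → ℚ
  p at n = peval p (seq α n)

  seq-evalₚ : ∀ p n → seq (evalₚ p α) n ≡ p at n
  seq-evalₚ []      n = refl
  seq-evalₚ (a ∷ p) n = cong (λ u → a + seq α n * u) (seq-evalₚ p n)

  eventually-nonzero : ∀ p → ¬ p ≈ₚ 0ₚ → Eventually λ n → 0ℚ < ∣ p at n ∣
  eventually-nonzero p p≉0 = let δ , 0<δ , N , h = bounded-away (evalₚ p α) (tr p p≉0) in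
    N , λ n n≥ → subst (λ u → 0ℚ < ∣ u ∣) (seq-evalₚ p n) (ℚₚ.<-trans 0<δ (h n n≥))

  -- Transcendence replaces the counting of roots: a nonzero polynomial is apart from 0 at `α`,
  -- hence nonzero at all late terms of the sequence.
  ≈0-from-germ : ∀ p → Eventually (λ n → p at n ≡ 0ℚ) → p ≈ₚ 0ₚ
  ≈0-from-germ p e with zero? p
  ... | yes p≈0 = p≈0
  ... | no p≉0  = contradiction refl (ℚₚ.<⇒≢ (proj₂ (eventually-inhabited
    (eventually₂ (λ n eq → subst (λ u → 0ℚ < ∣ u ∣) eq) e (eventually-nonzero p p≉0)))))

  ≈ₚ-from-germ : ∀ p q → Eventually (λ n → p at n ≡ q at n) → p ≈ₚ q
  ≈ₚ-from-germ p q e i = begin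
    coeff p i                              ≡⟨ regroup (coeff p i) (coeff q i) ⟩
    coeff p i + - 1ℚ * coeff q i + coeff q i
      ≡⟨ cong (λ u → coeff p i + u + coeff q i) (coeff-· (- 1ℚ) q i) ⟨
    coeff p i + coeff ((- 1ℚ) ·ₚ q) i + coeff q i
      ≡⟨ cong (_+ coeff q i) (trans (sym (coeff-+ p _ i)) (p-q≈0 i)) ⟩
    0ℚ + coeff q i                         ≡⟨ ℚₚ.+-identityˡ _ ⟩
    coeff q i                              ∎
    where
    open ℚSolver
    regroup : ∀ a b → a ≡ a + - 1ℚ * b + b
    regroup = solve 2 (λ a b → a := a :+ con (- 1ℚ) :* b :+ b) refl
    p-q≈0 : p -ₚ q ≈ₚ 0ₚ
    p-q≈0 = ≈0-from-germ (p -ₚ q) (eventually₁ (λ n eq → trans (peval-sub p q (seq α n))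
      (trans (cong (_- q at n) eq) (ℚₚ.+-inverseʳ (q at n)))) e)

  ≈ₚ-from-values : ∀ p q → (∀ t → peval p t ≡ peval q t) → p ≈ₚ q
  ≈ₚ-from-values p q e = ≈ₚ-from-germ p q (always λ n → e (seq α n))

  inv-den : RatFun → ℕ → ℚ
  inv-den r n = invℚ (den r at n)

  value : RatFun → ℕ → ℚ
  value r n = num r at n * inv-den r n

  seq-eval : ∀ r n → seq (eval α tr r) n ≡ value r n
  seq-eval r n = cong₂ (λ u v → u * invℚ v) (seq-evalₚ (num r) n) (seq-evalₚ (den r) n)

  den-inverse : ∀ r → Eventually λ n → den r at n * inv-den r n ≡ 1ℚ
  den-inverse r = eventually₁ (λ n → *-invℚ (den r at n))
    (eventually-nonzero (den r) (den≉0 r))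

  module _ where
    open ℚSolver

    cross-multiply : ∀ n d i m e j → d * i ≡ 1ℚ → e * j ≡ 1ℚ → n * e ≡ m * d → n * i ≡ m * j
    cross-multiply n d i m e j di≡1 ej≡1 ne≡md = begin
      n * i             ≡⟨ ℚₚ.*-identityʳ _ ⟨
      n * i * 1ℚ        ≡⟨ cong (n * i *_) ej≡1 ⟨
      n * i * (e * j)   ≡⟨ solve 4 (λ n i e j → n :* i :* (e :* j) := n :* e :* (i :* j)) refl n i e j ⟩
      n * e * (i * j)   ≡⟨ cong (_* (i * j)) ne≡md ⟩
      m * d * (i * j)   ≡⟨ solve 4 (λ m d i j → m :* d :* (i :* j) := m :* j :* (d :* i)) refl m d i j ⟩
      m * j * (d * i)   ≡⟨ cong (m * j *_) di≡1 ⟩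
      m * j * 1ℚ        ≡⟨ ℚₚ.*-identityʳ _ ⟩
      m * j             ∎

    clear-denominators : ∀ n d i m e j → d * i ≡ 1ℚ → e * j ≡ 1ℚ → n * i ≡ m * j → n * e ≡ m * d
    clear-denominators n d i m e j di≡1 ej≡1 =
      cross-multiply n j e m i d (trans (ℚₚ.*-comm j e) ej≡1) (trans (ℚₚ.*-comm i d) di≡1)

    inverse-product : ∀ d i e j k → d * i ≡ 1ℚ → e * j ≡ 1ℚ → d * e * k ≡ 1ℚ → k ≡ i * j
    inverse-product d i e j k di≡1 ej≡1 dek≡1 = begin
      k                        ≡⟨ ℚₚ.*-identityʳ k ⟨
      k * (1ℚ * 1ℚ)            ≡⟨ cong₂ (λ u v → k * (u * v)) di≡1 ej≡1 ⟨
      k * (d * i * (e * j))    ≡⟨ solve 5 (λ d i e j k → k :* (d :* i :* (e :* j)) := d :* e :* k :* (i :* j)) refl d i e j k ⟩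
      d * e * k * (i * j)      ≡⟨ cong (_* (i * j)) dek≡1 ⟩
      1ℚ * (i * j)             ≡⟨ ℚₚ.*-identityˡ _ ⟩
      i * j                    ∎

    add-fractions : ∀ n d i m e j → d * i ≡ 1ℚ → e * j ≡ 1ℚ →
      (n * e + m * d) * (i * j) ≡ n * i + m * j
    add-fractions n d i m e j di≡1 ej≡1 = begin
      (n * e + m * d) * (i * j)
        ≡⟨ solve 6 (λ n d i m e j → (n :* e :+ m :* d) :* (i :* j)
             := n :* i :* (e :* j) :+ m :* j :* (d :* i)) refl n d i m e j ⟩
      n * i * (e * j) + m * j * (d * i)
        ≡⟨ cong₂ (λ u v → n * i * u + m * j * v) ej≡1 di≡1 ⟩
      n * i * 1ℚ + m * j * 1ℚ ≡⟨ cong₂ _+_ (ℚₚ.*-identityʳ (n * i)) (ℚₚ.*-identityʳ (m * j)) ⟩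
      n * i + m * j ∎

  value-injective : ∀ {r s} → value r ~ value s → r ≈ s
  value-injective {r} {s} e = ≈ₚ-from-germ (num r *ₚ den s) (num s *ₚ den r)
    (eventually₃ (λ n di≡1 ej≡1 eq → trans (peval-* (num r) (den s) (seq α n))
        (trans (clear-denominators (num r at n) (den r at n) (inv-den r n) (num s at n) (den s at n) (inv-den s n) di≡1 ej≡1 eq) (sym (peval-* (num s) (den r) (seq α n)))))
      (den-inverse r) (den-inverse s) e)

  value-cong : ∀ {r s} → r ≈ s → value r ~ value s
  value-cong {r} {s} r≈s = eventually₂ (λ n di≡1 ej≡1 → cross-multiply (num r at n) (den r at n) (inv-den r n) (num s at n) (den s at n) (inv-den s n) di≡1 ej≡1
      (trans (sym (peval-* (num r) (den s) (seq α n)))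
        (trans (peval-cong (num r *ₚ den s) (num s *ₚ den r) r≈s (seq α n)) (peval-* (num s) (den r) (seq α n)))))
    (den-inverse r) (den-inverse s)

  inv-den-product : ∀ r s (h : ¬ den r *ₚ den s ≈ₚ 0ₚ) → Eventually λ n →
    invℚ ((den r *ₚ den s) at n) ≡ inv-den r n * inv-den s n
  inv-den-product r s h = eventually₃ (λ n di≡1 ej≡1 dek≡1 → inverse-product
      (den r at n) (inv-den r n) (den s at n) (inv-den s n) (invℚ ((den r *ₚ den s) at n)) di≡1 ej≡1
      (trans (cong (_* invℚ ((den r *ₚ den s) at n)) (sym (peval-* (den r) (den s) (seq α n)))) dek≡1))
    (den-inverse r) (den-inverse s)
    (eventually₁ (λ n → *-invℚ ((den r *ₚ den s) at n)) (eventually-nonzero (den r *ₚ den s) h))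

  value-⊕ : ∀ r s → value (r ⊕ s) ~ λ n → value r n + value s n
  value-⊕ r s = eventually₃ (λ n di≡1 ej≡1 k≡ij → trans
      (cong₂ _*_ (trans (peval-+ (num r *ₚ den s) (num s *ₚ den r) (seq α n))
        (cong₂ _+_ (peval-* (num r) (den s) (seq α n)) (peval-* (num s) (den r) (seq α n)))) k≡ij)
      (add-fractions (num r at n) (den r at n) (inv-den r n) (num s at n) (den s at n) (inv-den s n) di≡1 ej≡1))
    (den-inverse r) (den-inverse s) (inv-den-product r s (den≉0 (r ⊕ s)))

  value-⊗ : ∀ r s → value (r ⊗ s) ~ λ n → value r n * value s n
  value-⊗ r s = eventually₁ (λ n k≡ij → trans (cong₂ _*_ (peval-* (num r) (num s) (seq α n)) k≡ij)
      (ℚSolver.solve 4 (λ a b i j → let open ℚSolver in a :* b :* (i :* j) := a :* i :* (b :* j)) refl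
        (num r at n) (num s at n) (inv-den r n) (inv-den s n)))
    (inv-den-product r s (den≉0 (r ⊗ s)))

  1≉0 : ¬ (1ℚ ∷ []) ≈ₚ 0ₚ
  1≉0 h = ℚₚ.<⇒≢ 0<1 (sym (h 0))

  poly : Poly → RatFun
  poly p = mkRatFun p (1ℚ ∷ []) 1≉0

  ⊖_ : RatFun → RatFun
  ⊖ mkRatFun n d d≉0 = mkRatFun ((- 1ℚ) ·ₚ n) d d≉0

  value-poly : ∀ p n → value (poly p) n ≡ p at n
  value-poly p n = trans (cong (p at n *_) inv-1) (ℚₚ.*-identityʳ (p at n))
    where
    1≡ : (1ℚ ∷ []) at n ≡ 1ℚ
    1≡ = peval-const 1ℚ (seq α n)
    inv-1 : invℚ ((1ℚ ∷ []) at n) ≡ 1ℚ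
    inv-1 = trans (cong invℚ 1≡) refl

  value-⊖ : ∀ r n → value (⊖ r) n ≡ - value r n
  value-⊖ r n = trans (cong (_* inv-den r n) (peval-neg (num r) (seq α n)))
    (sym (ℚₚ.neg-distribˡ-* (num r at n) (inv-den r n)))

  rational : ℚ → RatFun
  rational q = poly (q ∷ [])

  value-rational : ∀ q n → value (rational q) n ≡ q
  value-rational q n = trans (value-poly (q ∷ []) n) (peval-const q (seq α n))

  ratFuns : RawRing 0ℓ 0ℓ
  ratFuns = record
    { Carrier = RatFun
    ; _≈_     = _≈_
    ; _+_     = _⊕_
    ; _*_     = _⊗_
    ; -_      = ⊖_
    ; 0#      = rational 0ℚ
    ; 1#      = rational 1ℚ
    }

  -- Along this embedding the ring laws of fractions under cross-multiplication are inherited from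
  -- sequences.
  value-isRingMonomorphism : IsRingMonomorphism ratFuns germs value
  value-isRingMonomorphism = record
    { isRingHomomorphism = record
      { isSemiringHomomorphism = record
        { isNearSemiringHomomorphism = record
          { +-isMonoidHomomorphism = record
            { isMagmaHomomorphism = record
              { isRelHomomorphism = record { cong = λ {r} {s} → value-cong {r} {s} }
              ; homo              = value-⊕
              }
            ; ε-homo = always (value-rational 0ℚ)
            }
          ; *-homo = value-⊗
          }
        ; 1#-homo = always (value-rational 1ℚ)
        }
      ; -‿homo = λ r → always (value-⊖ r)
      }
    ; injective = λ {r} {s} → value-injective {r} {s}
    }

  ratFuns-commutativeRing : CommutativeRing 0ℓ 0ℓ
  ratFuns-commutativeRing = record
    { isCommutativeRing = RingMonomorphism.isCommutativeRing value-isRingMonomorphism germs-isCommutativeRing }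

  -- The order on ℚ(α).

  EventuallyPos : (ℕ → ℚ) → Set
  EventuallyPos f = ∃[ ε ] (0ℚ < ε × Eventually λ n → ε < f n)

  pos-resp : ∀ {f g} → f ~ g → EventuallyPos f → EventuallyPos g
  pos-resp e (ε , 0<ε , h) = ε , 0<ε , eventually₂ (λ n eq ε<f → subst (ε <_) eq ε<f) e h

  pos-intro : ∀ {r} → EventuallyPos (value r) → ℚ⟨α⟩⁺ α tr r
  pos-intro {r} = pos-resp (always λ n → trans (sym (seq-eval r n)) (sym (ℚₚ.+-identityʳ (seq (eval α tr r) n))))

  pos-elim : ∀ {r} → ℚ⟨α⟩⁺ α tr r → EventuallyPos (value r)
  pos-elim {r} = pos-resp (always λ n → trans (ℚₚ.+-identityʳ (seq (eval α tr r) n)) (seq-eval r n))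

  neg-intro : ∀ {r} → EventuallyPos (λ n → - value r n) → eval α tr r <ᵣ 0ᵣ
  neg-intro {r} = pos-resp (always λ n → trans (cong (-_) (sym (seq-eval r n))) (sym (ℚₚ.+-identityˡ _)))

  neg-elim : ∀ {r} → eval α tr r <ᵣ 0ᵣ → EventuallyPos (λ n → - value r n)
  neg-elim {r} = pos-resp (always λ n → trans (ℚₚ.+-identityˡ _) (cong (-_) (seq-eval r n)))

  pos-+ : ∀ {f g} → EventuallyPos f → EventuallyPos g → EventuallyPos (λ n → f n + g n)
  pos-+ (ε , 0<ε , h) (δ , 0<δ , k) = ε + δ , ℚₚ.+-mono-< 0<ε 0<δ , eventually₂ (λ _ → ℚₚ.+-mono-<) h k

  pos-* : ∀ {f g} → EventuallyPos f → EventuallyPos g → EventuallyPos (λ n → f n * g n)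
  pos-* (ε , 0<ε , h) (δ , 0<δ , k) = ε * δ , *-pos 0<ε 0<δ , eventually₂
    (λ n ε<f δ<g → *-mono-≤-< (ℚₚ.<⇒≤ 0<δ) (ℚₚ.<-trans 0<ε ε<f) (ℚₚ.<⇒≤ ε<f) δ<g) h k

  pos-const : ∀ {q} → 0ℚ < q → EventuallyPos (λ _ → q)
  pos-const 0<q = let ε , 0<ε , ε<q = ℚₚ.<-dense 0<q in ε , 0<ε , always λ _ → ε<q

  ¬pos-0 : ¬ EventuallyPos (λ _ → 0ℚ)
  ¬pos-0 (ε , 0<ε , h) = ℚₚ.<-asym 0<ε (proj₂ (eventually-inhabited h))

  -- If d i = 1 and d is bounded, then i² is bounded away from 0, so n i = (n d) i² is as positive
  -- as n d.
  pos-divide : ∀ (f : ℕ → ℚ) d (d≉0 : ¬ d ≈ₚ 0ₚ) → EventuallyPos (λ n → f n * d at n) →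
    EventuallyPos (λ n → f n * invℚ (d at n))
  pos-divide f d d≉0 fd>0 = pos-resp
    (eventually₁ (λ n di≡1 → cancel (f n) (d at n) (invℚ (d at n)) di≡1) d-inverse)
    (pos-* fd>0 inverse²>0)
    where
    d-inverse : Eventually λ n → d at n * invℚ (d at n) ≡ 1ℚ
    d-inverse = den-inverse (mkRatFun d d d≉0)
    cancel : ∀ x d i → d * i ≡ 1ℚ → x * d * (i * i) ≡ x * i
    cancel x d i di≡1 = trans (solve 3 (λ x d i → x :* d :* (i :* i) := x :* i :* (d :* i)) refl x d i)
      (trans (cong (x * i *_) di≡1) (ℚₚ.*-identityʳ (x * i)))
      where open ℚSolver
    inverse²>0 : EventuallyPos (λ n → invℚ (d at n) * invℚ (d at n))
    inverse²>0 =
      let C , 0<C , N , ∣d∣≤C = eventually-bounded {seq (evalₚ d α)} (isCauchy (evalₚ d α))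
          D = (ℚ.1/ C) {{ℚ.>-nonZero 0<C}}
          0<D = 1/-pos 0<C
          ε , 0<ε , ε<DD = ℚₚ.<-dense (*-pos 0<D 0<D)
      in ε , 0<ε , eventually₂ (λ n d≤C di≡1 → ℚₚ.<-≤-trans ε<DD
           (square-bound C D (d at n) (invℚ (d at n)) 0<D (*-inverse C 0<C)
             (subst (λ u → ∣ u ∣ ≤ C) (seq-evalₚ d n) d≤C) di≡1))
           (N , ∣d∣≤C) d-inverse
      where
      *-inverse : ∀ C (0<C : 0ℚ < C) → (ℚ.1/ C) {{ℚ.>-nonZero 0<C}} * C ≡ 1ℚ
      *-inverse C 0<C = ℚₚ.*-inverseˡ C {{ℚ.>-nonZero 0<C}}
      square-bound : ∀ C D d i → 0ℚ < D → D * C ≡ 1ℚ → ∣ d ∣ ≤ C → d * i ≡ 1ℚ → D * D ≤ i * i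
      square-bound C D d i 0<D DC≡1 d≤C di≡1 =
        subst (D * D ≤_) (trans (sym (ℚₚ.∣p*q∣≡∣p∣*∣q∣ i i)) (∣i*i∣ i))
          (ℚₚ.≤-trans (ℚₚ.*-monoʳ-≤-nonNeg D {{ℚ.nonNegative (ℚₚ.<⇒≤ 0<D)}} D≤∣i∣)
                      (ℚₚ.*-monoˡ-≤-nonNeg ∣ i ∣ {{ℚₚ.∣-∣-nonNeg i}} D≤∣i∣))
        where
        ∣i*i∣ : ∀ i → ∣ i * i ∣ ≡ i * i
        ∣i*i∣ i with ℚₚ.≤-total 0ℚ i
        ... | inj₁ 0≤i = ℚₚ.0≤p⇒∣p∣≡p (subst (_≤ i * i) (ℚₚ.*-zeroˡ i)
          (ℚₚ.*-monoʳ-≤-nonNeg i {{ℚ.nonNegative 0≤i}} 0≤i))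
        ... | inj₂ i≤0 = ℚₚ.0≤p⇒∣p∣≡p (subst (_≤ i * i) (ℚₚ.*-zeroˡ i)
          (ℚₚ.*-monoʳ-≤-nonPos i {{ℚ.nonPositive i≤0}} i≤0))
        D≤∣i∣ : D ≤ ∣ i ∣
        D≤∣i∣ = ℚₚ.≤-trans (ℚₚ.≤-reflexive (sym (trans (cong (D *_) ∣d∣∣i∣≡1) (ℚₚ.*-identityʳ D))))
          (ℚₚ.≤-trans
            (ℚₚ.*-monoˡ-≤-nonNeg D {{ℚ.nonNegative (ℚₚ.<⇒≤ 0<D)}}
              (ℚₚ.*-monoʳ-≤-nonNeg ∣ i ∣ {{ℚₚ.∣-∣-nonNeg i}} d≤C))
            (ℚₚ.≤-reflexive (trans (sym (ℚₚ.*-assoc D C ∣ i ∣))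
              (trans (cong (_* ∣ i ∣) DC≡1) (ℚₚ.*-identityˡ ∣ i ∣)))))
          where
          ∣d∣∣i∣≡1 : ∣ d ∣ * ∣ i ∣ ≡ 1ℚ
          ∣d∣∣i∣≡1 = trans (sym (ℚₚ.∣p*q∣≡∣p∣*∣q∣ d i)) (cong ∣_∣ di≡1)

  -- The sign of a fraction is that of numerator times denominator. This is a polynomial, so unless
  -- the numerator is zero, which is decidable, transcendence supplies its sign.
  pos-trichotomy : ∀ r → EventuallyPos (value r) ⊎ r ≈ rational 0ℚ ⊎ EventuallyPos (λ n → - value r n)
  pos-trichotomy r with zero? (num r)
  ... | yes n≈0 = inj₂ (inj₁ (value-injective {r} {rational 0ℚ} (always λ n →
    trans (cong (_* inv-den r n) (peval-cong (num r) 0ₚ n≈0 (seq α n)))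
      (trans (ℚₚ.*-zeroˡ (inv-den r n)) (sym (value-rational 0ℚ n))))))
  ... | no n≉0 = [ (λ neg → inj₂ (inj₂ (pos-resp
                       (always λ n → sym (ℚₚ.neg-distribˡ-* (num r at n) (inv-den r n)))
                       (pos-divide (λ n → - num r at n) (den r) (den≉0 r) (pos-resp
                         (always λ n → trans (ℚₚ.+-identityˡ (- seq (evalₚ (num r *ₚ den r) α) n)) (trans (cong (-_) (seq-nd n))
                           (ℚₚ.neg-distribˡ-* (num r at n) (den r at n)))) neg)))))
                 , (λ pos → inj₁ (pos-divide (num r at_) (den r) (den≉0 r) (pos-resp
                       (always λ n → trans (ℚₚ.+-identityʳ (seq (evalₚ (num r *ₚ den r) α) n)) (seq-nd n)) pos)))
                 ]′ (tr (num r *ₚ den r) (*ₚ-≉0 {num r} {den r} n≉0 (den≉0 r)))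
    where
    seq-nd : ∀ n → seq (evalₚ (num r *ₚ den r) α) n ≡ num r at n * den r at n
    seq-nd n = trans (seq-evalₚ (num r *ₚ den r) n) (peval-* (num r) (den r) (seq α n))

  -- The rational x_N + ε/2 works, where N is so large that x - x_N stays below ε/4.
  pos-dense : ∀ (x : ℝ) {f g : ℕ → ℚ} → f ~ seq x → EventuallyPos (λ n → g n - f n) →
    ∃[ q ] (EventuallyPos (λ n → q - f n) × EventuallyPos (λ n → g n - q))
  pos-dense x {f} {g} f~x (ε , 0<ε , h) =
    let ε/4 = ℚ.½ * (ℚ.½ * ε)
        0<ε/4 = *-pos (ℚₚ.positive⁻¹ ½) (*-pos (ℚₚ.positive⁻¹ ½) 0<ε)
        N , close = isCauchy x ε/4 0<ε/4
        near : Eventually λ n → ∣ seq x N - f n ∣ < ε/4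
        near = eventually₂ (λ n eq c → subst (λ u → ∣ seq x N - u ∣ < ε/4) (sym eq) c) f~x
                 (N , λ n n≥ → close N n ℕₚ.≤-refl n≥)
    in seq x N + ½ * ε
     , (ε/4 , 0<ε/4 , eventually₁ (λ n → above-f (seq x N) (f n)) near)
     , (ε/4 , 0<ε/4 , eventually₂ (λ n → below-g (seq x N) (f n) (g n)) near h)
    where
    open ℚSolver
    above-f : ∀ c u → ∣ c - u ∣ < ½ * (½ * ε) → ½ * (½ * ε) < c + ½ * ε - u
    above-f c u c-u = subst₂ _<_
      (solve 1 (λ e → con ½ :* e :+ :- (con ½ :* (con ½ :* e)) := con ½ :* (con ½ :* e)) refl ε)
      (solve 3 (λ e c u → con ½ :* e :+ :- (u :- c) := c :+ con ½ :* e :- u) refl ε c u)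
      (ℚₚ.+-monoʳ-< (½ * ε) (ℚₚ.neg-antimono-< (ℚₚ.≤-<-trans (p≤∣p∣ (u - c))
        (subst (_< ½ * (½ * ε)) (trans (sym (ℚₚ.∣-p∣≡∣p∣ (c - u))) (cong ∣_∣
          (solve 2 (λ c u → :- (c :- u) := u :- c) refl c u))) c-u))))
    below-g : ∀ c u v → ∣ c - u ∣ < ½ * (½ * ε) → ε < v - u → ½ * (½ * ε) < v - (c + ½ * ε)
    below-g c u v c-u ε<v-u = subst₂ _<_
      (solve 1 (λ e → e :+ :- (con ½ :* (con ½ :* e)) :- con ½ :* e := con ½ :* (con ½ :* e)) refl ε)
      (solve 4 (λ e c u v → v :- u :+ :- (c :- u) :- con ½ :* e := v :- (c :+ con ½ :* e)) refl ε c u v)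
      (ℚₚ.+-monoˡ-< (- (½ * ε)) (ℚₚ.+-mono-< ε<v-u
        (ℚₚ.neg-antimono-< (ℚₚ.≤-<-trans (p≤∣p∣ (c - u)) c-u))))

  sym~ : ∀ {f g} → f ~ g → g ~ f
  sym~ = eventually₁ λ _ → sym

  infixr 5 _∙∙_ _∙_
  _∙∙_ : ∀ {f g h} → f ~ g → g ~ h → f ~ h
  _∙∙_ = eventually₂ λ _ → trans

  _∙_ : ∀ {f g h : ℕ → ℚ} → (∀ n → f n ≡ g n) → g ~ h → f ~ h
  e ∙ e′ = always e ∙∙ e′

  K : DenseOrderedField
  K = record
    { commutativeRing = ratFuns-commutativeRing
    ; ι          = rational
    ; ι-+        = λ p q → value-injective {rational (p + q)} {rational p ⊕ rational q}
        (value-rational (p + q) ∙ sym~ (value-⊕ (rational p) (rational q)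
          ∙∙ always λ n → cong₂ _+_ (value-rational p n) (value-rational q n)))
    ; ι-*        = λ p q → value-injective {rational (p * q)} {rational p ⊗ rational q}
        (value-rational (p * q) ∙ sym~ (value-⊗ (rational p) (rational q)
          ∙∙ always λ n → cong₂ _*_ (value-rational p n) (value-rational q n)))
    ; ι-neg      = λ q → value-injective {rational (- q)} {⊖ rational q}
        (always λ n → trans (value-rational (- q) n)
          (sym (trans (value-⊖ (rational q) n) (cong (-_) (value-rational q n)))))
    ; ι-0        = ≈-refl (rational 0ℚ)
    ; ι-1        = ≈-refl (rational 1ℚ)
    ; Pos        = ℚ⟨α⟩⁺ α tr
    ; Pos-resp   = λ {r} {s} r≈s p → pos-intro {s} (pos-resp (value-cong {r} {s} r≈s) (pos-elim {r} p))
    ; Pos-+      = λ {r} {s} p q → pos-intro {r ⊕ s}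
        (pos-resp (sym~ (value-⊕ r s)) (pos-+ (pos-elim {r} p) (pos-elim {s} q)))
    ; Pos-*      = λ {r} {s} p q → pos-intro {r ⊗ s}
        (pos-resp (sym~ (value-⊗ r s)) (pos-* (pos-elim {r} p) (pos-elim {s} q)))
    ; Pos-ι      = λ {q} 0<q → pos-intro {rational q}
        (pos-resp (always λ n → sym (value-rational q n)) (pos-const 0<q))
    ; ¬Pos-0     = λ p → ¬pos-0 (pos-resp (always (value-rational 0ℚ)) (pos-elim {rational 0ℚ} p))
    ; trichotomy = λ r → [ inj₁ ∘ pos-intro {r}
                         , inj₂ ∘ [ inj₁ , inj₂ ∘ ⊖-pos-intro r ]′ ]′ (pos-trichotomy r)
    ; dense      = λ r s p →
        let q , p₁ , p₂ = pos-dense (eval α tr r) {value r} {value s} (always λ n → sym (seq-eval r n))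
                            (pos-resp (value-⊕⊖ s r) (pos-elim {s ⊕ ⊖ r} p))
        in q , pos-intro {rational q ⊕ ⊖ r} (pos-resp (sym~ (value-⊕⊖ (rational q) r
                 ∙∙ always λ n → cong (_- value r n) (value-rational q n))) p₁)
             , pos-intro {s ⊕ ⊖ rational q} (pos-resp (sym~ (value-⊕⊖ s (rational q)
                 ∙∙ always λ n → cong (λ u → value s n - u) (value-rational q n))) p₂)
    }
    where
    ≈-refl : ∀ r → r ≈ r
    ≈-refl r _ = refl
    ⊖-pos-intro : ∀ r → EventuallyPos (λ n → - value r n) → ℚ⟨α⟩⁺ α tr (⊖ r)
    ⊖-pos-intro r = pos-intro {⊖ r} ∘ pos-resp (always λ n → sym (value-⊖ r n))
    value-⊕⊖ : ∀ r s → value (r ⊕ ⊖ s) ~ λ n → value r n - value s n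
    value-⊕⊖ r s = value-⊕ r (⊖ s) ∙∙ always λ n → cong (value r n +_) (value-⊖ s n)

  -- The formal derivative is a derivation.

  ≈-from-values : ∀ {r s} → (∀ t → peval (num r) t * peval (den s) t ≡ peval (num s) t * peval (den r) t) →
    r ≈ s
  ≈-from-values {r} {s} e = ≈ₚ-from-values (num r *ₚ den s) (num s *ₚ den r) λ t →
    trans (peval-* (num r) (den s) t) (trans (e t) (sym (peval-* (num s) (den r) t)))

  ≈-values : ∀ {r s} → r ≈ s → ∀ t → peval (num r) t * peval (den s) t ≡ peval (num s) t * peval (den r) t
  ≈-values {r} {s} r≈s t = trans (sym (peval-* (num r) (den s) t))
    (trans (peval-cong (num r *ₚ den s) (num s *ₚ den r) r≈s t) (peval-* (num s) (den r) t))

  wronskian : RatFun → ℚ → ℚ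
  wronskian r t = dval (num r) t * peval (den r) t - peval (num r) t * dval (den r) t

  num-deriv : ∀ r t → peval (num (deriv r)) t ≡ wronskian r t
  num-deriv r t = trans (peval-sub (derivₚ (num r) *ₚ den r) (num r *ₚ derivₚ (den r)) t)
    (cong₂ _-_ (peval-* (derivₚ (num r)) (den r) t) (peval-* (num r) (derivₚ (den r)) t))

  den-deriv : ∀ r t → peval (den (deriv r)) t ≡ peval (den r) t * peval (den r) t
  den-deriv r t = peval-* (den r) (den r) t

  module _ where
    open ℚSolver

    -- The second hypothesis is the derivative of the first.
    deriv-cong-identity : ∀ n d m e n′ d′ m′ e′ → n * e ≡ m * d → n′ * e + n * e′ ≡ m′ * d + m * d′ →
      (n′ * d - n * d′) * (e * e) ≡ (m′ * e - m * e′) * (d * d)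
    deriv-cong-identity n d m e n′ d′ m′ e′ eq eq′ = begin
      (n′ * d - n * d′) * (e * e)
        ≡⟨ solve 6 (λ n d e n′ d′ e′ → (n′ :* d :- n :* d′) :* (e :* e)
             := (n′ :* e :+ n :* e′) :* (d :* e) :- n :* e :* (d :* e′ :+ d′ :* e)) refl n d e n′ d′ e′ ⟩
      (n′ * e + n * e′) * (d * e) - n * e * (d * e′ + d′ * e)
        ≡⟨ cong₂ (λ u v → u * (d * e) - v * (d * e′ + d′ * e)) eq′ eq ⟩
      (m′ * d + m * d′) * (d * e) - m * d * (d * e′ + d′ * e)
        ≡⟨ solve 6 (λ d m e d′ m′ e′ → (m′ :* d :+ m :* d′) :* (d :* e) :- m :* d :* (d :* e′ :+ d′ :* e)
             := (m′ :* e :- m :* e′) :* (d :* d)) refl d m e d′ m′ e′ ⟩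
      (m′ * e - m * e′) * (d * d) ∎

    deriv-+-identity : ∀ n d m e n′ d′ m′ e′ →
      (n′ * e + n * e′ + (m′ * d + m * d′)) * (d * e) - (n * e + m * d) * (d′ * e + d * e′)
      ≡ (n′ * d - n * d′) * (e * e) + (m′ * e - m * e′) * (d * d)
    deriv-+-identity = solve 8 (λ n d m e n′ d′ m′ e′ →
      (n′ :* e :+ n :* e′ :+ (m′ :* d :+ m :* d′)) :* (d :* e) :- (n :* e :+ m :* d) :* (d′ :* e :+ d :* e′)
      := (n′ :* d :- n :* d′) :* (e :* e) :+ (m′ :* e :- m :* e′) :* (d :* d)) refl

    deriv-*-identity : ∀ n d m e n′ d′ m′ e′ →
      (n′ * m + n * m′) * (d * e) - n * m * (d′ * e + d * e′)
      ≡ (n′ * d - n * d′) * (m * e) + n * d * (m′ * e - m * e′)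
    deriv-*-identity = solve 8 (λ n d m e n′ d′ m′ e′ →
      (n′ :* m :+ n :* m′) :* (d :* e) :- n :* m :* (d′ :* e :+ d :* e′)
      := (n′ :* d :- n :* d′) :* (m :* e) :+ n :* d :* (m′ :* e :- m :* e′)) refl

    -- For `deriv-⊗`, with `u` and `v` the Wronskians of the factors: one side has denominator
    -- `(d * e)²`, the other `d² * e` times `d * e²`.
    cross-multiply-product : ∀ n d m e u v →
      (u * (m * e) + n * d * v) * (d * d * e * (d * (e * e)))
      ≡ (u * m * (d * (e * e)) + n * v * (d * d * e)) * (d * e * (d * e))
    cross-multiply-product = solve 6 (λ n d m e u v →
      (u :* (m :* e) :+ n :* d :* v) :* (d :* d :* e :* (d :* (e :* e)))
      := (u :* m :* (d :* (e :* e)) :+ n :* v :* (d :* d :* e)) :* (d :* e :* (d :* e))) refl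

  deriv-cong : ∀ {r s} → r ≈ s → deriv r ≈ deriv s
  deriv-cong {r} {s} r≈s = ≈-from-values {deriv r} {deriv s} λ t → trans
    (cong₂ _*_ (num-deriv r t) (den-deriv s t)) (trans
    (deriv-cong-identity (peval (num r) t) (peval (den r) t) (peval (num s) t) (peval (den s) t)
      (dval (num r) t) (dval (den r) t) (dval (num s) t) (dval (den s) t) (≈-values {r} {s} r≈s t)
      (trans (sym (dval-* (num r) (den s) t))
        (trans (dval-cong (num r *ₚ den s) (num s *ₚ den r) r≈s t) (dval-* (num s) (den r) t))))
    (sym (cong₂ _*_ (num-deriv s t) (den-deriv r t))))

  deriv-⊕ : ∀ r s → deriv (r ⊕ s) ≈ deriv r ⊕ deriv s
  deriv-⊕ r s = ≈-from-values {deriv (r ⊕ s)} {deriv r ⊕ deriv s} λ t →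
    let n = peval (num r) t ; d = peval (den r) t ; m = peval (num s) t ; e = peval (den s) t
        n′ = dval (num r) t ; d′ = dval (den r) t ; m′ = dval (num s) t ; e′ = dval (den s) t
        numerators : peval (num (deriv (r ⊕ s))) t ≡ peval (num (deriv r ⊕ deriv s)) t
        numerators = trans (num-deriv (r ⊕ s) t) (trans
          (cong₂ _-_
            (cong₂ _*_ (trans (dval-+ (num r *ₚ den s) (num s *ₚ den r) t)
              (cong₂ _+_ (dval-* (num r) (den s) t) (dval-* (num s) (den r) t))) (peval-* (den r) (den s) t))
            (cong₂ _*_ (trans (peval-+ (num r *ₚ den s) (num s *ₚ den r) t)
              (cong₂ _+_ (peval-* (num r) (den s) t) (peval-* (num s) (den r) t))) (dval-* (den r) (den s) t)))
          (trans (deriv-+-identity n d m e n′ d′ m′ e′) (sym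
            (trans (peval-+ (num (deriv r) *ₚ den (deriv s)) (num (deriv s) *ₚ den (deriv r)) t)
              (cong₂ _+_
                (trans (peval-* (num (deriv r)) (den (deriv s)) t) (cong₂ _*_ (num-deriv r t) (den-deriv s t)))
                (trans (peval-* (num (deriv s)) (den (deriv r)) t) (cong₂ _*_ (num-deriv s t) (den-deriv r t))))))))
        denominators : peval (den (deriv r ⊕ deriv s)) t ≡ peval (den (deriv (r ⊕ s))) t
        denominators = trans (peval-* (den (deriv r)) (den (deriv s)) t)
          (trans (cong₂ _*_ (den-deriv r t) (den-deriv s t)) (trans (regroup d e)
            (sym (trans (den-deriv (r ⊕ s) t) (cong₂ _*_ (peval-* (den r) (den s) t) (peval-* (den r) (den s) t))))))
    in cong₂ _*_ numerators denominators
    where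
    regroup : ∀ d e → d * d * (e * e) ≡ d * e * (d * e)
    regroup = solve 2 (λ d e → d :* d :* (e :* e) := d :* e :* (d :* e)) refl
      where open ℚSolver

  deriv-⊗ : ∀ r s → deriv (r ⊗ s) ≈ deriv r ⊗ s ⊕ r ⊗ deriv s
  deriv-⊗ r s = ≈-from-values {deriv (r ⊗ s)} {deriv r ⊗ s ⊕ r ⊗ deriv s} λ t →
    let n = peval (num r) t ; d = peval (den r) t ; m = peval (num s) t ; e = peval (den s) t
        n′ = dval (num r) t ; d′ = dval (den r) t ; m′ = dval (num s) t ; e′ = dval (den s) t
        x = deriv r ⊗ s ; y = r ⊗ deriv s
        num-l : peval (num (deriv (r ⊗ s))) t ≡ wronskian r t * (m * e) + n * d * wronskian s t
        num-l = trans (num-deriv (r ⊗ s) t) (trans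
          (cong₂ _-_ (cong₂ _*_ (dval-* (num r) (num s) t) (peval-* (den r) (den s) t))
                     (cong₂ _*_ (peval-* (num r) (num s) t) (dval-* (den r) (den s) t)))
          (deriv-*-identity n d m e n′ d′ m′ e′))
        den-l : peval (den (deriv (r ⊗ s))) t ≡ d * e * (d * e)
        den-l = trans (den-deriv (r ⊗ s) t) (cong₂ _*_ (peval-* (den r) (den s) t) (peval-* (den r) (den s) t))
        den-x : peval (den x) t ≡ d * d * e
        den-x = trans (peval-* (den (deriv r)) (den s) t) (cong (_* e) (den-deriv r t))
        den-y : peval (den y) t ≡ d * (e * e)
        den-y = trans (peval-* (den r) (den (deriv s)) t) (cong (d *_) (den-deriv s t))
        num-x : peval (num x) t ≡ wronskian r t * m
        num-x = trans (peval-* (num (deriv r)) (num s) t) (cong (_* m) (num-deriv r t))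
        num-y : peval (num y) t ≡ n * wronskian s t
        num-y = trans (peval-* (num r) (num (deriv s)) t) (cong (n *_) (num-deriv s t))
        num-r : peval (num (x ⊕ y)) t ≡ wronskian r t * m * (d * (e * e)) + n * wronskian s t * (d * d * e)
        num-r = trans (peval-+ (num x *ₚ den y) (num y *ₚ den x) t) (cong₂ _+_
          (trans (peval-* (num x) (den y) t) (cong₂ _*_ num-x den-y))
          (trans (peval-* (num y) (den x) t) (cong₂ _*_ num-y den-x)))
        den-r : peval (den (x ⊕ y)) t ≡ d * d * e * (d * (e * e))
        den-r = trans (peval-* (den x) (den y) t) (cong₂ _*_ den-x den-y)
    in trans (cong₂ _*_ num-l den-r) (trans
         (cross-multiply-product n d m e (wronskian r t) (wronskian s t))
         (sym (cong₂ _*_ num-r den-l)))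

  deriv-poly : ∀ p → deriv (poly p) ≈ poly (derivₚ p)
  deriv-poly p = ≈-from-values {deriv (poly p)} {poly (derivₚ p)} λ t → cong₂ _*_
    (trans (num-deriv (poly p) t) (trans
      (cong₂ (λ u v → dval p t * u - peval p t * v) (peval-const 1ℚ t) (dval-const 1ℚ t))
      (simplify (dval p t) (peval p t))))
    (sym (trans (den-deriv (poly p) t) (trans (cong (_* one t) (peval-const 1ℚ t)) (ℚₚ.*-identityˡ (one t)))))
    where
    one : ℚ → ℚ
    one = peval (1ℚ ∷ [])
    simplify : ∀ u v → u * 1ℚ - v * 0ℚ ≡ u
    simplify = solve 2 (λ u v → u :* con 1ℚ :- v :* con 0ℚ := u) refl
      where open ℚSolver

  -- Rational functions with derivative zero are constant.

  -- Pointwise cancellation fails at `t = 0`; instead equal values give equal coefficients, and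
  -- those of `p` and `q` are found one place further up.
  ≡-from-0∷ : ∀ p q → (∀ t → t * peval p t ≡ t * peval q t) → ∀ t → peval p t ≡ peval q t
  ≡-from-0∷ p q e = peval-cong p q (≈ₚ-from-values (0ℚ ∷ p) (0ℚ ∷ q) (λ t →
    trans (peval-0∷ p t) (trans (e t) (sym (peval-0∷ q t)))) ∘ suc)

  -- The hypothesis says that (xᵏm)′ d = xᵏm d′ for k = suc j; at t = 0 it forces the constant
  -- term of m to vanish, and m = x m₁ satisfies the same with k + 1.
  wronskian-vanishes : ∀ j m d → ¬ peval d 0ℚ ≡ 0ℚ →
    (∀ t → (ℕ→ℚ (suc j) * peval m t + t * dval m t) * peval d t ≡ t * peval m t * dval d t) →
    ∀ t → peval m t ≡ 0ℚ
  wronskian-vanishes j []      d d₀≢0 e t = refl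
  wronskian-vanishes j (b ∷ m) d d₀≢0 e t = trans (cong₂ (λ b u → b + t * u) b≡0
      (wronskian-vanishes (suc j) m d d₀≢0 shifted t)) (peval-const 0ℚ t)
    where
    open ℚSolver
    k = ℕ→ℚ (suc j)
    k≢0 : ¬ k ≡ 0ℚ
    k≢0 k≡0 = ℚₚ.<⇒≢ (ℚₚ.+-mono-<-≤ 0<1 (0≤ℕ→ℚ j)) (sym k≡0)
    at-0 : k * b * peval d 0ℚ ≡ 0ℚ
    at-0 = trans (solve 4 (λ k b w d → k :* b :* d := (k :* b :+ con 0ℚ :* w) :* d) refl
          k b (dval (b ∷ m) 0ℚ) (peval d 0ℚ))
      (trans (cong (λ u → (k * u + 0ℚ * dval (b ∷ m) 0ℚ) * peval d 0ℚ) (sym (peval-at-0 b m)))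
      (trans (e 0ℚ) (solve 2 (λ u w → con 0ℚ :* u :* w := con 0ℚ) refl (peval (b ∷ m) 0ℚ) (dval d 0ℚ))))
    b≡0 : b ≡ 0ℚ
    b≡0 = [ (λ kb≡0 → [ (λ k≡0 → contradiction k≡0 k≢0) , id ]′ (p*q≡0 k b kb≡0))
          , (λ d₀≡0 → contradiction d₀≡0 d₀≢0) ]′ (p*q≡0 (k * b) (peval d 0ℚ) at-0)
    lhs rhs : Poly
    lhs = (ℕ→ℚ (suc (suc j)) ·ₚ m +ₚ (0ℚ ∷ derivₚ m)) *ₚ d
    rhs = (0ℚ ∷ m) *ₚ derivₚ d
    lhs≡ : ∀ t → peval lhs t ≡ ((1ℚ + k) * peval m t + t * dval m t) * peval d t
    lhs≡ t = trans (peval-* (ℕ→ℚ (suc (suc j)) ·ₚ m +ₚ (0ℚ ∷ derivₚ m)) d t)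
      (cong (_* peval d t) (trans (peval-+ (ℕ→ℚ (suc (suc j)) ·ₚ m) (0ℚ ∷ derivₚ m) t)
      (cong₂ _+_ (peval-· (ℕ→ℚ (suc (suc j))) m t) (peval-0∷ (derivₚ m) t))))
    rhs≡ : ∀ t → peval rhs t ≡ t * peval m t * dval d t
    rhs≡ t = trans (peval-* (0ℚ ∷ m) (derivₚ d) t) (cong (_* dval d t) (peval-0∷ m t))
    times-t : ∀ t → t * peval lhs t ≡ t * peval rhs t
    times-t t = begin
      t * peval lhs t ≡⟨ cong (t *_) (lhs≡ t) ⟩
      t * (((1ℚ + k) * peval m t + t * dval m t) * peval d t)
        ≡⟨ solve 5 (λ t k m m′ d → t :* (((con 1ℚ :+ k) :* m :+ t :* m′) :* d)
             := (k :* (con 0ℚ :+ t :* m) :+ t :* (m :+ t :* m′)) :* d) refl t k (peval m t) (dval m t) (peval d t) ⟩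
      (k * (0ℚ + t * peval m t) + t * (peval m t + t * dval m t)) * peval d t
        ≡⟨ cong₂ (λ u v → (k * (u + t * peval m t) + t * v) * peval d t) (sym b≡0) (sym (dval-∷ b m t)) ⟩
      (k * peval (b ∷ m) t + t * dval (b ∷ m) t) * peval d t ≡⟨ e t ⟩
      t * (b + t * peval m t) * dval d t ≡⟨ cong (λ u → t * (u + t * peval m t) * dval d t) b≡0 ⟩
      t * (0ℚ + t * peval m t) * dval d t
        ≡⟨ solve 3 (λ t m d′ → t :* (con 0ℚ :+ t :* m) :* d′ := t :* (t :* m :* d′)) refl t (peval m t) (dval d t) ⟩
      t * (t * peval m t * dval d t) ≡⟨ cong (t *_) (rhs≡ t) ⟨
      t * peval rhs t ∎
    shifted : ∀ t → ((1ℚ + k) * peval m t + t * dval m t) * peval d t ≡ t * peval m t * dval d t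
    shifted t = trans (sym (lhs≡ t)) (trans (≡-from-0∷ lhs rhs times-t t) (rhs≡ t))

  -- The cleared form of `n′ / n = d′ / d`, equivalently of a vanishing derivative of `n / d`.
  SameLogDeriv : (n d : Poly) → Set
  SameLogDeriv n d = ∀ t → dval n t * peval d t ≡ peval n t * dval d t

  -- The starting case `k = 1` of `wronskian-vanishes`, applied to `x m`.
  vanishes : ∀ b m d → b ≡ 0ℚ → ¬ peval d 0ℚ ≡ 0ℚ → SameLogDeriv (b ∷ m) d → ∀ t → peval (b ∷ m) t ≡ 0ℚ
  vanishes b m d refl d₀≢0 e t = trans (peval-0∷ m t) (trans
    (cong (t *_) (wronskian-vanishes 0 m d d₀≢0 (λ t → begin
      (1ℚ * peval m t + t * dval m t) * peval d t
        ≡⟨ cong (λ u → (u + t * dval m t) * peval d t) (ℚₚ.*-identityˡ (peval m t)) ⟩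
      (peval m t + t * dval m t) * peval d t   ≡⟨ cong (_* peval d t) (dval-∷ 0ℚ m t) ⟨
      dval (0ℚ ∷ m) t * peval d t              ≡⟨ e t ⟩
      peval (0ℚ ∷ m) t * dval d t              ≡⟨ cong (_* dval d t) (peval-0∷ m t) ⟩
      t * peval m t * dval d t                 ∎) t))
    (ℚₚ.*-zeroʳ t))

  -- Common factors of the variable are removed until a constant term is nonzero. If it is that of
  -- `d`, subtracting `c = b / a` times `d` from `n` kills the constant term and preserves the
  -- relation, so `vanishes` leaves nothing over. If only that of `n` is nonzero, `vanishes` with
  -- the roles exchanged would make `d` zero.
  proportional : ∀ d n → ¬ d ≈ₚ 0ₚ → SameLogDeriv n d → ∃[ c ] (∀ t → peval n t ≡ c * peval d t)
  proportional []      n       d≉0 e = contradiction (λ _ → refl) d≉0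
  proportional (a ∷ d) []      d≉0 e = 0ℚ , λ t → sym (ℚₚ.*-zeroˡ (peval (a ∷ d) t))
  proportional (a ∷ d) (b ∷ n) d≉0 e with a ℚₚ.≟ 0ℚ | b ℚₚ.≟ 0ℚ
  ... | no a≢0 | _ = c , λ t → begin
      peval (b ∷ n) t                                      ≡⟨ solve 2 (λ u v → u := u :- v :+ v) refl _ _ ⟩
      peval (b ∷ n) t - c * peval (a ∷ d) t + c * peval (a ∷ d) t
        ≡⟨ cong (_+ c * peval (a ∷ d) t) (trans (sym (m≡ t)) (m≡0 t)) ⟩
      0ℚ + c * peval (a ∷ d) t                             ≡⟨ ℚₚ.+-identityˡ _ ⟩
      c * peval (a ∷ d) t                                  ∎
    where
    open ℚSolver
    instance a-nonZero = ℚ.≢-nonZero a≢0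
    c = b * ℚ.1/ a
    m : Poly
    m = n +ₚ (- c) ·ₚ d
    head≡0 : b + - c * a ≡ 0ℚ
    head≡0 = trans (solve 3 (λ a b i → b :+ :- (b :* i) :* a := b :* (con 1ℚ :- i :* a)) refl a b (ℚ.1/ a))
      (trans (cong (λ u → b * (1ℚ - u)) (ℚₚ.*-inverseˡ a)) (ℚₚ.*-zeroʳ b))
    m≡ : ∀ t → peval (b + - c * a ∷ m) t ≡ peval (b ∷ n) t - c * peval (a ∷ d) t
    m≡ t = trans (peval-+ (b ∷ n) ((- c) ·ₚ (a ∷ d)) t) (cong (peval (b ∷ n) t +_)
      (trans (peval-· (- c) (a ∷ d) t) (sym (ℚₚ.neg-distribˡ-* c (peval (a ∷ d) t)))))
    m′≡ : ∀ t → dval (b + - c * a ∷ m) t ≡ dval (b ∷ n) t - c * dval (a ∷ d) t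
    m′≡ t = trans (dval-+ (b ∷ n) ((- c) ·ₚ (a ∷ d)) t) (cong (dval (b ∷ n) t +_)
      (trans (dval-· (- c) (a ∷ d) t) (sym (ℚₚ.neg-distribˡ-* c (dval (a ∷ d) t)))))
    m≡0 : ∀ t → peval (b + - c * a ∷ m) t ≡ 0ℚ
    m≡0 = vanishes (b + - c * a) m (a ∷ d) head≡0 (λ h → a≢0 (trans (sym (peval-at-0 a d)) h)) λ t → begin
      dval (b + - c * a ∷ m) t * peval (a ∷ d) t      ≡⟨ cong (_* peval (a ∷ d) t) (m′≡ t) ⟩
      (dval (b ∷ n) t - c * dval (a ∷ d) t) * peval (a ∷ d) t
        ≡⟨ solve 4 (λ n′ c d′ d → (n′ :- c :* d′) :* d := n′ :* d :- c :* d :* d′) refl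
             (dval (b ∷ n) t) c (dval (a ∷ d) t) (peval (a ∷ d) t) ⟩
      dval (b ∷ n) t * peval (a ∷ d) t - c * peval (a ∷ d) t * dval (a ∷ d) t
        ≡⟨ cong (_- c * peval (a ∷ d) t * dval (a ∷ d) t) (e t) ⟩
      peval (b ∷ n) t * dval (a ∷ d) t - c * peval (a ∷ d) t * dval (a ∷ d) t
        ≡⟨ solve 4 (λ n c d d′ → n :* d′ :- c :* d :* d′ := (n :- c :* d) :* d′) refl
             (peval (b ∷ n) t) c (peval (a ∷ d) t) (dval (a ∷ d) t) ⟩
      (peval (b ∷ n) t - c * peval (a ∷ d) t) * dval (a ∷ d) t ≡⟨ cong (_* dval (a ∷ d) t) (m≡ t) ⟨
      peval (b + - c * a ∷ m) t * dval (a ∷ d) t      ∎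
  ... | yes a≡0 | no b≢0 = contradiction
    (≈ₚ-from-values (a ∷ d) 0ₚ (vanishes a d (b ∷ n) a≡0 (λ h → b≢0 (trans (sym (peval-at-0 b n)) h)) (λ t →
      trans (ℚₚ.*-comm (dval (a ∷ d) t) (peval (b ∷ n) t))
        (trans (sym (e t)) (ℚₚ.*-comm (dval (b ∷ n) t) (peval (a ∷ d) t))))))
    d≉0
  ... | yes refl | yes refl = map₂
    (λ {c} h t → trans (peval-0∷ n t) (trans (cong (t *_) (h t)) (trans
      (solve 3 (λ t c d → t :* (c :* d) := c :* (t :* d)) refl t c (peval d t))
      (cong (c *_) (sym (peval-0∷ d t))))))
    (proportional d n (d≉0 ∘ 0∷≈0 refl) divided)
    where
    open ℚSolver
    lhs rhs : Poly
    lhs = derivₚ n *ₚ d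
    rhs = n *ₚ derivₚ d
    -- The product rule puts the term `n * (t * d)` on both sides; without it, what remains is the
    -- relation for `n` and `d` times `t²`.
    times-t² : ∀ t → t * peval (0ℚ ∷ lhs) t ≡ t * peval (0ℚ ∷ rhs) t
    times-t² t = begin
      t * peval (0ℚ ∷ lhs) t
        ≡⟨ cong (t *_) (trans (peval-0∷ lhs t) (cong (t *_) (peval-* (derivₚ n) d t))) ⟩
      t * (t * (dval n t * peval d t))
        ≡⟨ solve 4 (λ t n n′ d → t :* (t :* (n′ :* d)) := (n :+ t :* n′) :* (t :* d) :- n :* (t :* d)) refl
             t (peval n t) (dval n t) (peval d t) ⟩
      (peval n t + t * dval n t) * (t * peval d t) - peval n t * (t * peval d t)
        ≡⟨ cong (_- peval n t * (t * peval d t)) (trans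
             (sym (cong₂ _*_ (dval-∷ 0ℚ n t) (peval-0∷ d t))) (trans (e t)
             (cong₂ _*_ (peval-0∷ n t) (dval-∷ 0ℚ d t)))) ⟩
      t * peval n t * (peval d t + t * dval d t) - peval n t * (t * peval d t)
        ≡⟨ solve 4 (λ t n d d′ → t :* n :* (d :+ t :* d′) :- n :* (t :* d) := t :* (t :* (n :* d′))) refl
             t (peval n t) (peval d t) (dval d t) ⟩
      t * (t * (peval n t * dval d t))
        ≡⟨ cong (t *_) (trans (peval-0∷ rhs t) (cong (t *_) (peval-* n (derivₚ d) t))) ⟨
      t * peval (0ℚ ∷ rhs) t ∎
    divided : SameLogDeriv n d
    divided t = trans (sym (peval-* (derivₚ n) d t)) (trans
      (≡-from-0∷ lhs rhs (λ t → trans (sym (peval-0∷ lhs t))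
        (trans (≡-from-0∷ (0ℚ ∷ lhs) (0ℚ ∷ rhs) times-t² t) (peval-0∷ rhs t))) t)
      (peval-* n (derivₚ d) t))

  private
    module K = DenseOrderedField K
  open Bipartitions K

  -- ℚ(α) meets the hypotheses of the classification.

  deriv-isDerivation : IsDerivation deriv
  deriv-isDerivation = record
    { δ-cong = λ {r} {s} → deriv-cong {r} {s}
    ; δ-+    = deriv-⊕
    ; δ-*    = deriv-⊗
    ; δ-ι    = λ q → deriv-poly (q ∷ [])
    }

  generator : RatFun
  generator = poly (0ℚ ∷ 1ℚ ∷ [])

  deriv-generator : deriv generator ≈ rational 1ℚ
  deriv-generator = K.≃-trans {deriv generator} {poly (derivₚ (0ℚ ∷ 1ℚ ∷ []))} {rational 1ℚ}
    (deriv-poly (0ℚ ∷ 1ℚ ∷ []))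
    (value-injective {poly (derivₚ (0ℚ ∷ 1ℚ ∷ []))} {rational 1ℚ} (always λ n → trans
      (value-poly (derivₚ (0ℚ ∷ 1ℚ ∷ [])) n)
      (trans (cong (1ℚ +_) (trans (cong (seq α n *_) (peval-const 0ℚ (seq α n))) (ℚₚ.*-zeroʳ (seq α n))))
        (sym (value-rational 1ℚ n)))))

  inverse : ∀ {r} → ℚ⟨α⟩⁺ α tr r → ∃[ s ] s ⊗ r ≈ rational 1ℚ
  inverse {r} r>0 = mkRatFun (den r) (num r) num≉0
    , ≈-from-values {mkRatFun (den r) (num r) num≉0 ⊗ r} {rational 1ℚ} λ t →
        trans (cong (_* peval (1ℚ ∷ []) t) (trans (peval-* (den r) (num r) t)
          (trans (ℚₚ.*-comm (peval (den r) t) (peval (num r) t)) (sym (peval-* (num r) (den r) t)))))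
        (ℚₚ.*-comm (peval (num r *ₚ den r) t) (peval (1ℚ ∷ []) t))
    where
    num≉0 : ¬ num r ≈ₚ 0ₚ
    num≉0 n≈0 = ¬pos-0 (pos-resp (always λ n → trans
      (cong (_* inv-den r n) (peval-cong (num r) 0ₚ n≈0 (seq α n))) (ℚₚ.*-zeroˡ (inv-den r n)))
      (pos-elim {r} r>0))

  constant : ∀ r → deriv r ≈ rational 0ℚ → ∃[ q ] r ≈ rational q
  constant r e = map₂
    (λ {c} h → ≈-from-values {r} {rational c} λ t → trans (cong₂ _*_ (h t) (peval-const 1ℚ t))
      (trans (ℚₚ.*-identityʳ (c * peval (den r) t)) (cong (_* peval (den r) t) (sym (peval-const c t)))))
    (proportional (den r) (num r) (den≉0 r) λ t → difference-0 (dval (num r) t * peval (den r) t) _ (begin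
      wronskian r t                          ≡⟨ num-deriv r t ⟨
      peval (num (deriv r)) t                ≡⟨ ℚₚ.*-identityʳ _ ⟨
      peval (num (deriv r)) t * 1ℚ           ≡⟨ cong (peval (num (deriv r)) t *_) (peval-const 1ℚ t) ⟨
      peval (num (deriv r)) t * peval (1ℚ ∷ []) t ≡⟨ ≈-values {deriv r} {rational 0ℚ} e t ⟩
      peval (0ℚ ∷ []) t * peval (den (deriv r)) t ≡⟨ cong (_* peval (den (deriv r)) t) (peval-const 0ℚ t) ⟩
      0ℚ * peval (den (deriv r)) t           ≡⟨ ℚₚ.*-zeroˡ (peval (den (deriv r)) t) ⟩
      0ℚ                                     ∎))
    where
    difference-0 : ∀ u v → u - v ≡ 0ℚ → u ≡ v
    difference-0 u v e = trans (solve 2 (λ u v → u := u :- v :+ v) refl u v)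
      (trans (cong (_+ v) e) (ℚₚ.+-identityˡ v))
      where open ℚSolver

  poly-closed : ∀ {ℓ} {S : Pred RatFun ℓ} → IsSubring S → S generator → ∀ p → S (poly p)
  poly-closed {S = S} sub s []      = S-resp {rational 0ℚ} {poly []}
    (value-injective {rational 0ℚ} {poly []} (always λ n → trans (value-rational 0ℚ n) (sym (value-poly [] n))))
    (S-ι 0ℚ)
    where open IsSubring sub
  poly-closed {S = S} sub s (a ∷ p) = S-resp {rational a ⊕ generator ⊗ poly p} {poly (a ∷ p)}
    (value-injective {rational a ⊕ generator ⊗ poly p} {poly (a ∷ p)}
      (value-⊕ (rational a) (generator ⊗ poly p) ∙∙
       eventually₁ (λ n e → trans (cong₂ _+_ (value-rational a n) (trans e
           (cong₂ _*_ (trans (value-poly (0ℚ ∷ 1ℚ ∷ []) n) (simplify (seq α n))) (value-poly p n))))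
           (sym (value-poly (a ∷ p) n)))
         (value-⊗ generator (poly p))))
    (S-+ {rational a} {generator ⊗ poly p} (S-ι a) (S-* {generator} {poly p} s (poly-closed sub s p)))
    where
    open IsSubring sub
    simplify : ∀ t → 0ℚ + t * (1ℚ + t * 0ℚ) ≡ t
    simplify = solve 1 (λ t → con 0ℚ :+ t :* (con 1ℚ :+ t :* con 0ℚ) := t) refl
      where open ℚSolver

  -- The denominator is a nonzero polynomial and so has a sign at `α`; `w` is the denominator or its
  -- negative.
  fraction : ∀ {ℓ} {S : Pred RatFun ℓ} → IsSubring S → S generator →
    ∀ r → ∃[ w ] (ℚ⟨α⟩⁺ α tr w × S w × S (r ⊗ w))
  fraction {S = S} sub s r =
    [ (λ p → poly (den r) , p , S-poly (den r) , S-resp {poly (num r)} {r ⊗ poly (den r)}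
        (scaled (num r) (den r) (λ t → refl)) (S-poly (num r)))
    , [ (λ e → contradiction (den≈0 e) (den≉0 r))
      , (λ p → ⊖ poly (den r) , p , S-poly ((- 1ℚ) ·ₚ den r) , S-resp {⊖ poly (num r)} {r ⊗ ⊖ poly (den r)}
          (scaled ((- 1ℚ) ·ₚ num r) ((- 1ℚ) ·ₚ den r) (λ t → trans (cong (_* peval (den r) t) (peval-· (- 1ℚ) (num r) t))
            (trans (rotate (- 1ℚ) (peval (num r) t) (peval (den r) t))
              (cong (peval (num r) t *_) (sym (peval-· (- 1ℚ) (den r) t))))))
          (S-poly ((- 1ℚ) ·ₚ num r)))
      ]′ ]′ (K.trichotomy (poly (den r)))
    where
    open IsSubring sub
    S-poly = poly-closed sub s
    rotate : ∀ c n d → c * n * d ≡ n * (c * d)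
    rotate = solve 3 (λ c n d → c :* n :* d := n :* (c :* d)) refl
      where open ℚSolver
    scaled : ∀ n d → (∀ t → peval n t * peval (den r) t ≡ peval (num r) t * peval d t) →
      poly n ≈ r ⊗ poly d
    scaled n d h = ≈-from-values {poly n} {r ⊗ poly d} λ t → begin
      peval n t * peval (den r *ₚ (1ℚ ∷ [])) t            ≡⟨ cong (peval n t *_) (peval-* (den r) (1ℚ ∷ []) t) ⟩
      peval n t * (peval (den r) t * peval (1ℚ ∷ []) t)   ≡⟨ ℚₚ.*-assoc (peval n t) (peval (den r) t) _ ⟨
      peval n t * peval (den r) t * peval (1ℚ ∷ []) t     ≡⟨ cong (_* peval (1ℚ ∷ []) t) (h t) ⟩
      peval (num r) t * peval d t * peval (1ℚ ∷ []) t     ≡⟨ cong (_* peval (1ℚ ∷ []) t) (peval-* (num r) d t) ⟨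
      peval (num r *ₚ d) t * peval (1ℚ ∷ []) t            ∎
    den≈0 : poly (den r) ≈ rational 0ℚ → den r ≈ₚ 0ₚ
    den≈0 e = ≈0-from-germ (den r) (eventually₁ (λ n eq → trans (sym (value-poly (den r) n))
      (trans eq (value-rational 0ℚ n))) (value-cong {poly (den r)} {rational 0ℚ} e))

  -- Identification of the halves with `H₊`, `H₀` and `H₋`.

  rising≐H₊ : Rising deriv ≐ H₊ α tr
  rising≐H₊ = id , id

  falling≐H₋ : Rising (⊖_ ∘ deriv) ≐ H₋ α tr
  falling≐H₋ = (λ {r} (p , q) → p , neg-intro {deriv r} (pos-resp (always (value-⊖ (deriv r))) (pos-elim {⊖ deriv r} q)))
             , (λ {r} (p , q) → p , ⊖-pos {deriv r} (neg-elim {deriv r} q))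
    where
    ⊖-pos : ∀ {r} → EventuallyPos (λ n → - value r n) → ℚ⟨α⟩⁺ α tr (⊖ r)
    ⊖-pos {r} p = pos-intro {⊖ r} (pos-resp (always λ n → sym (value-⊖ r n)) p)

  eval≈0 : ∀ {r} → r ≈ rational 0ℚ → eval α tr r ≈ᵣ 0ᵣ
  eval≈0 {r} r≈0 ε 0<ε = eventually₁
    (λ n e → subst (_< ε) (cong (λ u → ∣ u - 0ℚ ∣) (sym (trans (seq-eval r n) (trans e (value-rational 0ℚ n))))) 0<ε)
    (value-cong {r} {rational 0ℚ} r≈0)

  -- A real equal to 0 has neither sign, so trichotomy leaves only formal vanishing. This turns the
  -- real condition in `H₀` into an algebraic one.
  ≈0-from-eval : ∀ {r} → eval α tr r ≈ᵣ 0ᵣ → r ≈ rational 0ℚ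
  ≈0-from-eval {r} small =
    [ (λ p → contradiction (pos-elim {r} p) (not-pos (value r) λ n → ℚₚ.≤-trans (p≤∣p∣ (value r n)) (bound n)))
    , [ id
      , (λ p → contradiction (pos-resp (always (value-⊖ r)) (pos-elim {⊖ r} p)) (not-pos (λ n → - value r n) λ n →
          ℚₚ.≤-trans (p≤∣p∣ (- value r n)) (ℚₚ.≤-trans (ℚₚ.≤-reflexive (ℚₚ.∣-p∣≡∣p∣ (value r n))) (bound n))))
      ]′ ]′ (K.trichotomy r)
    where
    bound : ∀ n → ∣ value r n ∣ ≤ ∣ seq (eval α tr r) n - 0ℚ ∣
    bound n = ℚₚ.≤-reflexive (cong ∣_∣ (sym (trans (ℚₚ.+-identityʳ (seq (eval α tr r) n)) (seq-eval r n))))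
    not-pos : ∀ f → (∀ n → f n ≤ ∣ seq (eval α tr r) n - 0ℚ ∣) → ¬ EventuallyPos f
    not-pos f f≤ (ε , 0<ε , h) = let n , ε<f , f<ε = eventually-inhabited (eventually₂
                                       (λ n a b → a , b) h (small ε 0<ε))
      in ℚₚ.<-asym ε<f (ℚₚ.≤-<-trans (f≤ n) f<ε)

  nonRising≐H₀∪H₋ : NonRising deriv ≐ H₀ α tr ∪ H₋ α tr
  nonRising≐H₀∪H₋ =
      (λ { {r} (p , inj₁ e) → inj₁ (p , eval≈0 {deriv r} e)
         ; {r} (p , inj₂ q) → inj₂ (proj₁ falling≐H₋ {r} (p , q)) })
    , (λ { {r} (inj₁ (p , e)) → p , inj₁ (≈0-from-eval {deriv r} e)
         ; {r} (inj₂ h) → map₂ inj₂ (proj₂ falling≐H₋ {r} h) })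

  nonFalling≐H₊∪H₀ : NonRising (⊖_ ∘ deriv) ≐ H₊ α tr ∪ H₀ α tr
  nonFalling≐H₊∪H₀ =
      (λ { {r} (p , inj₁ e) → inj₂ (p , eval≈0 {deriv r} (neg-zero⁻¹ {deriv r} e))
         ; {r} (p , inj₂ q) → inj₁ (p , K.Pos-resp {⊖ ⊖ deriv r} {deriv r} (neg-neg {deriv r}) q) })
    , (λ { {r} (inj₁ (p , q)) → p , inj₂ (K.Pos-resp {deriv r} {⊖ ⊖ deriv r}
              (K.≃-sym {⊖ ⊖ deriv r} {deriv r} (neg-neg {deriv r})) q)
         ; {r} (inj₂ (p , e)) → p , inj₁ (neg-zero {deriv r} (≈0-from-eval {deriv r} e)) })

  -- Decompositions as bipartitions, and the conclusion.

  toBipartition : ∀ {ℓ₁ ℓ₂} {A : Pred RatFun ℓ₁} {B : Pred RatFun ℓ₂} →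
    IsDecomposition (ℚ⟨α⟩⁺ α tr) A B → IsBipartition A B
  toBipartition dec = record
    { A-resp = λ {r} {s} → A-resp-≈ {r} {s} ; B-resp = λ {r} {s} → B-resp-≈ {r} {s}
    ; cover = λ {r} → proj₂ union {r}
    ; A-pos = λ {r} → proj₁ union {r} ∘ inj₁ ; B-pos = λ {r} → proj₁ union {r} ∘ inj₂
    ; disjoint = λ {r} a b → IsDecomposition.disjoint dec {r} (a , b)
    ; A-+ = λ {r} {s} → A-closed-⊕ {r} {s} ; A-* = λ {r} {s} → A-closed-⊗ {r} {s}
    ; B-+ = λ {r} {s} → B-closed-⊕ {r} {s} ; B-* = λ {r} {s} → B-closed-⊗ {r} {s}
    }
    where open IsDecomposition dec

  fromBipartition : ∀ {ℓ₁ ℓ₂ ℓ₃ ℓ₄} {A : Pred RatFun ℓ₁} {B : Pred RatFun ℓ₂}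
    {A′ : Pred RatFun ℓ₃} {B′ : Pred RatFun ℓ₄} → IsBipartition A B → Satisfiable A → Satisfiable B →
    A ≐ A′ → B ≐ B′ → IsDecomposition (ℚ⟨α⟩⁺ α tr) A′ B′
  fromBipartition p (a , a∈A) (b , b∈B) (A⇒ , A⇐) (B⇒ , B⇐) = record
    { A-resp-≈   = λ {r} {s} r≈s → A⇒ {s} ∘ A-resp p {r} {s} r≈s ∘ A⇐ {r}
    ; B-resp-≈   = λ {r} {s} r≈s → B⇒ {s} ∘ B-resp p {r} {s} r≈s ∘ B⇐ {r}
    ; union      = (λ {r} → [ A-pos p {r} ∘ A⇐ {r} , B-pos p {r} ∘ B⇐ {r} ]′)
                 , (λ {r} → Sum.map (A⇒ {r}) (B⇒ {r}) ∘ cover p {r})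
    ; disjoint   = λ {r} (x , y) → disjoint p {r} (A⇐ {r} x) (B⇐ {r} y)
    ; A-nonempty = a , A⇒ {a} a∈A
    ; B-nonempty = b , B⇒ {b} b∈B
    ; A-closed-⊕ = λ {r} {s} x y → A⇒ {r ⊕ s} (A-+ p {r} {s} (A⇐ {r} x) (A⇐ {s} y))
    ; A-closed-⊗ = λ {r} {s} x y → A⇒ {r ⊗ s} (A-* p {r} {s} (A⇐ {r} x) (A⇐ {s} y))
    ; B-closed-⊕ = λ {r} {s} x y → B⇒ {r ⊕ s} (B-+ p {r} {s} (B⇐ {r} x) (B⇐ {s} y))
    ; B-closed-⊗ = λ {r} {s} x y → B⇒ {r ⊗ s} (B-* p {r} {s} (B⇐ {r} x) (B⇐ {s} y))
    }

  neg-deriv-isDerivation : IsDerivation (⊖_ ∘ deriv)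
  neg-deriv-isDerivation = IsDerivation.neg-isDerivation deriv-isDerivation

  neg-deriv-generator : ⊖ deriv (⊖ generator) ≈ rational 1ℚ
  neg-deriv-generator = K.≃-trans {⊖ deriv (⊖ generator)} {⊖ ⊖ deriv generator} {rational 1ℚ}
    (K.-‿cong {deriv (⊖ generator)} {⊖ deriv generator} (IsDerivation.δ-neg deriv-isDerivation generator))
    (K.≃-trans {⊖ ⊖ deriv generator} {deriv generator} {rational 1ℚ}
      (neg-neg {deriv generator}) deriv-generator)

  H₊∪H₀-H₋ : IsDecomposition (ℚ⟨α⟩⁺ α tr) (H₊ α tr ∪ H₀ α tr) (H₋ α tr)
  H₊∪H₀-H₋ = fromBipartition (rising-isBipartition neg-deriv-isDerivation)
    (rational 1ℚ , nonRising-1 neg-deriv-isDerivation)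
    (rising-satisfiable neg-deriv-isDerivation {⊖ generator} neg-deriv-generator)
    nonFalling≐H₊∪H₀ falling≐H₋

  H₊-H₀∪H₋ : IsDecomposition (ℚ⟨α⟩⁺ α tr) (H₊ α tr) (H₀ α tr ∪ H₋ α tr)
  H₊-H₀∪H₋ = fromBipartition (swap-bipartition (rising-isBipartition deriv-isDerivation))
    (rising-satisfiable deriv-isDerivation {generator} deriv-generator)
    (rational 1ℚ , nonRising-1 deriv-isDerivation)
    rising≐H₊ nonRising≐H₀∪H₋

  halves-if-1∈A : ∀ {ℓ₁ ℓ₂} {A : Pred RatFun ℓ₁} {B : Pred RatFun ℓ₂} → IsBipartition A B →
    A (rational 1ℚ) → Satisfiable B →
    (A ≐ H₊ α tr ∪ H₀ α tr × B ≐ H₋ α tr) ⊎ (A ≐ H₀ α tr ∪ H₋ α tr × B ≐ H₊ α tr)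
  halves-if-1∈A p 1∈A (b , b∈B) =
    [ (λ d → let A≐ , B≐ = decides⇒≐ {deriv} p d in
        inj₂ (≐-trans A≐ nonRising≐H₀∪H₋ , ≐-trans B≐ rising≐H₊))
    , (λ d → let A≐ , B≐ = decides⇒≐ {⊖_ ∘ deriv} p d in
        inj₁ (≐-trans A≐ nonFalling≐H₊∪H₀ , ≐-trans B≐ falling≐H₋))
    ]′ (Classification.classification deriv-isDerivation {generator} deriv-generator
          (λ {r} → inverse {r}) fraction constant p 1∈A {b} b∈B)

  -- The part containing 1 takes the role of A in the classification; if it is the second part, the
  -- two are exchanged, which the unordered conclusion absorbs.
  only-halves : ∀ {ℓ₁ ℓ₂} (A : Pred RatFun ℓ₁) (B : Pred RatFun ℓ₂) →
    IsDecomposition (ℚ⟨α⟩⁺ α tr) A B →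
    SameUnorderedPair A B (H₊ α tr ∪ H₀ α tr) (H₋ α tr)
    ⊎ SameUnorderedPair A B (H₊ α tr) (H₀ α tr ∪ H₋ α tr)
  only-halves A B dec =
    [ (λ 1∈A → Sum.map inj₁ inj₂ (halves-if-1∈A p 1∈A (IsDecomposition.B-nonempty dec)))
    , (λ 1∈B → Sum.map (inj₂ ∘ swap) (inj₁ ∘ swap)
        (halves-if-1∈A (swap-bipartition p) 1∈B (IsDecomposition.A-nonempty dec)))
    ]′ (cover p {rational 1ℚ} Pos-1)
    where
    p = toBipartition dec

theorem2p2 : (ℓ₁ ℓ₂ : Level)
    (α : ℝ) (tr : Transcendental α) →
    IsDecomposition (ℚ⟨α⟩⁺ α tr) (H₊ α tr ∪ H₀ α tr) (H₋ α tr)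
    × IsDecomposition (ℚ⟨α⟩⁺ α tr) (H₊ α tr) (H₀ α tr ∪ H₋ α tr)
    × ((A : Pred RatFun ℓ₁) (B : Pred RatFun ℓ₂) →
       IsDecomposition (ℚ⟨α⟩⁺ α tr) A B →
       SameUnorderedPair A B (H₊ α tr ∪ H₀ α tr) (H₋ α tr)
       ⊎ SameUnorderedPair A B (H₊ α tr) (H₀ α tr ∪ H₋ α tr))
theorem2p2 ℓ₁ ℓ₂ α tr = H₊∪H₀-H₋ , H₊-H₀∪H₋ , only-halves
  where open TranscendentalReal α tr
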